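{- Let $V=\{a^n : a,n \in \mathbb{N},\ n\ge 2\}$ be the set of pure powers. Let $a_1, \ldots, a_d$ be positive integers such that $H(0; a_1, \ldots, a_d) \subset V \cap [1,N]$. If the $a_i$ are pairwise distinct, then for sufficiently large $N$ \[ d \ll \frac{(\log \log N)^3}{\log \log \log N}; \] in general (the $a_i$ not necessarily distinct), for sufficiently large $N$ \[ d \ll \frac{(\log \log N)^4}{(\log \log \log N)^2}. \] The implied constants are absolute.
   Context: $H(0;a_1,\dots,a_d)=\{\sum_{i=1}^d \varepsilon_i a_i : \varepsilon_i\in\{0,1\},\ \sum_i \varepsilon_i>0\}$ (the set of non-empty subset sums). $X \ll Y$ means $X \le C Y$ for some constant $C>0$. $\log$ is the natural logarithm. -}

module Defs where

open import Data.Nat using (ℕ; zero; suc; _+_; _*_; _^_; _≤_)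
open import Data.Nat.Logarithm using (⌊log₂_⌋)
open import Data.Bool using (true; false)
open import Data.Fin using (Fin) renaming (zero to fzero; suc to fsuc)
open import Data.Fin.Subset using (Subset; Nonempty)
open import Data.Vec using ([]; _∷_)
open import Data.Product using (∃₂; _×_)
open import Relation.Binary.PropositionalEquality using (_≡_)

PurePower : ℕ → Set
PurePower x = ∃₂ λ b n → 2 ≤ n × x ≡ b ^ n

subsetSum : ∀ {d} → (Fin d → ℕ) → Subset d → ℕ
subsetSum {zero}  a []            = 0
subsetSum {suc d} a (true  ∷ p)   = a fzero + subsetSum (λ i → a (fsuc i)) p
subsetSum {suc d} a (false ∷ p)   = subsetSum (λ i → a (fsuc i)) p

HinVN : ∀ {d} → (Fin d → ℕ) → ℕ → Set
HinVN {d} a N = (p : Subset d) → Nonempty p →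
  PurePower (subsetSum a p) × 1 ≤ subsetSum a p × subsetSum a p ≤ N

-- Integer surrogates for iterated logarithms (floor of base-2 log).
L2 L3 : ℕ → ℕ
L2 N = ⌊log₂ ⌊log₂ N ⌋ ⌋
L3 N = ⌊log₂ L2 N ⌋

{-# OPTIONS --safe #-}
module Submission where

-- Let A and B be sets of K positive integers such that A + B consists of pure powers below 2^M.  Write α + β = z^q with q
-- prime and colour (α, β) by q and the dyadic scale of z.  Around a monochromatic 4-cycle, let X and Y be the products of
-- the roots at opposite edges; then X^q − Y^q is (α − α′)(β − β′) up to sign, so |X − Y| is far smaller than X.  On the
-- other hand the q-th roots of unity modulo p form at most q classes, and averaging over these classes, prime by prime,
-- shows that for many 4-cycles X − Y is divisible by most of (α − α′)(β − β′).  Comparing the two bounds, a monochromatic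
-- graph has few non-degenerate 4-cycles, so K is polynomial in M.
--
-- Hence, when the a_i are split in two, one part has only M^O(1) distinct sub-sums.  By Cauchy–Davenport, k ≤ p − 1 numbers
-- of equal p-adic valuation have k + 1 sub-sums distinct modulo a higher power of p.  So discarding a few elements of least
-- valuation at a time stops early, and leaves a set in which, for every prime p between about √n and n = log log N, many
-- elements have the least valuation u_p.  There are so many of these primes that, for some p and a few primes r, no g ≥ 2
-- divides u_p + 1 and all the u_r.  But some sub-sum has valuation u_p + 1 at p and u_r at these r: it is not a pure power.

open import Defs
open import Data.Bool using (true; false)
open import Data.Empty using (⊥; ⊥-elim)
open import Data.Fin using (Fin; toℕ; fromℕ<; combine; remQuot; inject≤) renaming (zero to fzero; suc to fsuc)
open import Data.Fin.Properties using (toℕ<n; toℕ-injective; toℕ-fromℕ<; pigeonhole; any?; all?; combine-injective; combine-remQuot; inject≤-injective) renaming (_≟_ to _≟F_; suc-injective to fsuc-injective)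
open import Data.Fin.Subset using (Subset; Nonempty)
open import Data.Integer using (ℤ)
import Data.Integer as ℤ
import Data.Integer.Properties as ℤP
import Data.Integer.Divisibility.Signed as ℤD
import Data.Integer.Tactic.RingSolver as ℤR
open import Data.List using (List; []; _∷_; _++_; length; map; filter; take; drop; tabulate; lookup; upTo)
import Data.List.Properties as Lₚ
open import Data.List.Properties using (length-map; length-++; length-tabulate; take++drop≡id; length-take)
open import Data.List.Membership.Propositional using (_∈_)
open import Data.List.Membership.Propositional.Properties using (∈-filter⁺; ∈-upTo⁺; ∈-upTo⁻; ∈-lookup)
open import Data.List.Relation.Binary.Permutation.Propositional using (_↭_; ↭-refl; ↭-sym; ↭-trans; prep; swap; ↭-reflexive)
import Data.List.Relation.Binary.Permutation.Propositional as Perm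
open import Data.List.Relation.Binary.Permutation.Propositional.Properties using (++⁺ˡ; shift; ↭-length; All-resp-↭; ++-comm)
open import Data.List.Relation.Unary.All using (All; []; _∷_)
import Data.List.Relation.Unary.All as All
import Data.List.Relation.Unary.All.Properties as AllP
open import Data.List.Relation.Unary.AllPairs using (AllPairs; []; _∷_)
import Data.List.Relation.Unary.AllPairs.Properties as AllPairsP
open import Data.List.Relation.Unary.Any using (here; there)
import Data.List.Relation.Unary.Unique.Propositional.Properties as Uniq
open import Data.Nat
open import Data.Nat.Properties
open import Algebra.Properties.Semiring.Sum +-*-semiring using (sum; ∑-distrib-+; ∑-comm; *-distribˡ-sum; *-distribʳ-sum) renaming (sum-cong-≗ to sum-cong)
import Algebra.Properties.CommutativeMonoid.Sum *-1-commutativeMonoid as Prod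
open import Data.Nat.Combinatorics using (nC1≡n; nCk+nC[k+1]≡[n+1]C[k+1]; k>n⇒nCk≡0) renaming (_C_ to _choose_)
open import Data.Nat.Coprimality using (Coprime; coprime-divisor; coprime-Bézout)
import Data.Nat.Coprimality as Cop
open import Data.Nat.Divisibility
open import Data.Nat.DivMod hiding (_mod_)
open import Data.Nat.GCD
open import Data.Nat.ListAction using (product)
open import Data.Nat.Induction using (<-rec)
open import Data.Nat.Logarithm using (⌊log₂_⌋; ⌊log₂⌋-mono-≤; ⌊log₂[2^n]⌋≡n; ⌊log₂⌊n/2⌋⌋≡⌊log₂n⌋∸1)
open import Data.Nat.Primality
open import Data.Nat.Tactic.RingSolver using (solve-∀)
open import Data.Product using (∃; ∃₂; _×_; _,_; proj₁; proj₂)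
open import Data.Sum using (_⊎_; inj₁; inj₂; [_,_]′)
open import Data.Vec using ([]; _∷_; here; there)
open import Function using (_∘_; id; case_of_)
open import Function.Definitions using (Injective)
open import Relation.Binary.Definitions using (tri<; tri≈; tri>)
open import Relation.Binary.PropositionalEquality using (_≡_; _≢_; refl; sym; trans; cong; cong₂; subst; subst₂; module ≡-Reasoning)
open import Relation.Nullary using (¬_; Dec; yes; no; ¬?; _×-dec_)
open import Relation.Nullary.Decidable using (decidable-stable)
open import Relation.Unary using (Decidable)

-- Valuations

-- Where the bound n³ / log n, with n = log log N, comes from. The u_p may well share a factor, for
-- instance all be even, so they alone exclude no exponent; raising a single one by 1 is what breaks
-- it. Since u_p < M = 2^(n+1), a gcd of them is lowered at most about √n times by a factor 2^√n,
-- and then about √n halvings suffice. So valuations at about √n primes have to be controlled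
-- simultaneously. Each of them takes about √n blocks, and one block takes 3 p = O(n) elements.
-- Hence "many elements of least valuation" must mean m, of order n².
--
-- A prime with fewer than m such elements allows them to be discarded at a profit. With 2^l about
-- √n and below all the primes, a batch of at least 2^l - 1 elements multiplies the number of
-- distinct sub-sums by 2^l, and a smaller batch still doubles it. A doubling thus costs about m / l
-- elements at worst. As M^O(1) sub-sums leave room for only O(n) doublings, the whole set has O(n m
-- / l) elements; this division by l is the triple logarithm in the bound.

maxPower : (p x fuel : ℕ) → ℕ
maxPower p x zero = 0
maxPower p x (suc k) with p ^ suc k ∣? x
... | yes _ = suc k
... | no _ = maxPower p x k

-- The p-adic valuation; the fuel x suffices because k < p ^ k.  Meaningful only for p ≥ 2 and x > 0.
val : ℕ → ℕ → ℕ
val p x = maxPower p x x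

m≤n⇒p^m∣p^n : ∀ p {m n} → m ≤ n → p ^ m ∣ p ^ n
m≤n⇒p^m∣p^n p {m} {n} m≤n =
  divides (p ^ (n ∸ m)) (trans (cong (p ^_) (sym (m∸n+n≡m m≤n))) (^-distribˡ-+-* p (n ∸ m) m))

maxPower-∣ : ∀ p x f → p ^ maxPower p x f ∣ x
maxPower-∣ p x zero = 1∣ x
maxPower-∣ p x (suc k) with p ^ suc k ∣? x
... | yes d = d
... | no _ = maxPower-∣ p x k

maxPower-max : ∀ p x f k → k ≤ f → p ^ k ∣ x → k ≤ maxPower p x f
maxPower-max p x zero zero k≤f d = z≤n
maxPower-max p x (suc f) k k≤f d with p ^ suc f ∣? x
... | yes _ = k≤f
... | no nd with m≤n⇒m<n∨m≡n k≤f
... | inj₁ (s≤s k≤f′) = maxPower-max p x f k k≤f′ d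
... | inj₂ refl = ⊥-elim (nd d)

n<2^n : ∀ n → n < 2 ^ n
n<2^n zero = s≤s z≤n
n<2^n (suc n) = ≤-trans (+-mono-≤ (≤-trans (s≤s z≤n) (n<2^n n)) (n<2^n n))
  (≤-reflexive (cong (λ t → 2 ^ n + t) (sym (+-identityʳ (2 ^ n)))))

n<p^n : ∀ {p} n → 2 ≤ p → n < p ^ n
n<p^n n 2≤p = <-≤-trans (n<2^n n) (^-monoˡ-≤ n 2≤p)

∣⇒≤′ : ∀ {m n} → 0 < n → m ∣ n → m ≤ n
∣⇒≤′ 0<n d = ∣⇒≤ {{>-nonZero 0<n}} d

∣⇒≤val : ∀ {p x k} → 2 ≤ p → 0 < x → p ^ k ∣ x → k ≤ val p x
∣⇒≤val {p} {x} {k} 2≤p 0<x d =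
  maxPower-max p x x k (<⇒≤ (<-≤-trans (n<p^n k 2≤p) (∣⇒≤′ 0<x d))) d

≤val⇒∣ : ∀ p x {k} → k ≤ val p x → p ^ k ∣ x
≤val⇒∣ p x le = ∣-trans (m≤n⇒p^m∣p^n p le) (maxPower-∣ p x x)

prime⇒2≤ : ∀ {p} → Prime p → 2 ≤ p
prime⇒2≤ {p} pr = nonTrivial⇒n>1 p {{prime⇒nonTrivial pr}}

prime⇒0< : ∀ {p} → Prime p → 0 < p
prime⇒0< pr = <-trans (s≤s z≤n) (prime⇒2≤ pr)

^>0 : ∀ {p} k → 0 < p → 0 < p ^ k
^>0 {p} k 0<p = m^n>0 p {{>-nonZero 0<p}} k

*>0 : ∀ {x y} → 0 < x → 0 < y → 0 < x * y
*>0 = *-mono-≤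

*>0⇒ˡ : ∀ x {y} → 0 < x * y → 0 < x
*>0⇒ˡ zero ()
*>0⇒ˡ (suc x) _ = s≤s z≤n

*>0⇒ʳ : ∀ x {y} → 0 < x * y → 0 < y
*>0⇒ʳ x {y} lt = *>0⇒ˡ y (subst (0 <_) (*-comm x y) lt)

unitPart : ℕ → ℕ → ℕ
unitPart p x = quotient (maxPower-∣ p x x)

unitPart-eq : ∀ p x → x ≡ p ^ val p x * unitPart p x
unitPart-eq p x = m∣n⇒n≡m*quotient (maxPower-∣ p x x)

unitPart>0 : ∀ p x → 0 < x → 0 < unitPart p x
unitPart>0 p x 0<x = *>0⇒ʳ (p ^ val p x) (subst (0 <_) (unitPart-eq p x) 0<x)

p∤unitPart : ∀ {p x} → 2 ≤ p → 0 < x → ¬ p ∣ unitPart p x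
p∤unitPart {p} {x} 2≤p 0<x d = <-irrefl refl (∣⇒≤val 2≤p 0<x
  (subst₂ _∣_ (*-comm (p ^ val p x) p) (sym (unitPart-eq p x)) (*-monoʳ-∣ (p ^ val p x) d)))

val-unique : ∀ {p} a y → 2 ≤ p → 0 < y → ¬ p ∣ y → val p (p ^ a * y) ≡ a
val-unique {p} a y 2≤p 0<y nd = ≤-antisym (≮⇒≥ λ a<v →
    nd (*-cancelˡ-∣ (p ^ a) {{>-nonZero 0<pa}} (subst (_∣ p ^ a * y) (*-comm p (p ^ a)) (≤val⇒∣ p (p ^ a * y) a<v))))
    (∣⇒≤val 2≤p (*>0 0<pa 0<y) (m∣m*n y))
  where 0<pa = ^>0 a (<-trans (s≤s z≤n) 2≤p)

∤-* : ∀ {p x y} → Prime p → ¬ p ∣ x → ¬ p ∣ y → ¬ p ∣ x * y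
∤-* {p} {x} {y} pr nx ny d = [ nx , ny ]′ (euclidsLemma x y pr d)

val-* : ∀ {p x y} → Prime p → 0 < x → 0 < y → val p (x * y) ≡ val p x + val p y
val-* {p} {x} {y} pr 0<x 0<y = trans (cong (val p) eq)
    (val-unique (val p x + val p y) (unitPart p x * unitPart p y) 2≤p
      (*>0 (unitPart>0 p x 0<x) (unitPart>0 p y 0<y))
      (∤-* pr (p∤unitPart 2≤p 0<x) (p∤unitPart 2≤p 0<y)))
  where
  2≤p = prime⇒2≤ pr
  shuffle : ∀ a b c d → (a * b) * (c * d) ≡ (a * c) * (b * d)
  shuffle = solve-∀
  eq : x * y ≡ p ^ (val p x + val p y) * (unitPart p x * unitPart p y)
  eq = trans (cong₂ _*_ (unitPart-eq p x) (unitPart-eq p y))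
    (trans (shuffle (p ^ val p x) (unitPart p x) (p ^ val p y) (unitPart p y))
      (cong (_* (unitPart p x * unitPart p y)) (sym (^-distribˡ-+-* p (val p x) (val p y)))))

val-1 : ∀ {p} → Prime p → val p 1 ≡ 0
val-1 {p} pr = val-unique 0 1 (prime⇒2≤ pr) (s≤s z≤n)
  (λ d → <⇒≢ (prime⇒2≤ pr) (sym (∣1⇒≡1 d)))

val-^ : ∀ {p x} → Prime p → 0 < x → ∀ k → val p (x ^ k) ≡ k * val p x
val-^ pr 0<x zero = val-1 pr
val-^ {p} {x} pr 0<x (suc k) = trans (val-* pr 0<x (^>0 k 0<x)) (cong (val p x +_) (val-^ pr 0<x k))

∃primeDivisor : ∀ n → 2 ≤ n → ∃ λ p → Prime p × p ∣ n
∃primeDivisor = <-rec _ go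
  where
  go : ∀ n → (∀ {m} → m < n → 2 ≤ m → ∃ λ p → Prime p × p ∣ m) → 2 ≤ n → ∃ λ p → Prime p × p ∣ n
  go n rec 2≤n with prime? n
  ... | yes pr = n , pr , ∣-refl
  ... | no ¬pr with ¬prime⇒composite {{n>1⇒nonTrivial 2≤n}} ¬pr
  ... | hasNonTrivialDivisor {d} {{nt}} d<n d∣n with rec d<n (nonTrivial⇒n>1 d)
  ... | p , pr , p∣d = p , pr , ∣-trans p∣d d∣n

-- Peel off one prime p of x at a time.
val-≤⇒∣ : ∀ x y → 0 < x → 0 < y → (∀ p → Prime p → val p x ≤ val p y) → x ∣ y
val-≤⇒∣ = <-rec _ go
  where
  go : ∀ x → (∀ {x′} → x′ < x → ∀ y → 0 < x′ → 0 < y → (∀ p → Prime p → val p x′ ≤ val p y) → x′ ∣ y) →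
       ∀ y → 0 < x → 0 < y → (∀ p → Prime p → val p x ≤ val p y) → x ∣ y
  go (suc zero) rec y 0<x 0<y h = 1∣ y
  go x@(suc (suc _)) rec y 0<x 0<y h with ∃primeDivisor x (s≤s (s≤s z≤n))
  ... | p , pr , p∣x@(divides x′ xeq)
    with ≤val⇒∣ p y {1} (≤-trans (∣⇒≤val {p} {x} {1} (prime⇒2≤ pr) 0<x (subst (_∣ x) (sym (*-identityʳ p)) p∣x)) (h p pr))
  ... | divides y′ yeq′ = subst₂ _∣_ (sym xeq) (sym yeq) (*-monoˡ-∣ p (rec x′<x y′ 0<x′ 0<y′ h′))
    where
    yeq : y ≡ y′ * p
    yeq = trans yeq′ (cong (y′ *_) (*-identityʳ p))
    0<x′ : 0 < x′
    0<x′ = *>0⇒ˡ x′ (subst (0 <_) xeq 0<x)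
    0<y′ : 0 < y′
    0<y′ = *>0⇒ˡ y′ (subst (0 <_) yeq 0<y)
    x′<x : x′ < x
    x′<x = subst (x′ <_) (sym xeq) (m<m*n x′ p {{>-nonZero 0<x′}} (prime⇒2≤ pr))
    h′ : ∀ r → Prime r → val r x′ ≤ val r y′
    h′ r prr = +-cancelʳ-≤ (val r p) _ _ (subst₂ _≤_
      (trans (cong (val r) xeq) (val-* prr 0<x′ (prime⇒0< pr)))
      (trans (cong (val r) yeq) (val-* prr 0<y′ (prime⇒0< pr))) (h r prr))

-- Finite sums

sum-mono : ∀ {n} {f g : Fin n → ℕ} → (∀ i → f i ≤ g i) → sum f ≤ sum g
sum-mono {zero} h = z≤n
sum-mono {suc n} h = +-mono-≤ (h fzero) (sum-mono (h ∘ fsuc))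

sum-const : ∀ n c → sum {n} (λ _ → c) ≡ n * c
sum-const zero c = refl
sum-const (suc n) c = cong (c +_) (sum-const n c)

sum*sum : ∀ {m n} (f : Fin m → ℕ) (g : Fin n → ℕ) →
  sum f * sum g ≡ sum (λ i → sum (λ j → f i * g j))
sum*sum f g = trans (*-distribʳ-sum (sum g) f) (sum-cong (λ i → *-distribˡ-sum (f i) g))

2ab≤a²+b² : ∀ a b → 2 * (a * b) ≤ a * a + b * b
2ab≤a²+b² a b = [ ordered a b , (λ le → subst₂ _≤_ (cong (2 *_) (*-comm b a)) (+-comm (b * b) (a * a)) (ordered b a le)) ]′ (≤-total a b)
  where
  expand : ∀ a c → a * a + (a + c) * (a + c) ≡ 2 * (a * (a + c)) + c * c
  expand = solve-∀
  shifted : ∀ a c b → a + c ≡ b → 2 * (a * b) ≤ a * a + b * b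
  shifted a c .(a + c) refl = subst (2 * (a * (a + c)) ≤_) (sym (expand a c)) (m≤m+n _ _)
  ordered : ∀ a b → a ≤ b → 2 * (a * b) ≤ a * a + b * b
  ordered a b le = shifted a (b ∸ a) b (m+[n∸m]≡n le)

-- Expanded over pairs (i, j), twice the inequality is the sum of 2 s t ≤ s² + t² with s = x i * y j
-- and t = x j * y i; doubling avoids both division and subtraction.
cauchySchwarz : ∀ {n} (x y : Fin n → ℕ) →
  sum (λ i → x i * y i) * sum (λ i → x i * y i) ≤ sum (λ i → x i * x i) * sum (λ i → y i * y i)
cauchySchwarz {n} x y = *-cancelˡ-≤ 2 (begin
  2 * (sum xy * sum xy)
    ≡⟨ cong (2 *_) (sum*sum xy xy) ⟩
  2 * sum (λ i → sum (λ j → xy i * xy j))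
    ≡⟨ trans (*-distribˡ-sum 2 (λ i → sum (λ j → xy i * xy j))) (sum-cong (λ i → *-distribˡ-sum 2 (λ j → xy i * xy j))) ⟩
  sum (λ i → sum (λ j → 2 * (xy i * xy j)))
    ≤⟨ sum-mono (λ i → sum-mono (λ j → amgm (x i) (y i) (x j) (y j))) ⟩
  sum (λ i → sum (λ j → xx i * yy j + xx j * yy i))
    ≡⟨ trans (sum-cong (λ i → ∑-distrib-+ (λ j → xx i * yy j) (λ j → xx j * yy i)))
         (∑-distrib-+ (λ i → sum (λ j → xx i * yy j)) (λ i → sum (λ j → xx j * yy i))) ⟩
  sum (λ i → sum (λ j → xx i * yy j)) + sum (λ i → sum (λ j → xx j * yy i))
    ≡⟨ cong₂ _+_ (sym (sum*sum xx yy)) (trans (∑-comm (λ i j → xx j * yy i)) (sym (sum*sum xx yy))) ⟩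
  sum xx * sum yy + sum xx * sum yy
    ≡⟨ cong (sum xx * sum yy +_) (sym (+-identityʳ _)) ⟩
  2 * (sum xx * sum yy) ∎)
  where
  open ≤-Reasoning
  xy xx yy : Fin n → ℕ
  xy i = x i * y i
  xx i = x i * x i
  yy i = y i * y i
  amgm : ∀ a b c d → 2 * ((a * b) * (c * d)) ≤ (a * a) * (d * d) + (c * c) * (b * b)
  amgm a b c d = subst₂ _≤_ (cong (2 *_) (eq₁ a b c d)) (eq₂ a b c d) (2ab≤a²+b² (a * d) (c * b))
    where
    eq₁ : ∀ a b c d → (a * d) * (c * b) ≡ (a * b) * (c * d)
    eq₁ = solve-∀
    eq₂ : ∀ a b c d → (a * d) * (a * d) + (c * b) * (c * b) ≡ (a * a) * (d * d) + (c * c) * (b * b)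
    eq₂ = solve-∀

sum²≤n*sum² : ∀ {n} (f : Fin n → ℕ) → sum f * sum f ≤ n * sum (λ i → f i * f i)
sum²≤n*sum² {n} f = subst₂ _≤_
  (cong₂ _*_ (sum-cong (λ i → *-identityˡ (f i))) (sum-cong (λ i → *-identityˡ (f i))))
  (cong (_* sum (λ i → f i * f i)) (trans (sum-const n 1) (*-identityʳ n)))
  (cauchySchwarz (λ _ → 1) f)

ind : ∀ {p} {P : Set p} → Dec P → ℕ
ind (yes _) = 1
ind (no _) = 0

ind-yes : ∀ {p} {P : Set p} (d : Dec P) → P → ind d ≡ 1
ind-yes (yes _) p = refl
ind-yes (no np) p = ⊥-elim (np p)

ind-no : ∀ {p} {P : Set p} (d : Dec P) → ¬ P → ind d ≡ 0
ind-no (yes p) np = ⊥-elim (np p)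
ind-no (no _) np = refl

ind≤1 : ∀ {p} {P : Set p} (d : Dec P) → ind d ≤ 1
ind≤1 (yes _) = ≤-refl
ind≤1 (no _) = z≤n

ind-*-idem : ∀ {p} {P : Set p} (d : Dec P) → ind d * ind d ≡ ind d
ind-*-idem (yes _) = refl
ind-*-idem (no _) = refl

sum-0 : ∀ {n} (f : Fin n → ℕ) → (∀ i → f i ≡ 0) → sum f ≡ 0
sum-0 {n} f h = trans (sum-cong h) (trans (sum-const n 0) (*-zeroʳ n))

sum-single : ∀ {n} (i : Fin n) (f : Fin n → ℕ) → (∀ j → j ≢ i → f j ≡ 0) → sum f ≡ f i
sum-single {suc n} fzero f h = trans (cong (f fzero +_) (sum-0 (f ∘ fsuc) (λ j → h (fsuc j) λ ()))) (+-identityʳ _)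
sum-single {suc n} (fsuc i) f h = cong₂ _+_ (h fzero λ ())
  (sum-single i (f ∘ fsuc) (λ j j≢i → h (fsuc j) (j≢i ∘ fsuc-injective)))

term≤sum : ∀ {n} (f : Fin n → ℕ) i → f i ≤ sum f
term≤sum {suc n} f fzero = m≤m+n _ _
term≤sum {suc n} f (fsuc i) = ≤-trans (term≤sum (f ∘ fsuc) i) (m≤n+m _ _)

≠ᵢ : ∀ {n} → Fin n → Fin n → ℕ
≠ᵢ i j = ind (¬? (i ≟F j))

sum₂≤offDiag+diag : ∀ {n} (F : Fin n → Fin n → ℕ) →
  sum (λ i → sum (F i)) ≤ sum (λ i → sum (λ j → ≠ᵢ i j * F i j)) + sum (λ i → F i i)
sum₂≤offDiag+diag {n} F = begin
  sum (λ i → sum (F i)) ≤⟨ sum-mono (λ i → sum-mono (split i)) ⟩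
  sum (λ i → sum (λ j → ≠ᵢ i j * F i j + δ i j * F i j))
    ≡⟨ sum-cong (λ i → ∑-distrib-+ (λ j → ≠ᵢ i j * F i j) (λ j → δ i j * F i j)) ⟩
  sum (λ i → sum (λ j → ≠ᵢ i j * F i j) + sum (λ j → δ i j * F i j))
    ≡⟨ ∑-distrib-+ (λ i → sum (λ j → ≠ᵢ i j * F i j)) (λ i → sum (λ j → δ i j * F i j)) ⟩
  sum (λ i → sum (λ j → ≠ᵢ i j * F i j)) + sum (λ i → sum (λ j → δ i j * F i j))
    ≡⟨ cong (sum (λ i → sum (λ j → ≠ᵢ i j * F i j)) +_) (sum-cong diag) ⟩
  sum (λ i → sum (λ j → ≠ᵢ i j * F i j)) + sum (λ i → F i i) ∎
  where
  open ≤-Reasoning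
  δ : Fin n → Fin n → ℕ
  δ i j = ind (i ≟F j)
  split : ∀ i j → F i j ≤ ≠ᵢ i j * F i j + δ i j * F i j
  split i j with i ≟F j
  ... | yes _ = ≤-reflexive (sym (+-identityʳ (F i j)))
  ... | no _ = ≤-trans (≤-reflexive (sym (+-identityʳ (F i j)))) (m≤m+n _ _)
  diag : ∀ i → sum (λ j → δ i j * F i j) ≡ F i i
  diag i = trans (sum-single i _ (λ j j≢i → cong (_* F i j) (ind-no (i ≟F j) (λ e → j≢i (sym e)))))
    (trans (cong (_* F i i) (ind-yes (i ≟F i) refl)) (*-identityˡ _))

-- Finite products and their valuations

∏ : ∀ {n} → (Fin n → ℕ) → ℕ
∏ = Prod.sum

∏-mono : ∀ {n} {f g : Fin n → ℕ} → (∀ i → f i ≤ g i) → ∏ f ≤ ∏ g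
∏-mono {zero} h = ≤-refl
∏-mono {suc n} h = *-mono-≤ (h fzero) (∏-mono (h ∘ fsuc))

∏>0 : ∀ {n} {f : Fin n → ℕ} → (∀ i → 0 < f i) → 0 < ∏ f
∏>0 {zero} h = s≤s z≤n
∏>0 {suc n} h = *>0 (h fzero) (∏>0 (h ∘ fsuc))

∏-^ : ∀ {n} c (e : Fin n → ℕ) → ∏ (λ i → c ^ e i) ≡ c ^ sum e
∏-^ {zero} c e = refl
∏-^ {suc n} c e = trans (cong (c ^ e fzero *_) (∏-^ c (e ∘ fsuc))) (sym (^-distribˡ-+-* c (e fzero) _))

val-∏ : ∀ {n p} → Prime p → (f : Fin n → ℕ) → (∀ i → 0 < f i) → val p (∏ f) ≡ sum (λ i → val p (f i))
val-∏ {zero} pr f h = val-1 pr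
val-∏ {suc n} pr f h = trans (val-* pr (h fzero) (∏>0 (h ∘ fsuc)))
  (cong (val _ (f fzero) +_) (val-∏ pr (f ∘ fsuc) (h ∘ fsuc)))

-- Lifting the exponent

infix 4 _∣ᶻ_
_∣ᶻ_ : ℕ → ℤ → Set
m ∣ᶻ i = ℤ.+ m ℤD.∣ i

fromAbs : ∀ {m} i → m ∣ ℤ.∣ i ∣ → m ∣ᶻ i
fromAbs i d = ℤD.∣ᵤ⇒∣ d

toAbs : ∀ {m} i → m ∣ᶻ i → m ∣ ℤ.∣ i ∣
toAbs i d = ℤD.∣⇒∣ᵤ d

∣ᶻ-trans : ∀ {m n i} → m ∣ n → n ∣ᶻ i → m ∣ᶻ i
∣ᶻ-trans {i = i} d e = fromAbs i (∣-trans d (toAbs i e))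

euclidᶻ : ∀ {p} x y → Prime p → p ∣ᶻ x ℤ.* y → p ∣ᶻ x ⊎ p ∣ᶻ y
euclidᶻ {p} x y pr d with euclidsLemma ℤ.∣ x ∣ ℤ.∣ y ∣ pr (subst (p ∣_) (ℤP.abs-* x y) (toAbs (x ℤ.* y) d))
... | inj₁ e = inj₁ (fromAbs x e)
... | inj₂ e = inj₂ (fromAbs y e)

prime∣^⇒∣ᶻ : ∀ {p} x k → Prime p → p ∣ᶻ x ℤ.^ k → p ∣ᶻ x
prime∣^⇒∣ᶻ x zero pr d = ⊥-elim (<⇒≢ (prime⇒2≤ pr) (sym (∣1⇒≡1 (toAbs ℤ.1ℤ d))))
prime∣^⇒∣ᶻ x (suc k) pr d = [ id , prime∣^⇒∣ᶻ x k pr ]′ (euclidᶻ x (x ℤ.^ k) pr d)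

p^k∣d*s⇒p^k∣d : ∀ {p s} → Prime p → ¬ p ∣ s → ∀ k d → p ^ k ∣ d * s → p ^ k ∣ d
p^k∣d*s⇒p^k∣d pr ns zero d h = 1∣ d
p^k∣d*s⇒p^k∣d {p} {s} pr ns (suc k) d h with euclidsLemma d s pr (∣-trans (m∣m*n (p ^ k)) h)
... | inj₂ e = ⊥-elim (ns e)
... | inj₁ (divides d′ refl) = subst (p ^ suc k ∣_) (*-comm p d′) (*-monoʳ-∣ p
  (p^k∣d*s⇒p^k∣d pr ns k d′ (*-cancelˡ-∣ p {{prime⇒nonZero pr}} (subst (p * p ^ k ∣_) (shuffle d′ p s) h))))
  where
  shuffle : ∀ a b c → a * b * c ≡ b * (a * c)
  shuffle = solve-∀

distinctPrimes : ∀ {p q} → Prime p → Prime q → p ∣ q → p ≡ q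
distinctPrimes {p} prp prq d with prime⇒irreducible prq d
... | inj₁ refl = ⊥-elim (¬prime[1] prp)
... | inj₂ e = e

geom : ℕ → ℤ → ℤ → ℤ
geom zero X Y = ℤ.0ℤ
geom (suc n) X Y = X ℤ.* geom n X Y ℤ.+ Y ℤ.^ n

geom-diff : ∀ n X Y → X ℤ.^ n ℤ.- Y ℤ.^ n ≡ (X ℤ.- Y) ℤ.* geom n X Y
geom-diff zero X Y = sym (ℤP.*-zeroʳ (X ℤ.- Y))
geom-diff (suc n) X Y = trans (split X Y (X ℤ.^ n) (Y ℤ.^ n))
  (trans (cong (λ t → X ℤ.* t ℤ.+ (X ℤ.- Y) ℤ.* Y ℤ.^ n) (geom-diff n X Y)) (join X Y (geom n X Y) (Y ℤ.^ n)))
  where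
  split : ∀ X Y a b → X ℤ.* a ℤ.- Y ℤ.* b ≡ X ℤ.* (a ℤ.- b) ℤ.+ (X ℤ.- Y) ℤ.* b
  split = ℤR.solve-∀
  join : ∀ X Y s b → X ℤ.* ((X ℤ.- Y) ℤ.* s) ℤ.+ (X ℤ.- Y) ℤ.* b ≡ (X ℤ.- Y) ℤ.* (X ℤ.* s ℤ.+ b)
  join = ℤR.solve-∀

-- The number n(n - 1)/2, the coefficient of the second-order term in the expansion of `geom` around
-- X = Y.
triangle : ℕ → ℤ
triangle zero = ℤ.0ℤ
triangle (suc n) = triangle n ℤ.+ ℤ.+ n

-- Taylor remainders of geom n X Y at X = Y.
rem₁ rem₂ : ℕ → ℤ → ℤ → ℤ
rem₁ zero X Y = ℤ.0ℤ
rem₁ (suc n) X Y = ℤ.+ n ℤ.* Y ℤ.^ n ℤ.+ X ℤ.* rem₁ n X Y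
rem₂ zero X Y = ℤ.0ℤ
rem₂ (suc n) X Y = triangle n ℤ.* Y ℤ.^ n ℤ.+ X ℤ.* rem₂ n X Y

-- At X = Y the cofactor `geom n X Y` equals n Y^(n-1). The additional factor Y keeps the exponent n
-- - 1 out of the formula and is harmless where p does not divide Y.
taylor₁ : ∀ n X Y → Y ℤ.* geom n X Y ≡ ℤ.+ n ℤ.* Y ℤ.^ n ℤ.+ (X ℤ.- Y) ℤ.* rem₁ n X Y
taylor₁ zero X Y = zz X Y
  where
  zz : ∀ X Y → Y ℤ.* ℤ.0ℤ ≡ ℤ.0ℤ ℤ.* ℤ.1ℤ ℤ.+ (X ℤ.- Y) ℤ.* ℤ.0ℤ
  zz = ℤR.solve-∀
taylor₁ (suc n) X Y = trans (split X Y (geom n X Y) (Y ℤ.^ n))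
  (trans (cong (λ t → X ℤ.* t ℤ.+ Y ℤ.* Y ℤ.^ n) (taylor₁ n X Y)) (join (ℤ.+ n) X Y (Y ℤ.^ n) (rem₁ n X Y)))
  where
  split : ∀ X Y s b → Y ℤ.* (X ℤ.* s ℤ.+ b) ≡ X ℤ.* (Y ℤ.* s) ℤ.+ Y ℤ.* b
  split = ℤR.solve-∀
  join : ∀ n X Y b w → X ℤ.* (n ℤ.* b ℤ.+ (X ℤ.- Y) ℤ.* w) ℤ.+ Y ℤ.* b
    ≡ (ℤ.1ℤ ℤ.+ n) ℤ.* (Y ℤ.* b) ℤ.+ (X ℤ.- Y) ℤ.* (n ℤ.* b ℤ.+ X ℤ.* w)
  join = ℤR.solve-∀

taylor₂ : ∀ n X Y → Y ℤ.* rem₁ n X Y ≡ triangle n ℤ.* Y ℤ.^ n ℤ.+ (X ℤ.- Y) ℤ.* rem₂ n X Y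
taylor₂ zero X Y = zz X Y
  where
  zz : ∀ X Y → Y ℤ.* ℤ.0ℤ ≡ ℤ.0ℤ ℤ.* ℤ.1ℤ ℤ.+ (X ℤ.- Y) ℤ.* ℤ.0ℤ
  zz = ℤR.solve-∀
taylor₂ (suc n) X Y = trans (split (ℤ.+ n) X Y (rem₁ n X Y) (Y ℤ.^ n))
  (trans (cong (λ t → X ℤ.* t ℤ.+ ℤ.+ n ℤ.* (Y ℤ.* Y ℤ.^ n)) (taylor₂ n X Y))
    (join (ℤ.+ n) X Y (Y ℤ.^ n) (triangle n) (rem₂ n X Y)))
  where
  split : ∀ n X Y w b → Y ℤ.* (n ℤ.* b ℤ.+ X ℤ.* w) ≡ X ℤ.* (Y ℤ.* w) ℤ.+ n ℤ.* (Y ℤ.* b)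
  split = ℤR.solve-∀
  join : ∀ n X Y b t v → X ℤ.* (t ℤ.* b ℤ.+ (X ℤ.- Y) ℤ.* v) ℤ.+ n ℤ.* (Y ℤ.* b)
    ≡ (t ℤ.+ n) ℤ.* (Y ℤ.* b) ℤ.+ (X ℤ.- Y) ℤ.* (t ℤ.* b ℤ.+ X ℤ.* v)
  join = ℤR.solve-∀

2*triangle : ∀ n → ℤ.+ 2 ℤ.* triangle n ℤ.+ ℤ.+ n ≡ ℤ.+ n ℤ.* ℤ.+ n
2*triangle zero = refl
2*triangle (suc n) = trans (split (ℤ.+ n) (triangle n)) (trans (cong (λ t → t ℤ.+ ℤ.+ 2 ℤ.* ℤ.+ n ℤ.+ ℤ.1ℤ) (2*triangle n)) (join (ℤ.+ n)))
  where
  split : ∀ n t → ℤ.+ 2 ℤ.* (t ℤ.+ n) ℤ.+ (ℤ.1ℤ ℤ.+ n) ≡ (ℤ.+ 2 ℤ.* t ℤ.+ n) ℤ.+ ℤ.+ 2 ℤ.* n ℤ.+ ℤ.1ℤ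
  split = ℤR.solve-∀
  join : ∀ n → n ℤ.* n ℤ.+ ℤ.+ 2 ℤ.* n ℤ.+ ℤ.1ℤ ≡ (ℤ.1ℤ ℤ.+ n) ℤ.* (ℤ.1ℤ ℤ.+ n)
  join = ℤR.solve-∀

-- Modulo 2 all units agree, hence the modulus 4 at the prime 2 in the lifting lemma below.
pstar : ℕ → ℕ
pstar p with p ≟ 2
... | yes _ = 4
... | no _ = p

p∣pstar : ∀ p → p ∣ pstar p
p∣pstar p with p ≟ 2
... | yes refl = divides 2 refl
... | no _ = ∣-refl

p∣triangle : ∀ {p} → Prime p → p ≢ 2 → p ∣ᶻ triangle p
p∣triangle {p} pr ne = [ (λ d → ⊥-elim (ne (distinctPrimes pr prime[2] (toAbs (ℤ.+ 2) d)))) , id ]′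
  (euclidᶻ (ℤ.+ 2) (triangle p) pr (ℤD.∣m+n∣n⇒∣m
    (subst (p ∣ᶻ_) (sym (2*triangle p)) (ℤD.∣m⇒∣m*n (ℤ.+ p) ℤD.∣-refl)) ℤD.∣-refl))

geom-∤ : ∀ {p q} X Y → Prime p → Prime q → p ≢ q → p ∣ᶻ X ℤ.- Y → ¬ p ∣ᶻ Y → ¬ p ∣ᶻ geom q X Y
geom-∤ {p} {q} X Y prp prq p≢q d nY dS =
  [ (λ e → p≢q (distinctPrimes prp prq (toAbs (ℤ.+ q) e))) , (λ e → nY (prime∣^⇒∣ᶻ Y q prp e)) ]′
  (euclidᶻ (ℤ.+ q) (Y ℤ.^ q) prp (ℤD.∣m+n∣n⇒∣m
    (subst (p ∣ᶻ_) (taylor₁ q X Y) (ℤD.∣n⇒∣m*n Y dS)) (ℤD.∣m⇒∣m*n (rem₁ q X Y) d)))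

p∣geom : ∀ {p} X Y → Prime p → p ∣ᶻ X ℤ.- Y → ¬ p ∣ᶻ Y → p ∣ᶻ geom p X Y
p∣geom {p} X Y pr d nY = [ (λ e → ⊥-elim (nY e)) , id ]′ (euclidᶻ Y (geom p X Y) pr
  (subst (p ∣ᶻ_) (sym (taylor₁ p X Y)) (ℤD.∣m∣n⇒∣m+n (ℤD.∣m⇒∣m*n (Y ℤ.^ p) ℤD.∣-refl) (ℤD.∣m⇒∣m*n (rem₁ p X Y) d))))

∣ᶻ-* : ∀ {m n x y} → m ∣ᶻ x → n ∣ᶻ y → m * n ∣ᶻ x ℤ.* y
∣ᶻ-* {m} {n} {x} {y} d e = fromAbs (x ℤ.* y) (subst (m * n ∣_) (sym (ℤP.abs-* x y)) (*-pres-∣ (toAbs x d) (toAbs y e)))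

-- For odd p, expand Y² times the cofactor to second order: after p Y^(p+1) every term has two
-- factors p, one from X - Y and one from `triangle p`, or both from powers of X - Y. For p = 2 the
-- cofactor is X + Y = (X - Y) + 2 Y, and divisibility of X - Y by 4 decides.
p²∤geom : ∀ {p} X Y → Prime p → pstar p ∣ᶻ X ℤ.- Y → ¬ p ∣ᶻ Y → ¬ p * p ∣ᶻ geom p X Y
p²∤geom {p} X Y pr d⋆ nY dS with p ≟ 2
... | yes refl = nY (fromAbs Y (*-cancelˡ-∣ 2 (subst (4 ∣_) (ℤP.abs-* (ℤ.+ 2) Y) (toAbs (ℤ.+ 2 ℤ.* Y)
      (ℤD.∣m+n∣m⇒∣n (subst (4 ∣ᶻ_) (eq X Y) dS) d⋆)))))
  where
  eq : ∀ X Y → X ℤ.* (X ℤ.* ℤ.0ℤ ℤ.+ ℤ.1ℤ) ℤ.+ Y ℤ.* ℤ.1ℤ ≡ (X ℤ.- Y) ℤ.+ ℤ.+ 2 ℤ.* Y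
  eq = ℤR.solve-∀
... | no ne = nY (prime∣^⇒∣ᶻ Y (suc p) pr (fromAbs (Y ℤ.^ suc p) (*-cancelˡ-∣ p {{prime⇒nonZero pr}}
      (subst (p * p ∣_) (ℤP.abs-* (ℤ.+ p) (Y ℤ.^ suc p)) (toAbs (ℤ.+ p ℤ.* Y ℤ.^ suc p) (ℤD.∣m+n∣n⇒∣m
        (subst (p * p ∣ᶻ_) second (ℤD.∣n⇒∣m*n Y (ℤD.∣n⇒∣m*n Y dS)))
        (ℤD.∣m∣n⇒∣m+n (∣ᶻ-* d⋆ (ℤD.∣m⇒∣m*n (Y ℤ.^ p) (p∣triangle pr ne))) (∣ᶻ-* d⋆ (ℤD.∣m⇒∣m*n (rem₂ p X Y) d⋆)))))))))
  where
  expand : ∀ P Y b D w → Y ℤ.* (P ℤ.* b ℤ.+ D ℤ.* w) ≡ P ℤ.* (Y ℤ.* b) ℤ.+ D ℤ.* (Y ℤ.* w)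
  expand = ℤR.solve-∀
  expand′ : ∀ P b D t v c → P ℤ.* b ℤ.+ D ℤ.* (t ℤ.* c ℤ.+ D ℤ.* v) ≡ P ℤ.* b ℤ.+ (D ℤ.* (t ℤ.* c) ℤ.+ D ℤ.* (D ℤ.* v))
  expand′ = ℤR.solve-∀
  D = X ℤ.- Y
  second : Y ℤ.* (Y ℤ.* geom p X Y) ≡
    ℤ.+ p ℤ.* Y ℤ.^ suc p ℤ.+ (D ℤ.* (triangle p ℤ.* Y ℤ.^ p) ℤ.+ D ℤ.* (D ℤ.* rem₂ p X Y))
  second = trans (cong (Y ℤ.*_) (taylor₁ p X Y)) (trans (expand (ℤ.+ p) Y (Y ℤ.^ p) D (rem₁ p X Y))
    (trans (cong (λ t → ℤ.+ p ℤ.* (Y ℤ.* Y ℤ.^ p) ℤ.+ D ℤ.* t) (taylor₂ p X Y))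
      (expand′ (ℤ.+ p) (Y ℤ.* Y ℤ.^ p) D (triangle p) (rem₂ p X Y) (Y ℤ.^ p))))

-- In X^q - Y^q = (X - Y) · `geom q X Y` the cofactor is prime to p if p ≠ q, and contains p exactly
-- once if p = q; the factor q in the conclusion pays for that one.
lifting : ∀ {p q} X Y → Prime p → Prime q → pstar p ∣ᶻ X ℤ.- Y → ¬ p ∣ᶻ Y → ∀ k →
  p ^ k ∣ ℤ.∣ X ℤ.^ q ℤ.- Y ℤ.^ q ∣ → p ^ k ∣ q * ℤ.∣ X ℤ.- Y ∣
lifting {p} {q} X Y prp prq d⋆ nY k h with p ≟ q | subst (p ^ k ∣_) (trans (cong ℤ.∣_∣ (geom-diff q X Y)) (ℤP.abs-* (X ℤ.- Y) (geom q X Y))) h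
... | no p≢q | h′ = ∣n⇒∣m*n q (p^k∣d*s⇒p^k∣d prp (λ e → geom-∤ X Y prp prq p≢q (∣ᶻ-trans (p∣pstar p) d⋆) nY (fromAbs _ e)) k _ h′)
... | yes refl | h′ with toAbs (geom p X Y) (p∣geom X Y prp (∣ᶻ-trans (p∣pstar p) d⋆) nY)
... | divides s seq = p^k∣d*s⇒p^k∣d prp ns k _ (subst (p ^ k ∣_) (trans (cong (ℤ.∣ X ℤ.- Y ∣ *_) seq) (shuffle _ s p)) h′)
  where
  shuffle : ∀ a b c → a * (b * c) ≡ c * a * b
  shuffle = solve-∀
  ns : ¬ p ∣ s
  ns e = p²∤geom X Y prp d⋆ nY (fromAbs _ (subst (p * p ∣_) (sym seq) (*-monoˡ-∣ p e)))

-- Roots of polynomials modulo a prime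

eval : List ℤ → ℤ → ℤ
eval [] x = ℤ.0ℤ
eval (c ∷ cs) x = c ℤ.+ x ℤ.* eval cs x

-- The quotient of f(x) − f(a) by x − a.
synth : List ℤ → ℤ → List ℤ
synth [] a = []
synth (c ∷ []) a = []
synth (c ∷ cs@(_ ∷ _)) a = eval cs a ∷ synth cs a

synth-eval : ∀ f a x → eval f x ℤ.- eval f a ≡ (x ℤ.- a) ℤ.* eval (synth f a) x
synth-eval [] a x = sym (ℤP.*-zeroʳ (x ℤ.- a))
synth-eval (c ∷ []) a x = eq c a x
  where
  eq : ∀ c a x → (c ℤ.+ x ℤ.* ℤ.0ℤ) ℤ.- (c ℤ.+ a ℤ.* ℤ.0ℤ) ≡ (x ℤ.- a) ℤ.* ℤ.0ℤ
  eq = ℤR.solve-∀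
synth-eval (c ∷ cs@(_ ∷ _)) a x = trans (split c a x (eval cs x) (eval cs a))
  (trans (cong (λ t → (x ℤ.- a) ℤ.* eval cs a ℤ.+ x ℤ.* t) (synth-eval cs a x))
    (join a x (eval cs a) (eval (synth cs a) x)))
  where
  split : ∀ c a x u v → (c ℤ.+ x ℤ.* u) ℤ.- (c ℤ.+ a ℤ.* v) ≡ (x ℤ.- a) ℤ.* v ℤ.+ x ℤ.* (u ℤ.- v)
  split = ℤR.solve-∀
  join : ∀ a x v w → (x ℤ.- a) ℤ.* v ℤ.+ x ℤ.* ((x ℤ.- a) ℤ.* w) ≡ (x ℤ.- a) ℤ.* (v ℤ.+ x ℤ.* w)
  join = ℤR.solve-∀

synth-length : ∀ c cs a → length (synth (c ∷ cs) a) ≡ length cs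
synth-length c [] a = refl
synth-length c (c′ ∷ cs) a = cong suc (synth-length c′ cs a)

synth-All : ∀ {p} f a → p ∣ᶻ eval f a → All (p ∣ᶻ_) (synth f a) → All (p ∣ᶻ_) f
synth-All [] a d ds = []
synth-All {p} (c ∷ []) a d ds = subst (p ∣ᶻ_) (eq c a) d ∷ []
  where
  eq : ∀ c a → c ℤ.+ a ℤ.* ℤ.0ℤ ≡ c
  eq = ℤR.solve-∀
synth-All (c ∷ cs@(_ ∷ _)) a d (e ∷ ds) = ℤD.∣m+n∣n⇒∣m d (ℤD.∣n⇒∣m*n a e) ∷ synth-All cs a e ds

-- Lagrange's bound by synthetic division: the quotient by x - a has one coefficient less, and keeps
-- the other roots modulo p by Euclid's lemma. Speaking of all coefficients, rather than of a
-- degree, makes the induction uniform.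
rootBound : ∀ {p} → Prime p → (f xs : List ℤ) → AllPairs (λ x y → ¬ p ∣ᶻ x ℤ.- y) xs →
  All (λ x → p ∣ᶻ eval f x) xs → length f ≤ length xs → All (p ∣ᶻ_) f
rootBound pr [] xs ps rs le = []
rootBound {p} pr f@(c ∷ cs) (a ∷ xs) (p₁ ∷ ps) (r ∷ rs) (s≤s le) =
  synth-All f a r (rootBound pr (synth f a) xs ps (All.zipWith quot (p₁ , rs))
    (subst (_≤ length xs) (sym (synth-length c cs a)) le))
  where
  swap-sign : ∀ x a → a ℤ.- x ≡ ℤ.- (x ℤ.- a)
  swap-sign = ℤR.solve-∀
  quot : ∀ {x} → (¬ p ∣ᶻ a ℤ.- x) × p ∣ᶻ eval f x → p ∣ᶻ eval (synth f a) x
  quot {x} (n , d) = [ (λ e → ⊥-elim (n (subst (p ∣ᶻ_) (sym (swap-sign x a)) (ℤD.∣m⇒∣-m e)))) , id ]′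
    (euclidᶻ (x ℤ.- a) (eval (synth f a) x) pr (subst (p ∣ᶻ_) (synth-eval f a x) (ℤD.∣m∣n⇒∣m-n d r)))


monomial : ℕ → List ℤ
monomial zero = ℤ.1ℤ ∷ []
monomial (suc n) = ℤ.0ℤ ∷ monomial n

eval-monomial : ∀ n x → eval (monomial n) x ≡ x ℤ.^ n
eval-monomial zero x = trans (cong (λ t → ℤ.1ℤ ℤ.+ t) (ℤP.*-zeroʳ x)) refl
eval-monomial (suc n) x = trans (ℤP.+-identityˡ _) (cong (x ℤ.*_) (eval-monomial n x))

monomial-lead : ∀ {p} n → All (p ∣ᶻ_) (monomial n) → p ∣ᶻ ℤ.1ℤ
monomial-lead zero (d ∷ _) = d
monomial-lead (suc n) (_ ∷ ds) = monomial-lead n ds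

monomial-length : ∀ n → length (monomial n) ≡ suc n
monomial-length zero = refl
monomial-length (suc n) = cong suc (monomial-length n)

rootsOfUnity≤ : ∀ {p} n → Prime p → (xs : List ℤ) → AllPairs (λ x y → ¬ p ∣ᶻ x ℤ.- y) xs →
  All (λ x → p ∣ᶻ x ℤ.^ suc n ℤ.- ℤ.1ℤ) xs → length xs ≤ suc n
rootsOfUnity≤ {p} n pr xs ps rs = ≮⇒≥ λ lt → absurd (rootBound pr (ℤ.-1ℤ ∷ monomial n) xs ps
    (All.map (λ {x} → subst (p ∣ᶻ_) (eq x)) rs) (subst (_≤ length xs) (cong suc (sym (monomial-length n))) lt))
  where
  eq : ∀ x → x ℤ.^ suc n ℤ.- ℤ.1ℤ ≡ ℤ.-1ℤ ℤ.+ x ℤ.* eval (monomial n) x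
  eq x = trans (ℤP.+-comm (x ℤ.^ suc n) ℤ.-1ℤ) (cong (λ t → ℤ.-1ℤ ℤ.+ x ℤ.* t) (sym (eval-monomial n x)))
  absurd : All (p ∣ᶻ_) (ℤ.-1ℤ ∷ monomial n) → ⊥
  absurd (_ ∷ ds) = <⇒≢ (prime⇒2≤ pr) (sym (∣1⇒≡1 (toAbs ℤ.1ℤ (monomial-lead n ds))))

-- Congruences of natural numbers

infix 4 _≡_mod_
-- The difference is taken in ℤ, free of truncation; the record keeps a, b and m recoverable from
-- the type, which the bare divisibility would not.
record _≡_mod_ (a b m : ℕ) : Set where
  constructor mod-intro
  field mod-elim : m ∣ᶻ ℤ.+ a ℤ.- ℤ.+ b
open _≡_mod_

mod-refl : ∀ {m a} → a ≡ a mod m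
mod-refl {m} {a} = mod-intro (subst (m ∣ᶻ_) (sym (ℤP.+-inverseʳ (ℤ.+ a))) (fromAbs ℤ.0ℤ (m ∣0)))

mod-reflexive : ∀ {m a b} → a ≡ b → a ≡ b mod m
mod-reflexive refl = mod-refl

mod-sym : ∀ {m a b} → a ≡ b mod m → b ≡ a mod m
mod-sym {m} {a} {b} (mod-intro d) = mod-intro (subst (m ∣ᶻ_) (eq (ℤ.+ a) (ℤ.+ b)) (ℤD.∣m⇒∣-m d))
  where
  eq : ∀ a b → ℤ.- (a ℤ.- b) ≡ b ℤ.- a
  eq = ℤR.solve-∀

mod-trans : ∀ {m a b c} → a ≡ b mod m → b ≡ c mod m → a ≡ c mod m
mod-trans {m} {a} {b} {c} (mod-intro d) (mod-intro e) =
  mod-intro (subst (m ∣ᶻ_) (eq (ℤ.+ a) (ℤ.+ b) (ℤ.+ c)) (ℤD.∣m∣n⇒∣m+n d e))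
  where
  eq : ∀ a b c → (a ℤ.- b) ℤ.+ (b ℤ.- c) ≡ a ℤ.- c
  eq = ℤR.solve-∀

mod-+ : ∀ {m a b c d} → a ≡ b mod m → c ≡ d mod m → a + c ≡ b + d mod m
mod-+ {m} {a} {b} {c} {d} (mod-intro h) (mod-intro k) = mod-intro (subst (m ∣ᶻ_)
  (trans (eq (ℤ.+ a) (ℤ.+ b) (ℤ.+ c) (ℤ.+ d)) (cong₂ ℤ._-_ (sym (ℤP.pos-+ a c)) (sym (ℤP.pos-+ b d)))) (ℤD.∣m∣n⇒∣m+n h k))
  where
  eq : ∀ a b c d → (a ℤ.- b) ℤ.+ (c ℤ.- d) ≡ (a ℤ.+ c) ℤ.- (b ℤ.+ d)
  eq = ℤR.solve-∀

mod-* : ∀ {m a b c d} → a ≡ b mod m → c ≡ d mod m → a * c ≡ b * d mod m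
mod-* {m} {a} {b} {c} {d} (mod-intro h) (mod-intro k) = mod-intro (subst (m ∣ᶻ_)
  (trans (eq (ℤ.+ a) (ℤ.+ b) (ℤ.+ c) (ℤ.+ d)) (cong₂ ℤ._-_ (sym (ℤP.pos-* a c)) (sym (ℤP.pos-* b d))))
  (ℤD.∣m∣n⇒∣m+n (ℤD.∣m⇒∣m*n (ℤ.+ c) h) (ℤD.∣n⇒∣m*n (ℤ.+ b) k)))
  where
  eq : ∀ a b c d → (a ℤ.- b) ℤ.* c ℤ.+ b ℤ.* (c ℤ.- d) ≡ a ℤ.* c ℤ.- b ℤ.* d
  eq = ℤR.solve-∀

mod-^ : ∀ {m a b} → a ≡ b mod m → ∀ k → a ^ k ≡ b ^ k mod m
mod-^ h zero = mod-refl
mod-^ h (suc k) = mod-* h (mod-^ h k)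

mod-weaken : ∀ {m n a b} → m ∣ n → a ≡ b mod n → a ≡ b mod m
mod-weaken d (mod-intro h) = mod-intro (∣ᶻ-trans d h)

mod-% : ∀ m a .{{_ : NonZero m}} → a ≡ a % m mod m
mod-% m a = mod-intro (subst (m ∣ᶻ_) (sym (trans (cong (λ t → ℤ.+ t ℤ.- ℤ.+ (a % m)) (m≡m%n+[m/n]*n a m))
    (trans (cong (ℤ._- ℤ.+ (a % m)) (ℤP.pos-+ (a % m) (a / m * m))) (eq (ℤ.+ (a % m)) (ℤ.+ (a / m * m))))))
  (fromAbs (ℤ.+ (a / m * m)) (n∣m*n (a / m))))
  where
  eq : ∀ r b → (r ℤ.+ b) ℤ.- r ≡ b
  eq = ℤR.solve-∀

mod-small : ∀ {m x y} → x < m → y < m → x ≡ y mod m → x ≡ y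
mod-small {m} {x} {y} x<m y<m h = [ (λ le → sym (small le y<m h)) , (λ le → small le x<m (mod-sym h)) ]′ (≤-total x y)
  where
  small : ∀ {x y} → x ≤ y → y < m → x ≡ y mod m → y ≡ x
  small {x} {y} x≤y y<m (mod-intro d) with y ∸ x in eq
  ... | zero = ≤-antisym (m∸n≡0⇒m≤n eq) x≤y
  ... | suc z = ⊥-elim (<⇒≱ (≤-<-trans (subst (_≤ y) eq (m∸n≤m y x)) y<m)
    (∣⇒≤ (subst (m ∣_) (trans (cong ℤ.∣_∣ (ℤP.m-n≡m⊖n x y)) (trans (ℤP.∣⊖∣-≤ x≤y) eq)) (toAbs _ d))))

%≡⇒mod : ∀ {m a b} .{{_ : NonZero m}} → a % m ≡ b % m → a ≡ b mod m
%≡⇒mod {m} {a} {b} e = mod-trans (mod-% m a) (mod-trans (mod-reflexive e) (mod-sym (mod-% m b)))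

mod-∣ : ∀ {m a b} → a ≡ b mod m → m ∣ b → m ∣ a
mod-∣ {m} {a} {b} (mod-intro h) d = toAbs (ℤ.+ a) (ℤD.∣m+n∣n⇒∣m {m = ℤ.+ a} {n = ℤ.- ℤ.+ b} h (ℤD.∣m⇒∣-m (fromAbs (ℤ.+ b) d)))

∣⇒mod : ∀ {m a b} → m ∣ a → m ∣ b → a ≡ b mod m
∣⇒mod {m} {a} {b} d e = mod-intro (ℤD.∣m∣n⇒∣m-n (fromAbs (ℤ.+ a) d) (fromAbs (ℤ.+ b) e))

pstar-prime : ∀ {p r} → Prime p → Prime r → r ∣ pstar p → r ≡ p
pstar-prime {p} prp prr d with p ≟ 2
... | no _ = distinctPrimes prr prp d
... | yes refl = [ distinctPrimes prr prime[2] , distinctPrimes prr prime[2] ]′ (euclidsLemma 2 2 prr d)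

pstar>0 : ∀ {p} → Prime p → 0 < pstar p
pstar>0 {p} pr with p ≟ 2
... | yes _ = s≤s z≤n
... | no _ = prime⇒0< pr

∤⇒coprime-pstar : ∀ {p u} → Prime p → ¬ p ∣ u → Coprime (pstar p) u
∤⇒coprime-pstar {p} {u} pr nd {zero} (d , e) = ⊥-elim (<⇒≢ (pstar>0 pr) (sym (0∣⇒≡0 d)))
∤⇒coprime-pstar {p} {u} pr nd {suc zero} (d , e) = refl
∤⇒coprime-pstar {p} {u} pr nd {suc (suc k)} (d , e) with ∃primeDivisor (suc (suc k)) (s≤s (s≤s z≤n))
... | r , prr , r∣k with pstar-prime pr prr (∣-trans r∣k d)
... | refl = ⊥-elim (nd (∣-trans r∣k e))

coprime⇒inverse : ∀ {m u} → Coprime m u → ∃ λ ι → ι * u ≡ 1 mod m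
coprime⇒inverse {m} {u} c with coprime-Bézout c
-- Here y * u ≡ -1, so its square is 1, and y * y * u is an inverse without negative numbers.
... | Bézout.+- x y eq = y * y * u , mod-intro (subst (m ∣ᶻ_) (factor (ℤ.+ (y * y * u * u)) (ℤ.+ (y * u)) (trans (cong ℤ.+_ (shuffle y u)) (ℤP.pos-* (y * u) (y * u))))
    (ℤD.∣m⇒∣m*n (ℤ.+ (y * u) ℤ.- ℤ.1ℤ) (fromAbs (ℤ.+ (y * u) ℤ.+ ℤ.1ℤ)
      (subst (m ∣_) (trans (sym eq) (+-comm 1 (y * u))) (n∣m*n x)))))
  where
  shuffle : ∀ y u → y * y * u * u ≡ (y * u) * (y * u)
  shuffle = solve-∀
  expand : ∀ a → (a ℤ.+ ℤ.1ℤ) ℤ.* (a ℤ.- ℤ.1ℤ) ≡ a ℤ.* a ℤ.- ℤ.1ℤ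
  expand = ℤR.solve-∀
  factor : ∀ b a → b ≡ a ℤ.* a → (a ℤ.+ ℤ.1ℤ) ℤ.* (a ℤ.- ℤ.1ℤ) ≡ b ℤ.- ℤ.1ℤ
  factor b a refl = expand a
... | Bézout.-+ x y eq = y , mod-trans (mod-reflexive (sym eq))
    (mod-+ (mod-refl {a = 1}) (∣⇒mod {b = 0} (n∣m*n x) (m ∣0)))

-- c ↦ 1 on the residues that can occur as a ratio of two q-th powers that agree modulo p.
letter : ∀ p q {m} → Fin m → ℕ
letter p q c = ind (p ∣? ℤ.∣ (ℤ.+ toℕ c) ℤ.^ q ℤ.- ℤ.1ℤ ∣)

letter≤1 : ∀ p q {m} (c : Fin m) → letter p q c ≤ 1
letter≤1 p q c = ind≤1 (p ∣? ℤ.∣ (ℤ.+ toℕ c) ℤ.^ q ℤ.- ℤ.1ℤ ∣)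

sum-ind≡length : ∀ {a p} {A : Set a} {P : A → Set p} (P? : Decidable P) {n} (f : Fin n → A) →
  sum (λ i → ind (P? (f i))) ≡ length (filter P? (tabulate f))
sum-ind≡length P? {zero} f = refl
sum-ind≡length P? {suc n} f with P? (f fzero)
... | yes _ = cong suc (sum-ind≡length P? (f ∘ fsuc))
... | no _ = sum-ind≡length P? (f ∘ fsuc)

-- For odd p the letters are roots of x^q - 1 modulo p. For p = 2 there are four residues modulo 4,
-- of which the two even ones drop out, leaving 2 ≤ q.
sum-letter≤ : ∀ {p q} → Prime p → 2 ≤ q → sum {pstar p} (letter p q) ≤ q
sum-letter≤ {p} {q@(suc q′)} pr 2≤q with p ≟ 2
... | yes refl = ≤-trans (+-mono-≤ (even fzero (divides 0 refl)) (+-mono-≤ (letter≤1 2 q {4} (fsuc fzero))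
      (+-mono-≤ (even (fsuc (fsuc fzero)) (divides 1 refl)) (+-mono-≤ (letter≤1 2 q {4} (fsuc (fsuc (fsuc fzero)))) z≤n)))) 2≤q
  where
  even : (c : Fin 4) → 2 ∣ toℕ c → letter 2 q c ≤ 0
  even c d = ≤-reflexive (ind-no (2 ∣? _) λ e → <⇒≢ (s≤s (s≤s z≤n)) (sym (∣1⇒≡1 (toAbs ℤ.-1ℤ
    (ℤD.∣m+n∣m⇒∣n (fromAbs ((ℤ.+ toℕ c) ℤ.^ q ℤ.- ℤ.1ℤ) e) (ℤD.∣m⇒∣m*n ((ℤ.+ toℕ c) ℤ.^ q′) (fromAbs (ℤ.+ toℕ c) d)))))))
... | no _ = subst (_≤ q) (sym (sum-ind≡length P? f)) (rootsOfUnity≤ q′ pr (filter P? (tabulate f))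
      (AllPairsP.filter⁺ P? (AllPairsP.tabulate⁺ distinct))
      (All.map (fromAbs _) (AllP.all-filter P? (tabulate f))))
  where
  P? : Decidable (λ x → p ∣ ℤ.∣ x ℤ.^ q ℤ.- ℤ.1ℤ ∣)
  P? x = p ∣? ℤ.∣ x ℤ.^ q ℤ.- ℤ.1ℤ ∣
  f : Fin p → ℤ
  f c = ℤ.+ toℕ c
  distinct : ∀ {i j} → i ≢ j → ¬ p ∣ᶻ f i ℤ.- f j
  distinct {i} {j} ne d = ne (toℕ-injective (mod-small (toℕ<n i) (toℕ<n j) (mod-intro d)))

-- Averaging over few residue classes

sum-below : ∀ {A} t → t ≤ A → sum {A} (λ k → ind (toℕ k <? t)) ≡ t
sum-below {zero} .0 z≤n = refl
sum-below {suc A} zero le = sum-0 (λ k → ind (toℕ {suc A} k <? 0)) (λ k → ind-no (toℕ k <? 0) λ ())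
sum-below {suc A} (suc t) (s≤s le) = cong suc (trans (sum-cong {A} λ k → shiftInd (toℕ k)) (sum-below t le))
  where
  shiftInd : ∀ k → ind (suc k <? suc t) ≡ ind (k <? t)
  shiftInd k with k <? t
  ... | yes lt = ind-yes (suc k <? suc t) (s≤s lt)
  ... | no ¬lt = ind-no (suc k <? suc t) (λ lt → ¬lt (s≤s⁻¹ lt))

-- The layer-cake formula: each level k contributes a product of a function of s and a function of
-- t, which turns the kernel min into a sum of squares below.
⊓-layers : ∀ {A} s t → s ≤ A → s ⊓ t ≡ sum {A} (λ k → ind (toℕ k <? s) * ind (toℕ k <? t))
⊓-layers {A} s t le = trans (sym (sum-below {A} (s ⊓ t) (≤-trans (m⊓n≤m s t) le))) (sum-cong {A} (λ k → split (toℕ k)))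
  where
  split : ∀ k → ind (k <? s ⊓ t) ≡ ind (k <? s) * ind (k <? t)
  split k with k <? s | k <? t
  ... | yes a | yes b = ind-yes (k <? s ⊓ t) (⊓-pres-m< a b)
  ... | yes a | no b = ind-no (k <? s ⊓ t) (λ c → b (<-≤-trans c (m⊓n≤n s t)))
  ... | no a | _ = ind-no (k <? s ⊓ t) (λ c → a (<-≤-trans c (m⊓n≤m s t)))

-- If the support of y meets at most q classes of ρ, then (Σ y)² ≤ q Σ_{ρ j = ρ j′} y j y j′.
fewClasses : ∀ {K s} q (R : Fin s → ℕ) (ρ : Fin K → Fin s) (y : Fin K → ℕ) →
  sum R ≤ q → (∀ c → R c * R c ≤ R c) → (∀ j → 0 < y j → R (ρ j) ≡ 1) →
  sum y * sum y ≤ q * sum (λ j → sum (λ j′ → ind (ρ j ≟F ρ j′) * (y j * y j′)))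
fewClasses {K} {s} q R ρ y ΣR≤q R²≤R supp = begin
  sum y * sum y ≡⟨ cong (λ t → t * t) byClass ⟩
  sum (λ c → R c * cls c) * sum (λ c → R c * cls c) ≤⟨ cauchySchwarz R cls ⟩
  sum (λ c → R c * R c) * sum (λ c → cls c * cls c)
    ≤⟨ *-mono-≤ (≤-trans (sum-mono R²≤R) ΣR≤q) (≤-reflexive squares) ⟩
  q * sum (λ j → sum (λ j′ → ind (ρ j ≟F ρ j′) * (y j * y j′))) ∎
  where
  open ≤-Reasoning
  cls : Fin s → ℕ
  cls c = sum (λ j → ind (ρ j ≟F c) * y j)
  at : ∀ {n} (c : Fin n) (g : Fin n → ℕ) → sum (λ c′ → ind (c ≟F c′) * g c′) ≡ g c
  at c g = trans (sum-single c (λ c′ → ind (c ≟F c′) * g c′) (λ c′ ne → cong (_* g c′) (ind-no (c ≟F c′) (λ e → ne (sym e)))))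
    (trans (cong (_* g c) (ind-yes (c ≟F c) refl)) (*-identityˡ _))
  swap₃ : ∀ a b c → a * (b * c) ≡ b * (a * c)
  swap₃ = solve-∀
  Ry : ∀ j → R (ρ j) * y j ≡ y j
  Ry j with y j in eq
  ... | zero = *-zeroʳ (R (ρ j))
  ... | suc k = trans (cong (_* suc k) (supp j (subst (0 <_) (sym eq) (s≤s z≤n)))) (*-identityˡ _)
  byClass : sum y ≡ sum (λ c → R c * cls c)
  byClass = sym (trans (sum-cong (λ c → trans (*-distribˡ-sum (R c) (λ j → ind (ρ j ≟F c) * y j))
      (sum-cong (λ j → swap₃ (R c) (ind (ρ j ≟F c)) (y j)))))
    (trans (∑-comm (λ c j → ind (ρ j ≟F c) * (R c * y j)))
      (sum-cong (λ j → trans (at (ρ j) (λ c → R c * y j)) (Ry j)))))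
  shuffle : ∀ a u b v → (a * u) * (b * v) ≡ a * (b * (u * v))
  shuffle = solve-∀
  flip : ∀ j j′ → ind (ρ j′ ≟F ρ j) ≡ ind (ρ j ≟F ρ j′)
  flip j j′ with ρ j ≟F ρ j′
  ... | yes e = ind-yes (ρ j′ ≟F ρ j) (sym e)
  ... | no ne = ind-no (ρ j′ ≟F ρ j) (λ e → ne (sym e))
  squares : sum (λ c → cls c * cls c) ≡ sum (λ j → sum (λ j′ → ind (ρ j ≟F ρ j′) * (y j * y j′)))
  squares = trans (sum-cong (λ c → sum*sum (λ j → ind (ρ j ≟F c) * y j) (λ j → ind (ρ j ≟F c) * y j)))
    (trans (∑-comm (λ c j → sum (λ j′ → (ind (ρ j ≟F c) * y j) * (ind (ρ j′ ≟F c) * y j′))))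
    (sum-cong (λ j → trans (∑-comm (λ c j′ → (ind (ρ j ≟F c) * y j) * (ind (ρ j′ ≟F c) * y j′)))
      (sum-cong (λ j′ → trans (sum-cong (λ c → shuffle (ind (ρ j ≟F c)) (y j) (ind (ρ j′ ≟F c)) (y j′)))
        (trans (at (ρ j) (λ c → ind (ρ j′ ≟F c) * (y j * y j′))) (cong (_* (y j * y j′)) (flip j j′))))))))

-- The kernel min(t, t′) is a positive combination of the squares treated in fewClasses.
fewClasses-⊓ : ∀ {K s} q A (R : Fin s → ℕ) (ρ : Fin K → Fin s) (x t : Fin K → ℕ) →
  sum R ≤ q → (∀ c → R c * R c ≤ R c) → (∀ j → t j ≤ A) → (∀ j → 0 < x j → 0 < t j → R (ρ j) ≡ 1) →
  sum (λ j → sum (λ j′ → x j * x j′ * (t j ⊓ t j′))) ≤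
  q * sum (λ j → sum (λ j′ → ind (ρ j ≟F ρ j′) * (x j * x j′ * (t j ⊓ t j′))))
fewClasses-⊓ {K} q A R ρ x t ΣR≤q R²≤R t≤A supp = begin
  sum (λ j → sum (λ j′ → x j * x j′ * (t j ⊓ t j′))) ≡⟨ layers (λ _ _ → 1) (λ j j′ → sym (*-identityˡ _)) ⟩
  sum {A} (λ k → sum (λ j → sum (λ j′ → 1 * (y k j * y k j′))))
    ≡⟨ sum-cong {A} (λ k → trans (sum-cong (λ j → sum-cong (λ j′ → *-identityˡ (y k j * y k j′)))) (sym (sum*sum (y k) (y k)))) ⟩
  sum {A} (λ k → sum (y k) * sum (y k))
    ≤⟨ sum-mono {A} (λ k → fewClasses q R ρ (y k) ΣR≤q R²≤R (suppₖ k)) ⟩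
  sum {A} (λ k → q * sum (λ j → sum (λ j′ → ind (ρ j ≟F ρ j′) * (y k j * y k j′))))
    ≡⟨ sym (*-distribˡ-sum {A} q (λ k → sum (λ j → sum (λ j′ → ind (ρ j ≟F ρ j′) * (y k j * y k j′))))) ⟩
  q * sum {A} (λ k → sum (λ j → sum (λ j′ → ind (ρ j ≟F ρ j′) * (y k j * y k j′))))
    ≡⟨ cong (q *_) (sym (layers (λ j j′ → ind (ρ j ≟F ρ j′)) (λ j j′ → refl))) ⟩
  q * sum (λ j → sum (λ j′ → ind (ρ j ≟F ρ j′) * (x j * x j′ * (t j ⊓ t j′)))) ∎
  where
  open ≤-Reasoning
  y : Fin A → Fin K → ℕ
  y k j = x j * ind (toℕ k <? t j)
  suppₖ : ∀ k j → 0 < y k j → R (ρ j) ≡ 1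
  suppₖ k j lt with toℕ k <? t j
  ... | yes k<t = supp j (*>0⇒ˡ (x j) lt) (≤-<-trans z≤n k<t)
  ... | no _ = ⊥-elim (<⇒≢ (*>0⇒ʳ (x j) lt) refl)
  shuffle : ∀ w a b c d → w * (a * b * (c * d)) ≡ w * ((a * c) * (b * d))
  shuffle = solve-∀
  layers : (w : Fin K → Fin K → ℕ) {F : Fin K → Fin K → ℕ} → (∀ j j′ → F j j′ ≡ w j j′ * (x j * x j′ * (t j ⊓ t j′))) →
    sum (λ j → sum (F j)) ≡ sum {A} (λ k → sum (λ j → sum (λ j′ → w j j′ * (y k j * y k j′))))
  layers w {F} F≡ = trans (sum-cong (λ j → trans (sum-cong (λ j′ → trans (F≡ j j′) (layer j j′)))
      (∑-comm (λ j′ k → w j j′ * (y k j * y k j′)))))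
    (∑-comm (λ j k → sum (λ j′ → w j j′ * (y k j * y k j′))))
    where
    layer : ∀ j j′ → w j j′ * (x j * x j′ * (t j ⊓ t j′)) ≡ sum {A} (λ k → w j j′ * (y k j * y k j′))
    layer j j′ = trans (cong (λ m → w j j′ * (x j * x j′ * m)) (⊓-layers {A} (t j) (t j′) (t≤A j)))
      (trans (cong (w j j′ *_) (*-distribˡ-sum {A} (x j * x j′) (λ k → ind (toℕ k <? t j) * ind (toℕ k <? t j′))))
      (trans (*-distribˡ-sum {A} (w j j′) (λ k → x j * x j′ * (ind (toℕ k <? t j) * ind (toℕ k <? t j′))))
        (sum-cong {A} (λ k → shuffle (w j j′) (x j) (x j′) (ind (toℕ k <? t j)) (ind (toℕ k <? t j′))))))

-- Distances and their valuations

dist : ℕ → ℕ → ℕ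
dist x y = ℤ.∣ ℤ.+ x ℤ.- ℤ.+ y ∣

pos-^ : ∀ x k → ℤ.+ (x ^ k) ≡ (ℤ.+ x) ℤ.^ k
pos-^ x zero = refl
pos-^ x (suc k) = trans (ℤP.pos-* x (x ^ k)) (cong (ℤ.+ x ℤ.*_) (pos-^ x k))

dist-refl : ∀ x → dist x x ≡ 0
dist-refl x = cong ℤ.∣_∣ (ℤP.+-inverseʳ (ℤ.+ x))

dist>0 : ∀ {x y} → x ≢ y → 0 < dist x y
dist>0 {x} {y} ne = n≢0⇒n>0 λ e → ne (ℤP.+-injective (ℤP.i-j≡0⇒i≡j (ℤ.+ x) (ℤ.+ y) (ℤP.∣i∣≡0⇒i≡0 e)))

dist-* : ∀ c x y → dist (c * x) (c * y) ≡ c * dist x y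
dist-* c x y = trans (cong ℤ.∣_∣ (trans (cong₂ ℤ._-_ (ℤP.pos-* c x) (ℤP.pos-* c y)) (eq (ℤ.+ c) (ℤ.+ x) (ℤ.+ y))))
  (ℤP.abs-* (ℤ.+ c) (ℤ.+ x ℤ.- ℤ.+ y))
  where
  eq : ∀ c x y → c ℤ.* x ℤ.- c ℤ.* y ≡ c ℤ.* (x ℤ.- y)
  eq = ℤR.solve-∀

dist-+ʳ : ∀ x y c → dist (x + c) (y + c) ≡ dist x y
dist-+ʳ x y c = cong ℤ.∣_∣ (trans (cong₂ ℤ._-_ (ℤP.pos-+ x c) (ℤP.pos-+ y c)) (eq (ℤ.+ x) (ℤ.+ y) (ℤ.+ c)))
  where
  eq : ∀ x y c → (x ℤ.+ c) ℤ.- (y ℤ.+ c) ≡ x ℤ.- y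
  eq = ℤR.solve-∀

dist-+ˡ : ∀ c x y → dist (c + x) (c + y) ≡ dist x y
dist-+ˡ c x y = trans (cong₂ dist (+-comm c x) (+-comm c y)) (dist-+ʳ x y c)

dist-sym : ∀ x y → dist x y ≡ dist y x
dist-sym x y = ℤP.∣i-j∣≡∣j-i∣ (ℤ.+ x) (ℤ.+ y)

dist-cross : ∀ α α′ β β′ → dist ((α′ + β) * (α + β′)) ((α + β) * (α′ + β′)) ≡ dist α α′ * dist β β′
dist-cross α α′ β β′ = trans (cong ℤ.∣_∣ (trans (cong₂ ℤ._-_ (prodℤ α′ β α β′) (prodℤ α β α′ β′))
    (eq (ℤ.+ α) (ℤ.+ α′) (ℤ.+ β) (ℤ.+ β′))))
  (ℤP.abs-* (ℤ.+ α ℤ.- ℤ.+ α′) (ℤ.+ β ℤ.- ℤ.+ β′))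
  where
  prodℤ : ∀ a b c d → ℤ.+ ((a + b) * (c + d)) ≡ (ℤ.+ a ℤ.+ ℤ.+ b) ℤ.* (ℤ.+ c ℤ.+ ℤ.+ d)
  prodℤ a b c d = trans (ℤP.pos-* (a + b) (c + d)) (cong₂ ℤ._*_ (ℤP.pos-+ a b) (ℤP.pos-+ c d))
  eq : ∀ a a′ b b′ → (a′ ℤ.+ b) ℤ.* (a ℤ.+ b′) ℤ.- (a ℤ.+ b) ℤ.* (a′ ℤ.+ b′) ≡ (a ℤ.- a′) ℤ.* (b ℤ.- b′)
  eq = ℤR.solve-∀

∣-dist : ∀ {m x y} → m ∣ x → m ∣ y → m ∣ dist x y
∣-dist {m} {x} {y} d e = toAbs (ℤ.+ x ℤ.- ℤ.+ y) (mod-elim (∣⇒mod d e))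

∣-dist⇒∣ˡ : ∀ {m x y} → m ∣ dist x y → m ∣ y → m ∣ x
∣-dist⇒∣ˡ {m} {x} {y} d e = mod-∣ (mod-intro (fromAbs (ℤ.+ x ℤ.- ℤ.+ y) d)) e

^-distrib-* : ∀ k x y → (x * y) ^ k ≡ x ^ k * y ^ k
^-distrib-* zero x y = refl
^-distrib-* (suc k) x y = trans (cong (x * y *_) (^-distrib-* k x y)) (shuffle x y (x ^ k) (y ^ k))
  where
  shuffle : ∀ a b c d → (a * b) * (c * d) ≡ (a * c) * (b * d)
  shuffle = solve-∀

-- The laws for the valuations w, v of two numbers and the valuation a of their difference, packaged
-- so that the case analysis around a 4-cycle is pure arithmetic of exponents.
record Ultrametric (w v a : ℕ) : Set where
  field
    left : w < v → a ≡ w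
    right : v < w → a ≡ v
    lower : w ⊓ v ≤ a
open Ultrametric

val-dist : ∀ {p x y} → Prime p → 0 < x → 0 < y → 0 < dist x y → Ultrametric (val p x) (val p y) (val p (dist x y))
val-dist {p} {x} {y} pr 0<x 0<y 0<d = record
  { left = λ w<v → ≤-antisym (≮⇒≥ λ w<a → <-irrefl refl (∣⇒≤val 2≤p 0<x
      (∣-dist⇒∣ˡ (≤val⇒∣ p (dist x y) w<a) (≤val⇒∣ p y w<v)))) (below ≤-refl (<⇒≤ w<v))
  ; right = λ v<w → ≤-antisym (≮⇒≥ λ v<a → <-irrefl refl (∣⇒≤val 2≤p 0<y
      (∣-dist⇒∣ˡ (subst (p ^ suc (val p y) ∣_) (dist-sym x y) (≤val⇒∣ p (dist x y) v<a)) (≤val⇒∣ p x v<w)))) (below (<⇒≤ v<w) ≤-refl)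
  ; lower = below (m⊓n≤m (val p x) (val p y)) (m⊓n≤n (val p x) (val p y)) }
  where
  2≤p = prime⇒2≤ pr
  below : ∀ {k} → k ≤ val p x → k ≤ val p y → k ≤ val p (dist x y)
  below k≤w k≤v = ∣⇒≤val 2≤p 0<d (∣-dist (≤val⇒∣ p x k≤w) (≤val⇒∣ p y k≤v))

-- With a the valuation of α - α′ and n, n′ those of α + β and α + β′, this is the part of a not
-- explained by common powers of p in the sums. As a minimum of truncated differences it is a kernel
-- for `fewClasses-⊓`.
excess : ℕ → ℕ → ℕ → ℕ
excess a n n′ = (a ∸ n) ⊓ (a ∸ n′)

excess≡0ˡ : ∀ {a n} n′ → a ≤ n → excess a n n′ ≡ 0
excess≡0ˡ {a} {n} n′ le = cong (_⊓ (a ∸ n′)) (m≤n⇒m∸n≡0 le)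

excess≡0ʳ : ∀ {a n′} n → a ≤ n′ → excess a n n′ ≡ 0
excess≡0ʳ {a} {n′} n le = trans (cong ((a ∸ n) ⊓_) (m≤n⇒m∸n≡0 le)) (⊓-zeroʳ (a ∸ n))

excess≡ʳ : ∀ a {n n′} → n ≤ n′ → excess a n n′ ≡ a ∸ n′
excess≡ʳ a le = m≥n⇒m⊓n≡n (∸-monoʳ-≤ a le)

excess≡ˡ : ∀ a {n n′} → n′ ≤ n → excess a n n′ ≡ a ∸ n
excess≡ˡ a le = m≤n⇒m⊓n≡m (∸-monoʳ-≤ a le)

module _ {n₁ n₂ n₃ n₄ a b : ℕ}
  (u₁₂ : Ultrametric n₁ n₂ a) (u₃₄ : Ultrametric n₃ n₄ a) (u₁₃ : Ultrametric n₁ n₃ b) (u₂₄ : Ultrametric n₂ n₄ b) where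

  private
    a+b-form : ∀ {x y} → a ≡ x → b ≡ y → ∀ {e f} → excess a n₁ n₃ ≡ e → excess b n₁ n₂ ≡ f →
      x + y ≡ (n₁ + n₄) + e + f → a + b ≡ (n₁ + n₄) + excess a n₁ n₃ + excess b n₁ n₂
    a+b-form ax by eD eE h = trans (cong₂ _+_ ax by) (trans h (sym (cong₂ (λ s t → (n₁ + n₄) + s + t) eD eE)))

    other< : ∀ {x y x′ y′} → x + y ≡ x′ + y′ → x < x′ → y′ < y
    other< {x} {y} {x′} {y′} eq lt = ≰⇒> λ y≤y′ → <-irrefl eq (+-mono-<-≤ lt y≤y′)

    comb : ∀ x y z → z ≤ y → x + y ≡ (x + z) + 0 + (y ∸ z)
    comb x y z le = trans (cong (x +_) (sym (m+[n∸m]≡n le))) (trans (sym (+-assoc x z (y ∸ z))) (cong (_+ (y ∸ z)) (sym (+-identityʳ (x + z)))))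

  -- If n₁ ≠ n₂, then a is the smaller of n₁, n₂ and, by balance, also equals the matching one of
  -- n₃, n₄; the four exponents then pair up and only the excess of b survives. The case n₁ ≠ n₃ is
  -- the mirror image. If all four agree, both excesses may be positive.
  excess-balanced : n₁ + n₄ ≡ n₂ + n₃ → a + b ≡ (n₁ + n₄) + excess a n₁ n₃ + excess b n₁ n₂
  excess-balanced eq with <-cmp n₁ n₂
  ... | tri< n₁<n₂ _ _ = a+b-form (left u₁₂ n₁<n₂) refl (excess≡0ˡ n₃ (≤-reflexive (left u₁₂ n₁<n₂))) (excess≡ʳ b (<⇒≤ n₁<n₂))
      (subst (λ t → n₁ + b ≡ (n₁ + t) + 0 + (b ∸ n₂)) (sym n₄≡n₂) (comb n₁ b n₂ n₂≤b))
    where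
    n₁≡n₃ : n₁ ≡ n₃
    n₁≡n₃ = trans (sym (left u₁₂ n₁<n₂)) (left u₃₄ (other< eq n₁<n₂))
    n₄≡n₂ : n₄ ≡ n₂
    n₄≡n₂ = +-cancelˡ-≡ n₃ n₄ n₂ (trans (cong (_+ n₄) (sym n₁≡n₃)) (trans eq (+-comm n₂ n₃)))
    n₂≤b : n₂ ≤ b
    n₂≤b = subst (_≤ b) (trans (cong (n₂ ⊓_) n₄≡n₂) (⊓-idem n₂)) (lower u₂₄)
  ... | tri> _ _ n₂<n₁ = a+b-form (right u₁₂ n₂<n₁) refl
      (excess≡0ˡ n₃ (≤-trans (≤-reflexive (right u₁₂ n₂<n₁)) (<⇒≤ n₂<n₁))) (excess≡ˡ b (<⇒≤ n₂<n₁))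
      (trans (comb n₂ b n₁ n₁≤b) (cong (λ t → t + 0 + (b ∸ n₁)) (trans (+-comm n₂ n₁) (cong (n₁ +_) n₂≡n₄))))
    where
    n₂≡n₄ : n₂ ≡ n₄
    n₂≡n₄ = trans (sym (right u₁₂ n₂<n₁)) (right u₃₄ (other< (sym eq) n₂<n₁))
    n₃≡n₁ : n₃ ≡ n₁
    n₃≡n₁ = +-cancelˡ-≡ n₂ n₃ n₁ (trans (sym eq) (trans (+-comm n₁ n₄) (cong (_+ n₁) (sym n₂≡n₄))))
    n₁≤b : n₁ ≤ b
    n₁≤b = subst (_≤ b) (trans (cong (n₁ ⊓_) n₃≡n₁) (⊓-idem n₁)) (lower u₁₃)
  ... | tri≈ _ refl _ with +-cancelˡ-≡ n₁ n₄ n₃ eq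
  ... | refl with <-cmp n₁ n₃
  ... | tri< n₁<n₃ _ _ = a+b-form refl (left u₁₃ n₁<n₃) (excess≡ʳ a (<⇒≤ n₁<n₃)) (excess≡0ˡ n₁ (≤-reflexive (left u₁₃ n₁<n₃)))
      (trans (+-comm a n₁) (trans (comb n₁ a n₃ n₃≤a) (swap₀ (n₁ + n₃) (a ∸ n₃))))
    where
    swap₀ : ∀ x y → x + 0 + y ≡ x + y + 0
    swap₀ = solve-∀
    n₃≤a : n₃ ≤ a
    n₃≤a = subst (_≤ a) (⊓-idem n₃) (lower u₃₄)
  ... | tri> _ _ n₃<n₁ = a+b-form refl (right u₁₃ n₃<n₁) (excess≡ˡ a (<⇒≤ n₃<n₁))
      (excess≡0ˡ n₁ (≤-trans (≤-reflexive (right u₁₃ n₃<n₁)) (<⇒≤ n₃<n₁)))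
      (trans (+-comm a n₃) (trans (comb n₃ a n₁ n₁≤a) (swap₀ n₃ n₁ (a ∸ n₁))))
    where
    swap₀ : ∀ x y z → (x + y) + 0 + z ≡ (y + x) + z + 0
    swap₀ = solve-∀
    n₁≤a : n₁ ≤ a
    n₁≤a = subst (_≤ a) (⊓-idem n₁) (lower u₁₂)
  ... | tri≈ _ refl _ = a+b-form refl refl (⊓-idem (a ∸ n₁)) (⊓-idem (b ∸ n₁))
      (trans (cong₂ _+_ (sym (m+[n∸m]≡n n₁≤a)) (sym (m+[n∸m]≡n n₁≤b))) (rearrange n₁ (a ∸ n₁) (b ∸ n₁)))
    where
    rearrange : ∀ n x y → (n + x) + (n + y) ≡ (n + n) + x + y
    rearrange = solve-∀
    n₁≤a : n₁ ≤ a
    n₁≤a = subst (_≤ a) (⊓-idem n₁) (lower u₁₂)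
    n₁≤b : n₁ ≤ b
    n₁≤b = subst (_≤ b) (⊓-idem n₁) (lower u₁₃)

  -- Imbalance forces two unequal exponents on one of two parallel edges. There the valuation of the
  -- difference is the smaller exponent, which truncates the excess to 0.
  excess-unbalanced : n₁ + n₄ ≢ n₂ + n₃ → excess a n₁ n₃ ≡ 0 × excess b n₁ n₂ ≡ 0
  excess-unbalanced ne = first , second
    where
    first : excess a n₁ n₃ ≡ 0
    first with <-cmp n₁ n₂ | <-cmp n₃ n₄
    ... | tri< lt _ _ | _ = excess≡0ˡ n₃ (≤-reflexive (left u₁₂ lt))
    ... | tri> _ _ gt | _ = excess≡0ˡ n₃ (≤-trans (≤-reflexive (right u₁₂ gt)) (<⇒≤ gt))
    ... | _ | tri< lt _ _ = excess≡0ʳ n₁ (≤-reflexive (left u₃₄ lt))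
    ... | _ | tri> _ _ gt = excess≡0ʳ n₁ (≤-trans (≤-reflexive (right u₃₄ gt)) (<⇒≤ gt))
    ... | tri≈ _ refl _ | tri≈ _ refl _ = ⊥-elim (ne refl)
    second : excess b n₁ n₂ ≡ 0
    second with <-cmp n₁ n₃ | <-cmp n₂ n₄
    ... | tri< lt _ _ | _ = excess≡0ˡ n₂ (≤-reflexive (left u₁₃ lt))
    ... | tri> _ _ gt | _ = excess≡0ˡ n₂ (≤-trans (≤-reflexive (right u₁₃ gt)) (<⇒≤ gt))
    ... | _ | tri< lt _ _ = excess≡0ʳ n₁ (≤-reflexive (left u₂₄ lt))
    ... | _ | tri> _ _ gt = excess≡0ʳ n₁ (≤-trans (≤-reflexive (right u₂₄ gt)) (<⇒≤ gt))
    ... | tri≈ _ refl _ | tri≈ _ refl _ = ⊥-elim (ne (+-comm n₁ n₂))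

-- The event in which `lifting` applies to the products of the roots at opposite edges, once their
-- powers of p are stripped off.
agree? : ∀ p z₁ z₂ z₃ z₄ → Dec (pstar p ∣ dist (unitPart p z₂ * unitPart p z₃) (unitPart p z₁ * unitPart p z₄))
agree? p z₁ z₂ z₃ z₄ = pstar p ∣? dist (unitPart p z₂ * unitPart p z₃) (unitPart p z₁ * unitPart p z₄)

module _ {p q : ℕ} (prp : Prime p) (prq : Prime q) {z₁ z₂ z₃ z₄ D E : ℕ}
  (z₁>0 : 0 < z₁) (z₂>0 : 0 < z₂) (z₃>0 : 0 < z₃) (z₄>0 : 0 < z₄) (D>0 : 0 < D) (E>0 : 0 < E)
  (d₁₂ : dist (z₁ ^ q) (z₂ ^ q) ≡ D) (d₃₄ : dist (z₃ ^ q) (z₄ ^ q) ≡ D)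
  (d₁₃ : dist (z₁ ^ q) (z₃ ^ q) ≡ E) (d₂₄ : dist (z₂ ^ q) (z₄ ^ q) ≡ E)
  (dXY : dist ((z₂ * z₃) ^ q) ((z₁ * z₄) ^ q) ≡ D * E) (h>0 : 0 < dist (z₂ * z₃) (z₁ * z₄)) where

  private
    v : ℕ → ℕ
    v = val p
    h X Y X′ Y′ a b e : ℕ
    h = dist (z₂ * z₃) (z₁ * z₄)
    X = z₂ * z₃
    Y = z₁ * z₄
    X′ = unitPart p z₂ * unitPart p z₃
    Y′ = unitPart p z₁ * unitPart p z₄
    a = v D
    b = v E
    e = excess a (q * v z₁) (q * v z₃) + excess b (q * v z₁) (q * v z₂)
    2≤p = prime⇒2≤ prp
    0<q = prime⇒0< prq

    ultra : ∀ {x y d} → 0 < x → 0 < y → 0 < d → dist (x ^ q) (y ^ q) ≡ d → Ultrametric (q * v x) (q * v y) (v d)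
    ultra {x} {y} {d} 0<x 0<y 0<d refl = subst₂ (λ s t → Ultrametric s t (v d)) (val-^ prp 0<x q) (val-^ prp 0<y q)
      (val-dist prp (^>0 q 0<x) (^>0 q 0<y) 0<d)

    uXY : Ultrametric (q * (v z₂ + v z₃)) (q * (v z₁ + v z₄)) (a + b)
    uXY = subst₂ (λ s t → Ultrametric (q * s) (q * t) (a + b)) (val-* prp z₂>0 z₃>0) (val-* prp z₁>0 z₄>0)
      (subst (Ultrametric (q * v X) (q * v Y)) (val-* prp D>0 E>0)
        (ultra (*>0 z₂>0 z₃>0) (*>0 z₁>0 z₄>0) (*>0 D>0 E>0) dXY))

    split : ∀ x y → x * y ≡ p ^ (v x + v y) * (unitPart p x * unitPart p y)
    split x y = trans (cong₂ _*_ (unitPart-eq p x) (unitPart-eq p y)) (trans (shuffle (p ^ v x) (unitPart p x) (p ^ v y) (unitPart p y))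
      (cong (_* (unitPart p x * unitPart p y)) (sym (^-distribˡ-+-* p (v x) (v y)))))
      where
      shuffle : ∀ a b c d → (a * b) * (c * d) ≡ (a * c) * (b * d)
      shuffle = solve-∀

    low : ∀ {k} → k ≤ v z₂ + v z₃ → k ≤ v z₁ + v z₄ → k ≤ v (q * h)
    low {k} k≤X k≤Y = ∣⇒≤val 2≤p (*>0 0<q h>0) (∣n⇒∣m*n q (∣-dist
      (subst (p ^ k ∣_) (sym (split z₂ z₃)) (∣m⇒∣m*n X′ (m≤n⇒p^m∣p^n p k≤X)))
      (subst (p ^ k ∣_) (sym (split z₁ z₄)) (∣m⇒∣m*n Y′ (m≤n⇒p^m∣p^n p k≤Y)))))

    factor : ∀ μ → v z₂ + v z₃ ≡ μ → v z₁ + v z₄ ≡ μ → h ≡ p ^ μ * dist X′ Y′ × D * E ≡ p ^ (q * μ) * dist (X′ ^ q) (Y′ ^ q)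
    factor μ eX eY = trans (cong₂ dist X≡ Y≡) (dist-* (p ^ μ) X′ Y′) ,
      trans (sym dXY) (trans (cong₂ dist (pow X≡) (pow Y≡)) (dist-* (p ^ (q * μ)) (X′ ^ q) (Y′ ^ q)))
      where
      X≡ : X ≡ p ^ μ * X′
      X≡ = trans (split z₂ z₃) (cong (λ t → p ^ t * X′) eX)
      Y≡ : Y ≡ p ^ μ * Y′
      Y≡ = trans (split z₁ z₄) (cong (λ t → p ^ t * Y′) eY)
      pow : ∀ {x x′} → x ≡ p ^ μ * x′ → x ^ q ≡ p ^ (q * μ) * x′ ^ q
      pow {x} {x′} refl = trans (^-distrib-* q (p ^ μ) x′) (cong (_* x′ ^ q) (trans (^-*-assoc p μ q) (cong (p ^_) (*-comm μ q))))

    agree⇒ : ∀ μ → v z₂ + v z₃ ≡ μ → v z₁ + v z₄ ≡ μ → pstar p ∣ dist X′ Y′ → a + b ≡ q * μ + e → μ + e ≤ v (q * h)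
    agree⇒ μ eX eY ag ab≡ = ∣⇒≤val 2≤p (*>0 0<q h>0) (subst (_∣ q * h) (sym (^-distribˡ-+-* p μ e))
        (subst (p ^ μ * p ^ e ∣_) (trans (shuffle (p ^ μ) q (dist X′ Y′)) (cong (q *_) (sym (proj₁ fac))))
          (*-monoʳ-∣ (p ^ μ) lifted)))
      where
      fac = factor μ eX eY
      shuffle : ∀ x y z → x * (y * z) ≡ y * (x * z)
      shuffle = solve-∀
      total : p ^ (q * μ) * p ^ e ∣ p ^ (q * μ) * dist (X′ ^ q) (Y′ ^ q)
      total = subst₂ _∣_ (trans (cong (p ^_) (trans (val-* prp D>0 E>0) ab≡)) (^-distribˡ-+-* p (q * μ) e)) (proj₂ fac) (maxPower-∣ p (D * E) (D * E))
      lifted : p ^ e ∣ q * dist X′ Y′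
      lifted = lifting (ℤ.+ X′) (ℤ.+ Y′) prp prq (fromAbs (ℤ.+ X′ ℤ.- ℤ.+ Y′) ag)
        (λ d → ∤-* prp (p∤unitPart 2≤p z₁>0) (p∤unitPart 2≤p z₄>0) (toAbs (ℤ.+ Y′) d)) e
        (subst (p ^ e ∣_) (cong ℤ.∣_∣ (cong₂ ℤ._-_ (pos-^ X′ q) (pos-^ Y′ q)))
          (*-cancelˡ-∣ (p ^ (q * μ)) {{>-nonZero (^>0 (q * μ) (prime⇒0< prp))}} total))

  -- In the balanced case a + b = q μ + e, with μ the common valuation of both products. Then h has
  -- valuation at least μ anyway, and agreement lifts the valuation of q h to μ + e, a gain of q e.
  -- In the unbalanced case e = 0, and a + b is q times the smaller valuation of the two products.
  quadVal : a + b + q * (ind (agree? p z₁ z₂ z₃ z₄) * e) ≤ q * v (q * h) + e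
  quadVal with (v z₁ + v z₄) ≟ (v z₂ + v z₃)
  ... | yes eq = balanced (agree? p z₁ z₂ z₃ z₄)
    where
    μ = v z₁ + v z₄
    dist-q : q * v z₁ + q * v z₄ ≡ q * μ
    dist-q = sym (*-distribˡ-+ q (v z₁) (v z₄))
    ab≡ : a + b ≡ q * μ + e
    ab≡ = trans (excess-balanced (ultra z₁>0 z₂>0 D>0 d₁₂) (ultra z₃>0 z₄>0 D>0 d₃₄) (ultra z₁>0 z₃>0 E>0 d₁₃) (ultra z₂>0 z₄>0 E>0 d₂₄)
        (trans dist-q (trans (cong (q *_) eq) (*-distribˡ-+ q (v z₂) (v z₃)))))
      (trans (+-assoc (q * v z₁ + q * v z₄) _ _) (cong (_+ e) dist-q))
    balanced : (ag : Dec (pstar p ∣ dist X′ Y′)) → a + b + q * (ind ag * e) ≤ q * v (q * h) + e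
    balanced (no _) = begin
      a + b + q * 0 ≡⟨ trans (cong (a + b +_) (*-zeroʳ q)) (trans (+-identityʳ (a + b)) ab≡) ⟩
      q * μ + e ≤⟨ +-monoˡ-≤ e (*-monoʳ-≤ q (low (≤-reflexive eq) ≤-refl)) ⟩
      q * v (q * h) + e ∎
      where open ≤-Reasoning
    balanced (yes ag) = begin
      a + b + q * (1 * e) ≡⟨ trans (cong (_+ q * (1 * e)) ab≡) (rearrange q μ e) ⟩
      q * (μ + e) + e ≤⟨ +-monoˡ-≤ e (*-monoʳ-≤ q (agree⇒ μ (sym eq) refl ag ab≡)) ⟩
      q * v (q * h) + e ∎
      where
      open ≤-Reasoning
      rearrange : ∀ q μ e → q * μ + e + q * (1 * e) ≡ q * (μ + e) + e
      rearrange = solve-∀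
  ... | no ne = begin
      a + b + q * (ind (agree? p z₁ z₂ z₃ z₄) * e)
        ≡⟨ cong (a + b +_) (trans (cong (λ t → q * (ind (agree? p z₁ z₂ z₃ z₄) * t)) e≡0) (trans (cong (q *_) (*-zeroʳ (ind (agree? p z₁ z₂ z₃ z₄)))) (*-zeroʳ q))) ⟩
      a + b + 0 ≡⟨ +-identityʳ (a + b) ⟩
      a + b ≤⟨ minimum ⟩
      q * v (q * h) ≤⟨ m≤m+n _ e ⟩
      q * v (q * h) + e ∎
    where
    open ≤-Reasoning
    instance
      nzq : NonZero q
      nzq = prime⇒nonZero prq
    zeros = excess-unbalanced (ultra z₁>0 z₂>0 D>0 d₁₂) (ultra z₃>0 z₄>0 D>0 d₃₄) (ultra z₁>0 z₃>0 E>0 d₁₃) (ultra z₂>0 z₄>0 E>0 d₂₄)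
      (λ eq → ne (*-cancelˡ-≡ _ _ q (trans (*-distribˡ-+ q (v z₁) (v z₄)) (trans eq (sym (*-distribˡ-+ q (v z₂) (v z₃)))))))
    e≡0 : e ≡ 0
    e≡0 = cong₂ _+_ (proj₁ zeros) (proj₂ zeros)
    minimum : a + b ≤ q * v (q * h)
    minimum with <-cmp (v z₁ + v z₄) (v z₂ + v z₃)
    ... | tri< lt _ _ = ≤-trans (≤-reflexive (right uXY (*-monoʳ-< q lt))) (*-monoʳ-≤ q (low (<⇒≤ lt) ≤-refl))
    ... | tri≈ _ eq _ = ⊥-elim (ne eq)
    ... | tri> _ _ gt = ≤-trans (≤-reflexive (left uXY (*-monoʳ-< q gt))) (*-monoʳ-≤ q (low ≤-refl (<⇒≤ gt)))

-- Averaging agreement over one pair of rows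

module _ {p q K : ℕ} (prp : Prime p) (prq : Prime q) (z z′ x : Fin K → ℕ) (D : ℕ)
  (z>0 : ∀ j → 0 < z j) (z′>0 : ∀ j → 0 < z′ j) (D>0 : 0 < D) (x²≤x : ∀ j → x j * x j ≤ x j)
  (dist≡D : ∀ j → 0 < x j → dist (z j ^ q) (z′ j ^ q) ≡ D) where

  private
    u u′ ι : Fin K → ℕ
    u j = unitPart p (z j)
    u′ j = unitPart p (z′ j)
    inverse : ∀ j → ∃ λ k → k * u j ≡ 1 mod pstar p
    inverse j = coprime⇒inverse (∤⇒coprime-pstar prp (p∤unitPart (prime⇒2≤ prp) (z>0 j)))
    ι j = proj₁ (inverse j)
    instance
      nz⋆ : NonZero (pstar p)
      nz⋆ = >-nonZero (pstar>0 prp)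
      nzq : NonZero q
      nzq = prime⇒nonZero prq
    a : ℕ
    a = val p D
    -- The class of the ratio of unit parts, u′ j / u j; equal classes at j and j′ give agreement by
    -- cross-multiplication.
    ρ : Fin K → Fin (pstar p)
    ρ j = fromℕ< (m%n<n (u′ j * ι j) (pstar p))

    ρ≡ : ∀ j → u′ j * ι j ≡ toℕ (ρ j) mod pstar p
    ρ≡ j = mod-trans (mod-% (pstar p) (u′ j * ι j)) (mod-reflexive (sym (toℕ-fromℕ< (m%n<n (u′ j * ι j) (pstar p)))))

    agree : ∀ j j′ → ρ j ≡ ρ j′ → ind (agree? p (z j) (z′ j) (z j′) (z′ j′)) ≡ 1
    agree j j′ eq = ind-yes (agree? p (z j) (z′ j) (z j′) (z′ j′)) (toAbs _ (mod-elim
        (mod-trans (mod-sym (toLetter (u′ j) (u j′) (ι j) (u j) (proj₂ (inverse j)) (ρ≡ j)))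
          (mod-trans (mod-reflexive (swapU (toℕ (ρ j)) (u j) (u j′)))
          (mod-trans (mod-reflexive (cong (λ c → toℕ c * (u j′ * u j)) eq))
          (mod-trans (toLetter (u′ j′) (u j) (ι j′) (u j′) (proj₂ (inverse j′)) (ρ≡ j′))
            (mod-reflexive (*-comm (u′ j′) (u j)))))))))
      where
      swapU : ∀ c s t → c * (s * t) ≡ c * (t * s)
      swapU c s t = cong (c *_) (*-comm s t)
      toLetter : ∀ w s k t {c} → k * t ≡ 1 mod pstar p → w * k ≡ c mod pstar p → c * (t * s) ≡ w * s mod pstar p
      toLetter w s k t {c} inv eq = mod-trans (mod-* (mod-sym eq) mod-refl) (mod-trans (mod-reflexive (shuffle w k t s))
          (mod-trans (mod-* inv mod-refl) (mod-reflexive (*-identityˡ (w * s)))))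
        where
        shuffle : ∀ w k t s → w * k * (t * s) ≡ k * t * (w * s)
        shuffle = solve-∀

    -- A valuation of D above that of z j ^ q forces z j and z′ j to have the same valuation and
    -- their unit parts to have congruent q-th powers; hence the ratio is a q-th root of unity
    -- modulo p.
    isLetter : ∀ j → 0 < x j → 0 < a ∸ q * val p (z j) → letter p q (ρ j) ≡ 1
    isLetter j 0<x alive = ind-yes (p ∣? _) (subst (λ t → p ∣ ℤ.∣ t ℤ.- ℤ.1ℤ ∣) (pos-^ (toℕ (ρ j)) q)
        (toAbs (ℤ.+ (toℕ (ρ j) ^ q) ℤ.- ℤ.1ℤ) (mod-elim root)))
      where
      Deq = dist≡D j 0<x
      qm<a : q * val p (z j) < a
      qm<a = ≰⇒> λ le → <⇒≢ alive (sym (m≤n⇒m∸n≡0 le))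
      ultra : Ultrametric (q * val p (z j)) (q * val p (z′ j)) a
      ultra = subst₂ (λ s t → Ultrametric s t a) (val-^ prp (z>0 j) q) (val-^ prp (z′>0 j) q)
        (subst (λ d → Ultrametric (val p (z j ^ q)) (val p (z′ j ^ q)) (val p d)) Deq
          (val-dist prp (^>0 q (z>0 j)) (^>0 q (z′>0 j)) (subst (0 <_) (sym Deq) D>0)))
      m≡m′ : val p (z j) ≡ val p (z′ j)
      m≡m′ with <-cmp (val p (z j)) (val p (z′ j))
      ... | tri< lt _ _ = ⊥-elim (<-irrefl (sym (left ultra (*-monoʳ-< q lt))) qm<a)
      ... | tri≈ _ eq _ = eq
      ... | tri> _ _ gt = ⊥-elim (<-asym qm<a (subst (_< q * val p (z j)) (sym (right ultra (*-monoʳ-< q gt))) (*-monoʳ-< q gt)))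
      m = val p (z j)
      power : ∀ y w → y ≡ p ^ m * w → y ^ q ≡ p ^ (q * m) * w ^ q
      power y w refl = trans (^-distrib-* q (p ^ m) w) (cong (_* w ^ q) (trans (^-*-assoc p m q) (cong (p ^_) (*-comm m q))))
      D≡ : D ≡ p ^ (q * m) * dist (u j ^ q) (u′ j ^ q)
      D≡ = trans (sym Deq) (trans (cong₂ dist (power (z j) (u j) (unitPart-eq p (z j)))
        (power (z′ j) (u′ j) (trans (unitPart-eq p (z′ j)) (cong (λ t → p ^ t * u′ j) (sym m≡m′))))) (dist-* (p ^ (q * m)) _ _))
      p∣ : p ∣ dist (u j ^ q) (u′ j ^ q)
      p∣ = *-cancelˡ-∣ (p ^ (q * m)) {{>-nonZero (^>0 (q * m) (prime⇒0< prp))}}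
        (subst₂ _∣_ (*-comm p (p ^ (q * m))) D≡ (≤val⇒∣ p D qm<a))
      units : u j ^ q ≡ u′ j ^ q mod p
      units = mod-intro (fromAbs _ p∣)
      root : toℕ (ρ j) ^ q ≡ 1 mod p
      root = mod-trans (mod-^ (mod-weaken (p∣pstar p) (mod-sym (ρ≡ j))) q)
        (mod-trans (mod-reflexive (^-distrib-* q (u′ j) (ι j)))
        (mod-trans (mod-* (mod-sym units) mod-refl)
        (mod-trans (mod-reflexive (trans (*-comm (u j ^ q) (ι j ^ q)) (sym (^-distrib-* q (ι j) (u j)))))
        (mod-trans (mod-^ (mod-weaken (p∣pstar p) (proj₂ (inverse j))) q) (mod-reflexive (^-zeroˡ q))))))

  ex : Fin K → Fin K → ℕ
  ex j j′ = excess a (q * val p (z j)) (q * val p (z j′))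

  ag : Fin K → Fin K → ℕ
  ag j j′ = ind (agree? p (z j) (z′ j) (z j′) (z′ j′))

  -- The ratios that carry any excess lie in at most q classes and pairs within a class agree, so
  -- agreement captures at least 1/q of the excess. The diagonal is separated because only j ≠ j′
  -- yields a 4-cycle; it becomes the error term.
  pairBound : sum (λ j → sum (λ j′ → ≠ᵢ j j′ * (x j * x j′) * ex j j′)) ≤
    q * (sum (λ j → sum (λ j′ → ≠ᵢ j j′ * (x j * x j′) * (ag j j′ * ex j j′))) + sum (λ j → x j * a))
  pairBound = begin
    sum (λ j → sum (λ j′ → ≠ᵢ j j′ * (x j * x j′) * ex j j′))
      ≤⟨ sum-mono (λ j → sum-mono (λ j′ → *-monoˡ-≤ (ex j j′)
           (≤-trans (*-monoˡ-≤ (x j * x j′) (ind≤1 (¬? (j ≟F j′)))) (≤-reflexive (*-identityˡ (x j * x j′)))))) ⟩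
    sum (λ j → sum (λ j′ → x j * x j′ * ex j j′))
      ≤⟨ fewClasses-⊓ q a (letter p q) ρ x (λ j → a ∸ q * val p (z j)) (sum-letter≤ prp (prime⇒2≤ prq))
           (λ c → ≤-reflexive (ind-*-idem (p ∣? _))) (λ j → m∸n≤m a (q * val p (z j))) isLetter ⟩
    q * sum (λ j → sum (λ j′ → ind (ρ j ≟F ρ j′) * (x j * x j′ * ex j j′)))
      ≤⟨ *-monoʳ-≤ q (sum-mono (λ j → sum-mono (λ j′ → same⇒agree j j′))) ⟩
    q * sum (λ j → sum (λ j′ → ag j j′ * (x j * x j′ * ex j j′)))
      ≤⟨ *-monoʳ-≤ q (sum₂≤offDiag+diag (λ j j′ → ag j j′ * (x j * x j′ * ex j j′))) ⟩
    q * (sum (λ j → sum (λ j′ → ≠ᵢ j j′ * (ag j j′ * (x j * x j′ * ex j j′)))) + sum (λ j → ag j j * (x j * x j * ex j j)))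
      ≤⟨ *-monoʳ-≤ q (+-mono-≤ (≤-reflexive (sum-cong (λ j → sum-cong (λ j′ → shuffle (≠ᵢ j j′) (ag j j′) (x j * x j′) (ex j j′)))))
           (sum-mono diag)) ⟩
    q * (sum (λ j → sum (λ j′ → ≠ᵢ j j′ * (x j * x j′) * (ag j j′ * ex j j′))) + sum (λ j → x j * a)) ∎
    where
    open ≤-Reasoning
    shuffle : ∀ n g y e → n * (g * (y * e)) ≡ n * y * (g * e)
    shuffle = solve-∀
    same⇒agree : ∀ j j′ → ind (ρ j ≟F ρ j′) * (x j * x j′ * ex j j′) ≤ ag j j′ * (x j * x j′ * ex j j′)
    same⇒agree j j′ with ρ j ≟F ρ j′
    ... | yes eq = ≤-reflexive (cong (_* (x j * x j′ * ex j j′)) (sym (agree j j′ eq)))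
    ... | no _ = z≤n
    diag : ∀ j → ag j j * (x j * x j * ex j j) ≤ x j * a
    diag j = ≤-trans (*-monoˡ-≤ (x j * x j * ex j j) (ind≤1 (agree? p (z j) (z′ j) (z j) (z′ j))))
      (≤-trans (≤-reflexive (*-identityˡ _)) (*-mono-≤ (x²≤x j)
        (≤-trans (m⊓n≤m _ _) (m∸n≤m a (q * val p (z j))))))

-- Powers close to each other

bernoulli : ∀ y h k → y ^ suc k + suc k * (h * y ^ k) ≤ (y + h) ^ suc k
bernoulli y h zero = ≤-reflexive (eq y h)
  where
  eq : ∀ y h → y * 1 + (h * 1 + 0) ≡ (y + h) * 1
  eq = solve-∀
bernoulli y h (suc k) = begin
  y ^ suc (suc k) + suc (suc k) * (h * y ^ suc k) ≤⟨ m≤m+n _ (suc k * (h * h * y ^ k)) ⟩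
  y ^ suc (suc k) + suc (suc k) * (h * y ^ suc k) + suc k * (h * h * y ^ k) ≡⟨ expand y h (suc k) (y ^ k) ⟩
  (y + h) * (y ^ suc k + suc k * (h * y ^ k)) ≤⟨ *-monoʳ-≤ (y + h) (bernoulli y h k) ⟩
  (y + h) ^ suc (suc k) ∎
  where
  open ≤-Reasoning
  expand : ∀ y h n w → y * (y * w) + (1 + n) * (h * (y * w)) + n * (h * h * w) ≡ (y + h) * (y * w + n * (h * w))
  expand = solve-∀

-- Bernoulli gives q h Y^(q−1) ≤ W ≤ Y^q / 4, so 4 q h ≤ Y, and this is fed back into q h Y^(q−1) ≤ W.
closeRoots : ∀ q {Y h W} → 2 ≤ q → 0 < Y → (Y + h) ^ q ≡ Y ^ q + W → 4 * W ≤ Y ^ q → (2 * (q * h)) ^ q ≤ W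
closeRoots q@(suc k) {Y} {h} {W} 2≤q 0<Y eq 4W≤ = begin
  (2 * (q * h)) ^ q ≡⟨ ^-distrib-* q 2 (q * h) ⟩
  2 ^ q * (q * h) ^ q ≤⟨ *-monoˡ-≤ ((q * h) ^ q) (^-monoʳ-≤ 2 q≤2k) ⟩
  2 ^ (2 * k) * (q * h) ^ q ≡⟨ cong (_* (q * h) ^ q) (sym (^-*-assoc 2 2 k)) ⟩
  4 ^ k * (q * h) ^ q ≡⟨ trans (shuffle (4 ^ k) (q * h) ((q * h) ^ k)) (cong (q * h *_) (sym (^-distrib-* k 4 (q * h)))) ⟩
  q * h * (4 * (q * h)) ^ k ≤⟨ *-monoʳ-≤ (q * h) (^-monoˡ-≤ k 4qh≤Y) ⟩
  q * h * Y ^ k ≤⟨ W≥ ⟩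
  W ∎
  where
  open ≤-Reasoning
  shuffle : ∀ a b c → a * (b * c) ≡ b * (a * c)
  shuffle = solve-∀
  q≤2k : q ≤ 2 * k
  q≤2k = subst (q ≤_) (cong (k +_) (sym (+-identityʳ k))) (+-monoˡ-≤ k (s≤s⁻¹ 2≤q))
  W≥ : q * h * Y ^ k ≤ W
  W≥ = +-cancelˡ-≤ (Y ^ q) _ _ (≤-trans (+-monoʳ-≤ (Y ^ q) (≤-reflexive (*-assoc q h (Y ^ k))))
    (≤-trans (bernoulli Y h k) (≤-reflexive eq)))
  4qh≤Y : 4 * (q * h) ≤ Y
  4qh≤Y = *-cancelʳ-≤ (4 * (q * h)) Y (Y ^ k) {{>-nonZero (^>0 k 0<Y)}}
    (≤-trans (≤-reflexive (*-assoc 4 (q * h) (Y ^ k))) (≤-trans (*-monoʳ-≤ 4 W≥) 4W≤))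

dist-≤ : ∀ {x y} → y ≤ x → dist x y ≡ x ∸ y
dist-≤ {x} {y} le = trans (cong ℤ.∣_∣ (ℤP.m-n≡m⊖n x y)) (trans (ℤP.∣m⊖n∣≡∣n⊖m∣ x y) (ℤP.∣⊖∣-≤ le))

closeRoots-dist : ∀ q {X Y W} → 2 ≤ q → 0 < X → 0 < Y → dist (X ^ q) (Y ^ q) ≡ W → 4 * W ≤ X ^ q → 4 * W ≤ Y ^ q →
  (2 * (q * dist X Y)) ^ q ≤ W
closeRoots-dist q {X} {Y} {W} 2≤q 0<X 0<Y d hX hY with ≤-total Y X
... | inj₁ le = subst (λ t → (2 * (q * t)) ^ q ≤ W) (sym (dist-≤ le)) (closeRoots q 2≤q 0<Y
      (trans (cong (_^ q) (m+[n∸m]≡n le)) (trans (sym (m+[n∸m]≡n le^)) (cong (Y ^ q +_) (trans (sym (dist-≤ le^)) d)))) hY)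
  where le^ = ^-monoˡ-≤ q le
... | inj₂ le = subst (λ t → (2 * (q * t)) ^ q ≤ W) (trans (sym (dist-≤ le)) (dist-sym Y X)) (closeRoots q 2≤q 0<X
      (trans (cong (_^ q) (m+[n∸m]≡n le)) (trans (sym (m+[n∸m]≡n le^))
        (cong (X ^ q +_) (trans (sym (dist-≤ le^)) (trans (dist-sym (Y ^ q) (X ^ q)) d))))) hX)
  where le^ = ^-monoˡ-≤ q le

-- Sums and products over quadruples

module _ {m n o r : ℕ} where
  sum₄ ∏₄ : (Fin m → Fin n → Fin o → Fin r → ℕ) → ℕ
  sum₄ f = sum (λ i → sum (λ j → sum (λ k → sum (f i j k))))
  ∏₄ f = ∏ (λ i → ∏ (λ j → ∏ (λ k → ∏ (f i j k))))

  sum₄-mono : ∀ {f g} → (∀ i j k l → f i j k l ≤ g i j k l) → sum₄ f ≤ sum₄ g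
  sum₄-mono h = sum-mono (λ i → sum-mono (λ j → sum-mono (λ k → sum-mono (h i j k))))

  sum₄-cong : ∀ {f g} → (∀ i j k l → f i j k l ≡ g i j k l) → sum₄ f ≡ sum₄ g
  sum₄-cong h = sum-cong (λ i → sum-cong (λ j → sum-cong (λ k → sum-cong (h i j k))))

  sum₄-+ : ∀ f g → sum₄ (λ i j k l → f i j k l + g i j k l) ≡ sum₄ f + sum₄ g
  sum₄-+ f g = trans (sum-cong (λ i → trans (sum-cong (λ j → trans (sum-cong (λ k → ∑-distrib-+ (f i j k) (g i j k)))
    (∑-distrib-+ (λ k → sum (f i j k)) (λ k → sum (g i j k)))))
    (∑-distrib-+ (λ j → sum (λ k → sum (f i j k))) (λ j → sum (λ k → sum (g i j k))))))
    (∑-distrib-+ (λ i → sum (λ j → sum (λ k → sum (f i j k)))) (λ i → sum (λ j → sum (λ k → sum (g i j k)))))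

  sum₄-*ˡ : ∀ c f → sum₄ (λ i j k l → c * f i j k l) ≡ c * sum₄ f
  sum₄-*ˡ c f = sym (trans (*-distribˡ-sum c (λ i → sum (λ j → sum (λ k → sum (f i j k)))))
    (sum-cong (λ i → trans (*-distribˡ-sum c (λ j → sum (λ k → sum (f i j k))))
    (sum-cong (λ j → trans (*-distribˡ-sum c (λ k → sum (f i j k))) (sum-cong (λ k → *-distribˡ-sum c (f i j k))))))))

  ∏₄-mono : ∀ {f g} → (∀ i j k l → f i j k l ≤ g i j k l) → ∏₄ f ≤ ∏₄ g
  ∏₄-mono h = ∏-mono (λ i → ∏-mono (λ j → ∏-mono (λ k → ∏-mono (h i j k))))

  ∏₄>0 : ∀ {f} → (∀ i j k l → 0 < f i j k l) → 0 < ∏₄ f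
  ∏₄>0 h = ∏>0 (λ i → ∏>0 (λ j → ∏>0 (λ k → ∏>0 (h i j k))))

  ∏₄-* : ∀ f g → ∏₄ (λ i j k l → f i j k l * g i j k l) ≡ ∏₄ f * ∏₄ g
  ∏₄-* f g = trans (Prod.sum-cong-≗ (λ i → trans (Prod.sum-cong-≗ (λ j → trans (Prod.sum-cong-≗ (λ k → Prod.∑-distrib-+ (f i j k) (g i j k)))
    (Prod.∑-distrib-+ (λ k → ∏ (f i j k)) (λ k → ∏ (g i j k)))))
    (Prod.∑-distrib-+ (λ j → ∏ (λ k → ∏ (f i j k))) (λ j → ∏ (λ k → ∏ (g i j k))))))
    (Prod.∑-distrib-+ (λ i → ∏ (λ j → ∏ (λ k → ∏ (f i j k)))) (λ i → ∏ (λ j → ∏ (λ k → ∏ (g i j k)))))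

  ∏₄-^ : ∀ c f → ∏₄ (λ i j k l → c ^ f i j k l) ≡ c ^ sum₄ f
  ∏₄-^ c f = trans (Prod.sum-cong-≗ (λ i → trans (Prod.sum-cong-≗ (λ j → trans (Prod.sum-cong-≗ (λ k → ∏-^ c (f i j k)))
    (∏-^ c (λ k → sum (f i j k))))) (∏-^ c (λ j → sum (λ k → sum (f i j k))))))
    (∏-^ c (λ i → sum (λ j → sum (λ k → sum (f i j k)))))

  val-∏₄ : ∀ {p} → Prime p → ∀ f → (∀ i j k l → 0 < f i j k l) → val p (∏₄ f) ≡ sum₄ (λ i j k l → val p (f i j k l))
  val-∏₄ pr f h = trans (val-∏ pr (λ i → ∏ (λ j → ∏ (λ k → ∏ (f i j k)))) (λ i → ∏>0 (λ j → ∏>0 (λ k → ∏>0 (h i j k)))))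
    (sum-cong (λ i → trans (val-∏ pr (λ j → ∏ (λ k → ∏ (f i j k))) (λ j → ∏>0 (λ k → ∏>0 (h i j k))))
    (sum-cong (λ j → trans (val-∏ pr (λ k → ∏ (f i j k)) (λ k → ∏>0 (h i j k)))
    (sum-cong (λ k → val-∏ pr (f i j k) (h i j k)))))))

sum₄-swap : ∀ {m n o r} (f : Fin m → Fin n → Fin o → Fin r → ℕ) → sum₄ f ≡ sum₄ (λ k l i j → f i j k l)
sum₄-swap f = trans (sum-cong (λ i → trans (∑-comm (λ j k → sum (f i j k))) (sum-cong (λ k → ∑-comm (λ j l → f i j k l)))))
  (trans (∑-comm (λ i k → sum (λ l → sum (λ j → f i j k l)))) (sum-cong (λ k → ∑-comm (λ i l → sum (λ j → f i j k l)))))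

-- The products below run over all quadruples, and a degenerate one may have base 0; its exponent is
-- then 0, so positivity of the base is available only for a positive exponent.
^>0′ : ∀ {x} n → (0 < n → 0 < x) → 0 < x ^ n
^>0′ zero h = s≤s z≤n
^>0′ (suc n) h = ^>0 (suc n) (h (s≤s z≤n))

val-^′ : ∀ {p x} → Prime p → ∀ n → (0 < n → 0 < x) → val p (x ^ n) ≡ n * val p x
val-^′ pr zero h = val-1 pr
val-^′ pr (suc n) h = val-^ pr (h (s≤s z≤n)) (suc n)

-- Size against divisibility over all 4-cycles

module _ {K : ℕ} {q : ℕ} (prq : Prime q) (α β : Fin K → ℕ)
  (α-inj : Injective _≡_ _≡_ α) (β-inj : Injective _≡_ _≡_ β)
  (e z : Fin K → Fin K → ℕ) (e≤1 : ∀ i j → e i j ≤ 1) (z>0 : ∀ i j → 0 < z i j)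
  (zq : ∀ i j → 0 < e i j → z i j ^ q ≡ α i + β j)
  (scale : ∀ i i′ j j′ → 0 < e i j → 0 < e i′ j → 0 < e i j′ → 0 < e i′ j′ →
    4 * (dist (α i) (α i′) * dist (β j) (β j′)) ≤ (α i + β j) * (α i′ + β j′) ×
    4 * (dist (α i) (α i′) * dist (β j) (β j′)) ≤ (α i′ + β j) * (α i + β j′))
  (M : ℕ) (α-range : ∀ i i′ → dist (α i) (α i′) ≤ 2 ^ M) (β-range : ∀ j j′ → dist (β j) (β j′) ≤ 2 ^ M) where

  private
    D E : Fin K → Fin K → ℕ
    D i i′ = dist (α i) (α i′)
    E j j′ = dist (β j) (β j′)

    row col : Fin K → Fin K → Fin K → ℕ
    row i i′ j = e i j * e i′ j
    col j j′ i = e i j * e i j′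

    -- χ is the indicator of non-degenerate 4-cycles of the graph e, and h is |X - Y| for the
    -- products X, Y at opposite edges.
    χ h : Fin K → Fin K → Fin K → Fin K → ℕ
    χ i i′ j j′ = ≠ᵢ i i′ * ≠ᵢ j j′ * (row i i′ j * row i i′ j′)
    h i i′ j j′ = dist (z i′ j * z i j′) (z i j * z i′ j′)

    ≠ᵢ>0 : ∀ {i j : Fin K} → 0 < ≠ᵢ i j → i ≢ j
    ≠ᵢ>0 {i} {j} lt with i ≟F j
    ... | yes _ = ⊥-elim (<⇒≢ lt refl)
    ... | no ne = ne

    D>0 : ∀ {i i′} → i ≢ i′ → 0 < D i i′
    D>0 ne = dist>0 (λ eq → ne (α-inj eq))
    E>0 : ∀ {j j′} → j ≢ j′ → 0 < E j j′
    E>0 ne = dist>0 (λ eq → ne (β-inj eq))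

    row²≤ : ∀ {a b} → a ≤ 1 → b ≤ 1 → a * b * (a * b) ≤ a * b
    row²≤ z≤n b≤1 = z≤n
    row²≤ {b = b} (s≤s z≤n) z≤n = z≤n
    row²≤ (s≤s z≤n) (s≤s z≤n) = s≤s z≤n

    dist-row : ∀ i i′ j → 0 < row i i′ j → dist (z i j ^ q) (z i′ j ^ q) ≡ D i i′
    dist-row i i′ j lt = trans (cong₂ dist (zq i j (*>0⇒ˡ (e i j) lt)) (zq i′ j (*>0⇒ʳ (e i j) lt))) (dist-+ʳ (α i) (α i′) (β j))

    dist-col : ∀ j j′ i → 0 < col j j′ i → dist (z i j ^ q) (z i j′ ^ q) ≡ E j j′
    dist-col j j′ i lt = trans (cong₂ dist (zq i j (*>0⇒ˡ (e i j) lt)) (zq i j′ (*>0⇒ʳ (e i j) lt))) (dist-+ˡ (α i) (β j) (β j′))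

    record Quad (i i′ j j′ : Fin K) : Set where
      field
        i≢ : i ≢ i′
        j≢ : j ≢ j′
        e₁ : 0 < e i j
        e₂ : 0 < e i′ j
        e₃ : 0 < e i j′
        e₄ : 0 < e i′ j′

      Dq : 0 < D i i′
      Dq = D>0 i≢
      Eq : 0 < E j j′
      Eq = E>0 j≢
      dXY : dist ((z i′ j * z i j′) ^ q) ((z i j * z i′ j′) ^ q) ≡ D i i′ * E j j′
      dXY = trans (cong₂ dist
          (trans (^-distrib-* q (z i′ j) (z i j′)) (cong₂ _*_ (zq i′ j e₂) (zq i j′ e₃)))
          (trans (^-distrib-* q (z i j) (z i′ j′)) (cong₂ _*_ (zq i j e₁) (zq i′ j′ e₄))))
        (dist-cross (α i) (α i′) (β j) (β j′))
      h>0 : 0 < h i i′ j j′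
      h>0 = dist>0 λ eq → <-irrefl (trans (sym (trans (cong (λ t → dist (t ^ q) ((z i j * z i′ j′) ^ q)) eq) (dist-refl ((z i j * z i′ j′) ^ q)))) dXY) (*>0 Dq Eq)
      small : (2 * (q * h i i′ j j′)) ^ q ≤ D i i′ * E j j′
      small = closeRoots-dist q (prime⇒2≤ prq) (*>0 (z>0 i′ j) (z>0 i j′)) (*>0 (z>0 i j) (z>0 i′ j′)) dXY
        (subst (4 * (D i i′ * E j j′) ≤_) (sym (trans (^-distrib-* q (z i′ j) (z i j′)) (cong₂ _*_ (zq i′ j e₂) (zq i j′ e₃))))
          (proj₂ (scale i i′ j j′ e₁ e₂ e₃ e₄)))
        (subst (4 * (D i i′ * E j j′) ≤_) (sym (trans (^-distrib-* q (z i j) (z i′ j′)) (cong₂ _*_ (zq i j e₁) (zq i′ j′ e₄))))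
          (proj₁ (scale i i′ j j′ e₁ e₂ e₃ e₄)))
    open Quad

    quad : ∀ i i′ j j′ → 0 < χ i i′ j j′ → Quad i i′ j j′
    quad i i′ j j′ lt = record
      { i≢ = ≠ᵢ>0 (*>0⇒ˡ (≠ᵢ i i′) (*>0⇒ˡ (≠ᵢ i i′ * ≠ᵢ j j′) lt))
      ; j≢ = ≠ᵢ>0 (*>0⇒ʳ (≠ᵢ i i′) (*>0⇒ˡ (≠ᵢ i i′ * ≠ᵢ j j′) lt))
      ; e₁ = *>0⇒ˡ (e i j) r ; e₂ = *>0⇒ʳ (e i j) r ; e₃ = *>0⇒ˡ (e i j′) r′ ; e₄ = *>0⇒ʳ (e i j′) r′ }
      where
      rr = *>0⇒ʳ (≠ᵢ i i′ * ≠ᵢ j j′) lt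
      r = *>0⇒ˡ (row i i′ j) rr
      r′ = *>0⇒ʳ (row i i′ j) rr

    module _ {p : ℕ} (prp : Prime p) where
      eD eE g : Fin K → Fin K → Fin K → Fin K → ℕ
      eD i i′ j j′ = excess (val p (D i i′)) (q * val p (z i j)) (q * val p (z i j′))
      eE i i′ j j′ = excess (val p (E j j′)) (q * val p (z i j)) (q * val p (z i′ j))
      g i i′ j j′ = ind (agree? p (z i j) (z i′ j) (z i j′) (z i′ j′))

      pointwise : ∀ i i′ j j′ →
        χ i i′ j j′ * (val p (D i i′) + val p (E j j′)) + q * (χ i i′ j j′ * (g i i′ j j′ * eD i i′ j j′) + χ i i′ j j′ * (g i i′ j j′ * eE i i′ j j′))
        ≤ χ i i′ j j′ * (q * val p (q * h i i′ j j′)) + (χ i i′ j j′ * eD i i′ j j′ + χ i i′ j j′ * eE i i′ j j′)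
      pointwise i i′ j j′ with χ i i′ j j′ in eq
      ... | zero = ≤-reflexive (*-zeroʳ q)
      ... | c@(suc _) = subst₂ _≤_ (shuffle₁ c (val p (D i i′) + val p (E j j′)) q (g i i′ j j′) (eD i i′ j j′) (eE i i′ j j′))
          (shuffle₂ c (q * val p (q * h i i′ j j′)) (eD i i′ j j′) (eE i i′ j j′))
          (*-monoʳ-≤ c (quadVal prp prq (z>0 i j) (z>0 i′ j) (z>0 i j′) (z>0 i′ j′) (Dq Q) (Eq Q)
            (dist-row i i′ j (*>0 (e₁ Q) (e₂ Q))) (dist-row i i′ j′ (*>0 (e₃ Q) (e₄ Q)))
            (dist-col j j′ i (*>0 (e₁ Q) (e₃ Q))) (dist-col j j′ i′ (*>0 (e₂ Q) (e₄ Q))) (dXY Q) (h>0 Q)))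
        where
        Q = quad i i′ j j′ (subst (0 <_) (sym eq) (s≤s z≤n))
        shuffle₁ : ∀ c s q g a b → c * (s + q * (g * (a + b))) ≡ c * s + q * (c * (g * a) + c * (g * b))
        shuffle₁ = solve-∀
        shuffle₂ : ∀ c s a b → c * (s + (a + b)) ≡ c * s + (c * a + c * b)
        shuffle₂ = solve-∀

      rowBound : ∀ i i′ →
        sum (λ j → sum (λ j′ → χ i i′ j j′ * eD i i′ j j′)) ≤
        q * (sum (λ j → sum (λ j′ → χ i i′ j j′ * (g i i′ j j′ * eD i i′ j j′))) + sum (λ j → ≠ᵢ i i′ * row i i′ j * val p (D i i′)))
      rowBound i i′ with i ≟F i′
      ... | yes _ = ≤-trans (≤-reflexive (sum-0 {K} (λ j → sum {K} (λ j′ → 0)) (λ j → sum-0 {K} (λ _ → 0) (λ _ → refl)))) z≤n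
      ... | no ne = subst₂ _≤_
          (sum-cong (λ j → sum-cong (λ j′ → unit₁ (≠ᵢ j j′) (row i i′ j * row i i′ j′) (eD i i′ j j′))))
          (cong (q *_) (cong₂ _+_
            (sum-cong (λ j → sum-cong (λ j′ → unit₁ (≠ᵢ j j′) (row i i′ j * row i i′ j′) (g i i′ j j′ * eD i i′ j j′))))
            (sum-cong (λ j → cong (_* val p (D i i′)) (sym (*-identityˡ (row i i′ j)))))))
          (pairBound prp prq (z i) (z i′) (row i i′) (D i i′) (z>0 i) (z>0 i′) (D>0 ne) (λ j → row²≤ (e≤1 i j) (e≤1 i′ j)) (dist-row i i′))
        where
        unit₁ : ∀ m r x → m * r * x ≡ 1 * m * r * x
        unit₁ = solve-∀

      colBound : ∀ j j′ →
        sum (λ i → sum (λ i′ → χ i i′ j j′ * eE i i′ j j′)) ≤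
        q * (sum (λ i → sum (λ i′ → χ i i′ j j′ * (g i i′ j j′ * eE i i′ j j′))) + sum (λ i → ≠ᵢ j j′ * col j j′ i * val p (E j j′)))
      colBound j j′ with j ≟F j′
      ... | yes _ = ≤-trans (≤-reflexive (sum-0 {K} (λ i → sum {K} (λ i′ → ≠ᵢ i i′ * 0 * (row i i′ j * row i i′ j′) * eE i i′ j j′))
            (λ i → sum-0 {K} (λ i′ → ≠ᵢ i i′ * 0 * (row i i′ j * row i i′ j′) * eE i i′ j j′)
              (λ i′ → cong (λ t → t * (row i i′ j * row i i′ j′) * eE i i′ j j′) (*-zeroʳ (≠ᵢ i i′)))))) z≤n
      ... | no ne = subst₂ _≤_
          (sum-cong (λ i → sum-cong (λ i′ → unit₁ (≠ᵢ i i′) (e i j) (e i j′) (e i′ j) (e i′ j′) (eE i i′ j j′))))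
          (cong (q *_) (cong₂ _+_
            (sum-cong (λ i → sum-cong (λ i′ → trans (cong (λ t → ≠ᵢ i i′ * (col j j′ i * col j j′ i′) * (t * eE i i′ j j′)) (transpose i i′))
              (unit₁ (≠ᵢ i i′) (e i j) (e i j′) (e i′ j) (e i′ j′) (g i i′ j j′ * eE i i′ j j′)))))
            (sum-cong (λ i → cong (_* val p (E j j′)) (sym (*-identityˡ (col j j′ i)))))))
          (pairBound prp prq (λ i → z i j) (λ i → z i j′) (col j j′) (E j j′) (λ i → z>0 i j) (λ i → z>0 i j′) (E>0 ne)
            (λ i → row²≤ (e≤1 i j) (e≤1 i j′)) (dist-col j j′))
        where
        unit₁ : ∀ n a b c d x → n * ((a * b) * (c * d)) * x ≡ n * 1 * ((a * c) * (b * d)) * x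
        unit₁ = solve-∀
        -- Agreement is symmetric under exchanging rows and columns, so one indicator serves both
        -- `rowBound` and `colBound`.
        transpose : ∀ i i′ → ind (agree? p (z i j) (z i j′) (z i′ j) (z i′ j′)) ≡ g i i′ j j′
        transpose i i′ = cong (λ t → ind (pstar p ∣? dist t (unitPart p (z i j) * unitPart p (z i′ j′)))) (*-comm (unitPart p (z i j′)) (unitPart p (z i′ j)))

      -- The diagonal terms of `pairBound`, indexed by paths of length two. The one-point last index
      -- lets these triple sums use the lemmas on fourfold sums.
      errRow errCol : Fin K → Fin K → Fin K → Fin 1 → ℕ
      errRow i i′ j _ = q * (≠ᵢ i i′ * row i i′ j) * val p (D i i′)
      errCol j j′ i _ = q * (≠ᵢ j j′ * col j j′ i) * val p (E j j′)

      sumErr : ∀ (w : Fin K → Fin K → Fin K → ℕ) (v : Fin K → Fin K → ℕ) →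
        sum (λ i → sum (λ i′ → q * sum (λ j → w i i′ j * v i i′))) ≡ sum₄ {o = K} {r = 1} (λ i i′ j _ → q * w i i′ j * v i i′)
      sumErr w v = sum-cong (λ i → sum-cong (λ i′ → trans (*-distribˡ-sum q (λ j → w i i′ j * v i i′))
        (sum-cong (λ j → trans (sym (*-assoc q (w i i′ j) (v i i′))) (sym (+-identityʳ _))))))

      outerBound : (P Q : Fin K → Fin K → Fin K → Fin K → ℕ) (R : Fin K → Fin K → Fin K → Fin 1 → ℕ) (T : Fin K → Fin K → Fin K → ℕ) →
        (∀ i i′ → sum (λ j → sum (P i i′ j)) ≤ q * (sum (λ j → sum (Q i i′ j)) + sum (T i i′))) →
        sum (λ i → sum (λ i′ → q * sum (T i i′))) ≡ sum₄ R → sum₄ P ≤ q * sum₄ Q + sum₄ R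
      outerBound P Q R T bound eq = begin
        sum₄ P ≤⟨ sum-mono (λ i → sum-mono (λ i′ → bound i i′)) ⟩
        sum (λ i → sum (λ i′ → q * (sum (λ j → sum (Q i i′ j)) + sum (T i i′))))
          ≡⟨ sum-cong (λ i → trans (sum-cong (λ i′ → *-distribˡ-+ q (sum (λ j → sum (Q i i′ j))) (sum (T i i′))))
               (∑-distrib-+ (λ i′ → q * sum (λ j → sum (Q i i′ j))) (λ i′ → q * sum (T i i′)))) ⟩
        sum (λ i → sum (λ i′ → q * sum (λ j → sum (Q i i′ j))) + sum (λ i′ → q * sum (T i i′)))
          ≡⟨ ∑-distrib-+ (λ i → sum (λ i′ → q * sum (λ j → sum (Q i i′ j)))) (λ i → sum (λ i′ → q * sum (T i i′))) ⟩
        sum (λ i → sum (λ i′ → q * sum (λ j → sum (Q i i′ j)))) + sum (λ i → sum (λ i′ → q * sum (T i i′)))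
          ≡⟨ cong₂ _+_ (sym (trans (*-distribˡ-sum q (λ i → sum (λ i′ → sum (λ j → sum (Q i i′ j)))))
               (sum-cong (λ i → *-distribˡ-sum q (λ i′ → sum (λ j → sum (Q i i′ j))))))) eq ⟩
        q * sum₄ Q + sum₄ R ∎
        where open ≤-Reasoning

      -- Sum `quadVal` over all 4-cycles. By the row and column averages, the excesses on its right
      -- are at most q times the agreeing excesses, which stand on its left and cancel; only the
      -- diagonal errors remain.
      valBound : sum₄ (λ i i′ j j′ → χ i i′ j j′ * (val p (D i i′) + val p (E j j′))) ≤
        sum₄ (λ i i′ j j′ → χ i i′ j j′ * (q * val p (q * h i i′ j j′))) + (sum₄ errRow + sum₄ errCol)
      valBound = +-cancelʳ-≤ (q * GD + q * GE) _ _ (begin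
        sum₄ A + (q * GD + q * GE) ≡⟨ cong (sum₄ A +_) (sym (*-distribˡ-+ q GD GE)) ⟩
        sum₄ A + q * (GD + GE)
          ≡⟨ cong (sum₄ A +_) (sym (trans (sum₄-*ˡ q (λ i i′ j j′ → gD i i′ j j′ + gE i i′ j j′)) (cong (q *_) (sum₄-+ gD gE)))) ⟩
        sum₄ A + sum₄ (λ i i′ j j′ → q * (gD i i′ j j′ + gE i i′ j j′))
          ≡⟨ sym (sum₄-+ A (λ i i′ j j′ → q * (gD i i′ j j′ + gE i i′ j j′))) ⟩
        sum₄ (λ i i′ j j′ → A i i′ j j′ + q * (gD i i′ j j′ + gE i i′ j j′)) ≤⟨ sum₄-mono pointwise ⟩
        sum₄ (λ i i′ j j′ → B i i′ j j′ + (cD i i′ j j′ + cE i i′ j j′))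
          ≡⟨ trans (sum₄-+ B (λ i i′ j j′ → cD i i′ j j′ + cE i i′ j j′)) (cong (sum₄ B +_) (sum₄-+ cD cE)) ⟩
        sum₄ B + (sum₄ cD + sum₄ cE) ≤⟨ +-monoʳ-≤ (sum₄ B) (+-mono-≤ rows cols) ⟩
        sum₄ B + ((q * GD + sum₄ errRow) + (q * GE + sum₄ errCol)) ≡⟨ rearrange (sum₄ B) (q * GD) (sum₄ errRow) (q * GE) (sum₄ errCol) ⟩
        sum₄ B + (sum₄ errRow + sum₄ errCol) + (q * GD + q * GE) ∎)
        where
        open ≤-Reasoning
        A B cD cE gD gE : Fin K → Fin K → Fin K → Fin K → ℕ
        A i i′ j j′ = χ i i′ j j′ * (val p (D i i′) + val p (E j j′))
        B i i′ j j′ = χ i i′ j j′ * (q * val p (q * h i i′ j j′))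
        cD i i′ j j′ = χ i i′ j j′ * eD i i′ j j′
        cE i i′ j j′ = χ i i′ j j′ * eE i i′ j j′
        gD i i′ j j′ = χ i i′ j j′ * (g i i′ j j′ * eD i i′ j j′)
        gE i i′ j j′ = χ i i′ j j′ * (g i i′ j j′ * eE i i′ j j′)
        GD = sum₄ gD
        GE = sum₄ gE
        rearrange : ∀ b x r y c → b + ((x + r) + (y + c)) ≡ b + (r + c) + (x + y)
        rearrange = solve-∀
        rows : sum₄ cD ≤ q * GD + sum₄ errRow
        rows = outerBound cD gD errRow (λ i i′ j → ≠ᵢ i i′ * row i i′ j * val p (D i i′)) rowBound
          (sumErr (λ i i′ j → ≠ᵢ i i′ * row i i′ j) (λ i i′ → val p (D i i′)))
        cols : sum₄ cE ≤ q * GE + sum₄ errCol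
        cols = subst₂ (λ s t → s ≤ q * t + sum₄ errCol) (sym (sum₄-swap cE)) (sym (sum₄-swap gE))
          (outerBound (λ j j′ i i′ → cE i i′ j j′) (λ j j′ i i′ → gE i i′ j j′) errCol
            (λ j j′ i → ≠ᵢ j j′ * col j j′ i * val p (E j j′)) colBound
            (sumErr (λ j j′ i → ≠ᵢ j j′ * col j j′ i) (λ j j′ → val p (E j j′))))

    G H : ℕ
    G = ∏₄ (λ i i′ j j′ → (D i i′ * E j j′) ^ χ i i′ j j′)
    H = ∏₄ (λ i i′ j j′ → ((q * h i i′ j j′) ^ q) ^ χ i i′ j j′)
    errD errE : Fin K → Fin K → Fin K → Fin 1 → ℕ
    errD i i′ j _ = D i i′ ^ (q * (≠ᵢ i i′ * row i i′ j))
    errE j j′ i _ = E j j′ ^ (q * (≠ᵢ j j′ * col j j′ i))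

    0<q = prime⇒0< prq

    G-pos : ∀ i i′ j j′ → 0 < χ i i′ j j′ → 0 < D i i′ * E j j′
    G-pos i i′ j j′ lt = *>0 (Dq Q) (Eq Q) where Q = quad i i′ j j′ lt
    qh-pos : ∀ i i′ j j′ → 0 < χ i i′ j j′ → 0 < q * h i i′ j j′
    qh-pos i i′ j j′ lt = *>0 0<q (h>0 (quad i i′ j j′ lt))
    D-pos : ∀ i i′ j → 0 < q * (≠ᵢ i i′ * row i i′ j) → 0 < D i i′
    D-pos i i′ j lt = D>0 (≠ᵢ>0 (*>0⇒ˡ (≠ᵢ i i′) (*>0⇒ʳ q lt)))
    E-pos : ∀ j j′ i → 0 < q * (≠ᵢ j j′ * col j j′ i) → 0 < E j j′
    E-pos j j′ i lt = E>0 (≠ᵢ>0 (*>0⇒ˡ (≠ᵢ j j′) (*>0⇒ʳ q lt)))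

    G>0 : 0 < G
    G>0 = ∏₄>0 (λ i i′ j j′ → ^>0′ (χ i i′ j j′) (G-pos i i′ j j′))
    H-factor>0 : ∀ i i′ j j′ → 0 < ((q * h i i′ j j′) ^ q) ^ χ i i′ j j′
    H-factor>0 i i′ j j′ = ^>0′ (χ i i′ j j′) (λ lt → ^>0 q (qh-pos i i′ j j′ lt))
    H>0 : 0 < H
    H>0 = ∏₄>0 H-factor>0
    errD>0 : 0 < ∏₄ errD
    errD>0 = ∏₄>0 {m = K} {n = K} {o = K} {r = 1} (λ i i′ j _ → ^>0′ (q * (≠ᵢ i i′ * row i i′ j)) (D-pos i i′ j))
    errE>0 : 0 < ∏₄ errE
    errE>0 = ∏₄>0 {m = K} {n = K} {o = K} {r = 1} (λ j j′ i _ → ^>0′ (q * (≠ᵢ j j′ * col j j′ i)) (E-pos j j′ i))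

    G∣ : G ∣ H * (∏₄ errD * ∏₄ errE)
    G∣ = val-≤⇒∣ G _ G>0 (*>0 H>0 (*>0 errD>0 errE>0)) λ p prp → subst₂ _≤_
      (sym (trans (val-∏₄ prp _ (λ i i′ j j′ → ^>0′ (χ i i′ j j′) (G-pos i i′ j j′))) (sum₄-cong (Gval prp))))
      (sym (trans (val-* prp H>0 (*>0 errD>0 errE>0)) (cong₂ _+_
        (trans (val-∏₄ prp _ H-factor>0) (sum₄-cong (Hval prp)))
        (trans (val-* prp errD>0 errE>0) (cong₂ _+_
          (trans (val-∏₄ {m = K} {n = K} {o = K} {r = 1} prp errD (λ i i′ j _ → ^>0′ (q * (≠ᵢ i i′ * row i i′ j)) (D-pos i i′ j)))
            (sum₄-cong {m = K} {n = K} {o = K} {r = 1} (λ i i′ j _ → val-^′ prp (q * (≠ᵢ i i′ * row i i′ j)) (D-pos i i′ j))))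
          (trans (val-∏₄ {m = K} {n = K} {o = K} {r = 1} prp errE (λ j j′ i _ → ^>0′ (q * (≠ᵢ j j′ * col j j′ i)) (E-pos j j′ i)))
            (sum₄-cong {m = K} {n = K} {o = K} {r = 1} (λ j j′ i _ → val-^′ prp (q * (≠ᵢ j j′ * col j j′ i)) (E-pos j j′ i)))))))))
      (valBound prp)
      where
      Gval : ∀ {p} → Prime p → ∀ i i′ j j′ → val p ((D i i′ * E j j′) ^ χ i i′ j j′) ≡ χ i i′ j j′ * (val p (D i i′) + val p (E j j′))
      Gval {p} prp i i′ j j′ = trans (val-^′ prp (χ i i′ j j′) (G-pos i i′ j j′)) (times (χ i i′ j j′) (λ lt → let Q = quad i i′ j j′ lt in val-* prp (Dq Q) (Eq Q)))
        where
        times : ∀ c {x y} → (0 < c → x ≡ y) → c * x ≡ c * y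
        times zero f = refl
        times c@(suc _) f = cong (c *_) (f (s≤s z≤n))
      Hval : ∀ {p} → Prime p → ∀ i i′ j j′ → val p (((q * h i i′ j j′) ^ q) ^ χ i i′ j j′) ≡ χ i i′ j j′ * (q * val p (q * h i i′ j j′))
      Hval {p} prp i i′ j j′ = trans (val-^′ prp (χ i i′ j j′) (λ lt → ^>0 q (qh-pos i i′ j j′ lt)))
          (times (χ i i′ j j′) (λ lt → val-^ prp (qh-pos i i′ j j′ lt) q))
        where
        times : ∀ c {x y} → (0 < c → x ≡ y) → c * x ≡ c * y
        times zero f = refl
        times c@(suc _) f = cong (c *_) (f (s≤s z≤n))

    X C₁ C₂ : ℕ
    X = sum₄ χ
    C₁ = sum₄ {o = K} {r = 1} (λ i i′ j _ → ≠ᵢ i i′ * row i i′ j)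
    C₂ = sum₄ {o = K} {r = 1} (λ j j′ i _ → ≠ᵢ j j′ * col j j′ i)

    -- The factor 2 inside `closeRoots` is the surplus that drives the argument: every 4-cycle
    -- contributes an extra 2^q.
    2^X*H≤G : (2 ^ q) ^ X * H ≤ G
    2^X*H≤G = begin
      (2 ^ q) ^ X * H ≡⟨ cong (_* H) (sym (∏₄-^ (2 ^ q) χ)) ⟩
      ∏₄ (λ i i′ j j′ → (2 ^ q) ^ χ i i′ j j′) * H ≡⟨ sym (∏₄-* (λ i i′ j j′ → (2 ^ q) ^ χ i i′ j j′) _) ⟩
      ∏₄ (λ i i′ j j′ → (2 ^ q) ^ χ i i′ j j′ * ((q * h i i′ j j′) ^ q) ^ χ i i′ j j′) ≤⟨ ∏₄-mono factor ⟩
      G ∎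
      where
      open ≤-Reasoning
      pow : ∀ c {x y w} → (0 < c → x * y ≤ w) → x ^ c * y ^ c ≤ w ^ c
      pow zero f = ≤-refl
      pow c@(suc _) {x} {y} f = ≤-trans (≤-reflexive (sym (^-distrib-* c x y))) (^-monoˡ-≤ c (f (s≤s z≤n)))
      factor : ∀ i i′ j j′ → (2 ^ q) ^ χ i i′ j j′ * ((q * h i i′ j j′) ^ q) ^ χ i i′ j j′ ≤ (D i i′ * E j j′) ^ χ i i′ j j′
      factor i i′ j j′ = pow (χ i i′ j j′) (λ lt → ≤-trans (≤-reflexive (sym (^-distrib-* q 2 (q * h i i′ j j′)))) (small (quad i i′ j j′ lt)))

    err≤ : ∏₄ errD * ∏₄ errE ≤ 2 ^ (q * (M * (C₁ + C₂)))
    err≤ = begin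
      ∏₄ errD * ∏₄ errE
        ≤⟨ *-mono-≤ (∏₄-mono {m = K} {n = K} {o = K} {r = 1} (λ i i′ j _ → ^-monoˡ-≤ (q * (≠ᵢ i i′ * row i i′ j)) (α-range i i′)))
             (∏₄-mono {m = K} {n = K} {o = K} {r = 1} (λ j j′ i _ → ^-monoˡ-≤ (q * (≠ᵢ j j′ * col j j′ i)) (β-range j j′))) ⟩
      ∏₄ {o = K} {r = 1} (λ i i′ j _ → (2 ^ M) ^ (q * (≠ᵢ i i′ * row i i′ j))) * ∏₄ {o = K} {r = 1} (λ j j′ i _ → (2 ^ M) ^ (q * (≠ᵢ j j′ * col j j′ i)))
        ≡⟨ cong₂ _*_ (total (λ i i′ j → ≠ᵢ i i′ * row i i′ j)) (total (λ j j′ i → ≠ᵢ j j′ * col j j′ i)) ⟩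
      2 ^ (q * (M * C₁)) * 2 ^ (q * (M * C₂))
        ≡⟨ trans (sym (^-distribˡ-+-* 2 (q * (M * C₁)) (q * (M * C₂)))) (cong (2 ^_) (combine′ q M C₁ C₂)) ⟩
      2 ^ (q * (M * (C₁ + C₂))) ∎
      where
      open ≤-Reasoning
      combine′ : ∀ q m a b → q * (m * a) + q * (m * b) ≡ q * (m * (a + b))
      combine′ = solve-∀
      shuffle : ∀ m q c → m * (q * c) ≡ q * (m * c)
      shuffle = solve-∀
      total : ∀ w → ∏₄ {o = K} {r = 1} (λ i i′ j _ → (2 ^ M) ^ (q * w i i′ j)) ≡ 2 ^ (q * (M * sum₄ {o = K} {r = 1} (λ i i′ j _ → w i i′ j)))
      total w = trans (∏₄-^ {m = K} {n = K} {o = K} {r = 1} (2 ^ M) (λ i i′ j _ → q * w i i′ j)) (trans (^-*-assoc 2 M (sum₄ {m = K} {n = K} {o = K} {r = 1} (λ i i′ j _ → q * w i i′ j))) (cong (2 ^_)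
        (trans (cong (M *_) (sum₄-*ˡ {m = K} {n = K} {o = K} {r = 1} q (λ i i′ j _ → w i i′ j))) (shuffle M q _))))

  -- G divides H times the errors, yet exceeds H by 2^(q X). So 2^(q X) is at most the errors, whose
  -- exponents carry the q of `pairBound`; comparing exponents of 2, this q cancels.
  quads≤cherries : sum₄ (λ i i′ j j′ → ≠ᵢ i i′ * ≠ᵢ j j′ * (e i j * e i′ j * (e i j′ * e i′ j′))) ≤
    M * (sum₄ {o = K} {r = 1} (λ i i′ j _ → ≠ᵢ i i′ * (e i j * e i′ j)) + sum₄ {o = K} {r = 1} (λ j j′ i _ → ≠ᵢ j j′ * (e i j * e i j′)))
  quads≤cherries = *-cancelˡ-≤ q {{prime⇒nonZero prq}} (≮⇒≥ λ lt → <⇒≱ (^-monoʳ-< 2 ≤-refl lt)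
    (*-cancelʳ-≤ (2 ^ (q * X)) (2 ^ (q * (M * (C₁ + C₂)))) H {{>-nonZero H>0}} (begin
      2 ^ (q * X) * H ≡⟨ cong (_* H) (sym (^-*-assoc 2 q X)) ⟩
      (2 ^ q) ^ X * H ≤⟨ 2^X*H≤G ⟩
      G ≤⟨ ∣⇒≤′ (*>0 H>0 (*>0 errD>0 errE>0)) G∣ ⟩
      H * (∏₄ errD * ∏₄ errE) ≤⟨ *-monoʳ-≤ H err≤ ⟩
      H * 2 ^ (q * (M * (C₁ + C₂))) ≡⟨ *-comm H _ ⟩
      2 ^ (q * (M * (C₁ + C₂))) * H ∎)))
    where open ≤-Reasoning

-- Counting 4-cycles

2^⌊log₂⌋≤ : ∀ x → 0 < x → 2 ^ ⌊log₂ x ⌋ ≤ x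
2^⌊log₂⌋≤ = <-rec _ go
  where
  go : ∀ x → (∀ {y} → y < x → 0 < y → 2 ^ ⌊log₂ y ⌋ ≤ y) → 0 < x → 2 ^ ⌊log₂ x ⌋ ≤ x
  go (suc zero) rec _ = ≤-refl
  go x@(suc (suc x′)) rec _ = begin
    2 ^ ⌊log₂ x ⌋ ≡⟨ cong (2 ^_) (sym (trans (cong suc (⌊log₂⌊n/2⌋⌋≡⌊log₂n⌋∸1 x)) (m+[n∸m]≡n (⌊log₂⌋-mono-≤ {2} {x} (s≤s (s≤s z≤n)))))) ⟩
    2 * 2 ^ ⌊log₂ ⌊ x /2⌋ ⌋ ≤⟨ *-monoʳ-≤ 2 (rec (⌊n/2⌋<n (suc x′)) (s≤s z≤n)) ⟩
    2 * ⌊ x /2⌋ ≡⟨ cong (⌊ x /2⌋ +_) (+-identityʳ ⌊ x /2⌋) ⟩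
    ⌊ x /2⌋ + ⌊ x /2⌋ ≤⟨ +-monoʳ-≤ ⌊ x /2⌋ (⌊n/2⌋≤⌈n/2⌉ x) ⟩
    ⌊ x /2⌋ + ⌈ x /2⌉ ≡⟨ ⌊n/2⌋+⌈n/2⌉≡n x ⟩
    x ∎
    where open ≤-Reasoning

2^k≤⇒k≤⌊log₂⌋ : ∀ {k x} → 2 ^ k ≤ x → k ≤ ⌊log₂ x ⌋
2^k≤⇒k≤⌊log₂⌋ {k} le = subst (_≤ _) (⌊log₂[2^n]⌋≡n k) (⌊log₂⌋-mono-≤ le)

<2^suc⌊log₂⌋ : ∀ x → x < 2 ^ suc ⌊log₂ x ⌋
<2^suc⌊log₂⌋ x = ≰⇒> λ le → <-irrefl refl (2^k≤⇒k≤⌊log₂⌋ {suc ⌊log₂ x ⌋} le)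

⌊log₂⌋< : ∀ {x M} → 0 < x → x < 2 ^ M → ⌊log₂ x ⌋ < M
⌊log₂⌋< {x} {M} 0<x lt = ≰⇒> λ le → <⇒≱ lt (≤-trans (^-monoʳ-≤ 2 le) (2^⌊log₂⌋≤ x 0<x))

-- Passing from the exponent to a prime divisor moves the rest into the base. The new base is at
-- least 2 because s is, which bounds the exponent by M.
primeRoot : ∀ {s M} → PurePower s → 2 ≤ s → s < 2 ^ M → ∃₂ λ z q → Prime q × q < M × 0 < z × z ^ q ≡ s
primeRoot {s} {M} (b , n , 2≤n , refl) 2≤s lt with ∃primeDivisor n 2≤n
... | q , prq , divides k refl = b ^ k , q , prq , q<M , <-trans (s≤s z≤n) 2≤z , zq≡
  where
  zq≡ : (b ^ k) ^ q ≡ b ^ (k * q)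
  zq≡ = ^-*-assoc b k q
  2≤z : 2 ≤ b ^ k
  2≤z with b ^ k in eq
  ... | zero = ⊥-elim (<⇒≢ (<-trans (s≤s z≤n) 2≤s) (trans (sym (zero^ q (prime⇒0< prq))) (trans (cong (_^ q) (sym eq)) zq≡)))
    where
    zero^ : ∀ q → 0 < q → 0 ^ q ≡ 0
    zero^ (suc q) _ = refl
  ... | suc zero = ⊥-elim (<⇒≢ 2≤s (trans (sym (^-zeroˡ q)) (trans (cong (_^ q) (sym eq)) zq≡)))
  ... | suc (suc _) = s≤s (s≤s z≤n)
  q<M : q < M
  q<M = ≰⇒> λ M≤q → <⇒≱ lt (≤-trans (^-monoʳ-≤ 2 M≤q) (≤-trans (^-monoˡ-≤ q 2≤z) (≤-reflexive zq≡)))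

argmax : ∀ {m} (f : Fin (suc m) → ℕ) → ∃ λ c → ∀ i → f i ≤ f c
argmax {zero} f = fzero , λ { fzero → ≤-refl }
argmax {suc m} f with argmax (f ∘ fsuc)
... | c , h with ≤-total (f fzero) (f (fsuc c))
... | inj₁ le = fsuc c , λ { fzero → le ; (fsuc i) → h i }
... | inj₂ ge = fzero , λ { fzero → ≤-refl ; (fsuc i) → ≤-trans (h i) ge }

sum≤max : ∀ {m} (f : Fin m → ℕ) → Fin m → ∃ λ c → sum f ≤ m * f c
sum≤max {suc m} f _ with argmax f
... | c , h = c , ≤-trans (sum-mono h) (≤-reflexive (sum-const (suc m) (f c)))

∃pos : ∀ {n} (f : Fin n → ℕ) → 0 < sum f → ∃ λ i → 0 < f i
∃pos {suc n} f lt with f fzero in eq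
... | suc _ = fzero , subst (0 <_) (sym eq) (s≤s z≤n)
... | zero with ∃pos (f ∘ fsuc) lt
... | i , h = fsuc i , h

sum₂²≤ : ∀ {m n} (f : Fin m → Fin n → ℕ) →
  sum (λ i → sum (f i)) * sum (λ i → sum (f i)) ≤ m * n * sum (λ i → sum (λ j → f i j * f i j))
sum₂²≤ {m} {n} f = begin
  sum (λ i → sum (f i)) * sum (λ i → sum (f i)) ≤⟨ sum²≤n*sum² (λ i → sum (f i)) ⟩
  m * sum (λ i → sum (f i) * sum (f i)) ≤⟨ *-monoʳ-≤ m (sum-mono (λ i → sum²≤n*sum² (f i))) ⟩
  m * sum (λ i → n * sum (λ j → f i j * f i j)) ≡⟨ cong (m *_) (sym (*-distribˡ-sum n (λ i → sum (λ j → f i j * f i j)))) ⟩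
  m * (n * sum (λ i → sum (λ j → f i j * f i j))) ≡⟨ sym (*-assoc m n _) ⟩
  m * n * sum (λ i → sum (λ j → f i j * f i j)) ∎
  where open ≤-Reasoning

-- A dense bipartite graph has many 4-cycles; if non-degenerate ones are few compared to cherries, it is small.
module _ {K : ℕ} (e : Fin K → Fin K → ℕ) (e≤1 : ∀ i j → e i j ≤ 1) (M : ℕ)
  (bound : sum₄ (λ i i′ j j′ → ≠ᵢ i i′ * ≠ᵢ j j′ * (e i j * e i′ j * (e i j′ * e i′ j′))) ≤
    M * (sum₄ {o = K} {r = 1} (λ i i′ j _ → ≠ᵢ i i′ * (e i j * e i′ j)) + sum₄ {o = K} {r = 1} (λ j j′ i _ → ≠ᵢ j j′ * (e i j * e i j′)))) where

  private
    Vr Vc hom X V edges : ℕ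
    Vr = sum (λ i → sum (λ i′ → sum (λ j → e i j * e i′ j)))
    Vc = sum (λ j → sum (λ j′ → sum (λ i → e i j * e i j′)))
    hom = sum₄ (λ i i′ j j′ → e i j * e i′ j * (e i j′ * e i′ j′))
    X = sum₄ (λ i i′ j j′ → ≠ᵢ i i′ * ≠ᵢ j j′ * (e i j * e i′ j * (e i j′ * e i′ j′)))
    V = Vr + Vc
    edges = sum (λ i → sum (e i))

    ≠* : ∀ {n} (i i′ : Fin n) x → ≠ᵢ i i′ * x ≤ x
    ≠* i i′ x = ≤-trans (*-monoˡ-≤ x (ind≤1 (¬? (i ≟F i′)))) (≤-reflexive (*-identityˡ x))

    drop₁ : (w : Fin K → Fin K → Fin K → ℕ) → sum₄ {o = K} {r = 1} (λ i i′ j _ → ≠ᵢ i i′ * w i i′ j) ≤ sum (λ i → sum (λ i′ → sum (w i i′)))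
    drop₁ w = sum-mono (λ i → sum-mono (λ i′ → sum-mono (λ j → ≤-trans (≤-reflexive (+-identityʳ _)) (≠* i i′ (w i i′ j)))))

    X≤ : X ≤ M * V
    X≤ = ≤-trans bound (*-monoʳ-≤ M (+-mono-≤ (drop₁ (λ i i′ j → e i j * e i′ j)) (drop₁ (λ j j′ i → e i j * e i j′))))

    idem : ∀ {a b} → a ≤ 1 → b ≤ 1 → a * b * (a * b) ≤ a * b
    idem z≤n _ = z≤n
    idem (s≤s z≤n) z≤n = z≤n
    idem (s≤s z≤n) (s≤s z≤n) = ≤-refl

    F : Fin K → Fin K → Fin K → Fin K → ℕ
    F i i′ j j′ = e i j * e i′ j * (e i j′ * e i′ j′)

    -- A 4-cycle with i = i′ or j = j′ collapses to a path of length two, counted by Vc or Vr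
    -- respectively.
    hom≤ : hom ≤ X + V
    hom≤ = begin
      hom ≤⟨ sum₂≤offDiag+diag (λ i i′ → sum (λ j → sum (F i i′ j))) ⟩
      sum (λ i → sum (λ i′ → ≠ᵢ i i′ * sum (λ j → sum (F i i′ j)))) + sum (λ i → sum (λ j → sum (F i i j)))
        ≤⟨ +-mono-≤ (sum-mono (λ i → sum-mono (λ i′ → off i i′))) (sum-mono (λ i → sum-mono (λ j → sum-mono (λ j′ → dropSquares i j j′)))) ⟩
      sum (λ i → sum (λ i′ → sum (λ j → sum (λ j′ → ≠ᵢ i i′ * ≠ᵢ j j′ * F i i′ j j′)) + sum (λ j → e i j * e i′ j)))
        + sum (λ i → sum (λ j → sum (λ j′ → e i j * e i j′)))
        ≡⟨ cong₂ _+_ (trans (sum-cong (λ i → ∑-distrib-+ (λ i′ → sum (λ j → sum (λ j′ → ≠ᵢ i i′ * ≠ᵢ j j′ * F i i′ j j′))) (λ i′ → sum (λ j → e i j * e i′ j))))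
             (∑-distrib-+ (λ i → sum (λ i′ → sum (λ j → sum (λ j′ → ≠ᵢ i i′ * ≠ᵢ j j′ * F i i′ j j′)))) (λ i → sum (λ i′ → sum (λ j → e i j * e i′ j)))))
             (trans (∑-comm (λ i j → sum (λ j′ → e i j * e i j′))) (sum-cong (λ j → ∑-comm (λ i j′ → e i j * e i j′)))) ⟩
      X + Vr + Vc ≡⟨ +-assoc X Vr Vc ⟩
      X + V ∎
      where
      open ≤-Reasoning
      shuffle : ∀ a b c → a * (b * c) ≡ a * b * c
      shuffle a b c = sym (*-assoc a b c)
      dropSquares : ∀ i j j′ → F i i j j′ ≤ e i j * e i j′
      dropSquares i j j′ = *-mono-≤ (sq (e≤1 i j)) (sq (e≤1 i j′))
        where
        sq : ∀ {a} → a ≤ 1 → a * a ≤ a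
        sq z≤n = z≤n
        sq (s≤s z≤n) = ≤-refl
      off : ∀ i i′ → ≠ᵢ i i′ * sum (λ j → sum (F i i′ j)) ≤
        sum (λ j → sum (λ j′ → ≠ᵢ i i′ * ≠ᵢ j j′ * F i i′ j j′)) + sum (λ j → e i j * e i′ j)
      off i i′ = begin
        ≠ᵢ i i′ * sum (λ j → sum (F i i′ j)) ≤⟨ *-monoʳ-≤ (≠ᵢ i i′) (sum₂≤offDiag+diag (F i i′)) ⟩
        ≠ᵢ i i′ * (sum (λ j → sum (λ j′ → ≠ᵢ j j′ * F i i′ j j′)) + sum (λ j → F i i′ j j)) ≡⟨ *-distribˡ-+ (≠ᵢ i i′) _ _ ⟩
        ≠ᵢ i i′ * sum (λ j → sum (λ j′ → ≠ᵢ j j′ * F i i′ j j′)) + ≠ᵢ i i′ * sum (λ j → F i i′ j j)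
          ≤⟨ +-mono-≤ (≤-reflexive (trans (*-distribˡ-sum (≠ᵢ i i′) (λ j → sum (λ j′ → ≠ᵢ j j′ * F i i′ j j′)))
                (sum-cong (λ j → trans (*-distribˡ-sum (≠ᵢ i i′) (λ j′ → ≠ᵢ j j′ * F i i′ j j′)) (sum-cong (λ j′ → shuffle (≠ᵢ i i′) (≠ᵢ j j′) (F i i′ j j′)))))))
              (≤-trans (≠* i i′ _) (sum-mono (λ j → idem (e≤1 i j) (e≤1 i′ j)))) ⟩
        sum (λ j → sum (λ j′ → ≠ᵢ i i′ * ≠ᵢ j j′ * F i i′ j j′)) + sum (λ j → e i j * e i′ j) ∎

    Vr²≤ : Vr * Vr ≤ K * K * hom
    Vr²≤ = ≤-trans (sum₂²≤ (λ i i′ → sum (λ j → e i j * e i′ j)))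
      (≤-reflexive (cong (K * K *_) (sum-cong (λ i → sum-cong (λ i′ → sum*sum (λ j → e i j * e i′ j) (λ j → e i j * e i′ j))))))

    Vc²≤ : Vc * Vc ≤ K * K * hom
    Vc²≤ = ≤-trans (sum₂²≤ (λ j j′ → sum (λ i → e i j * e i j′))) (≤-reflexive (cong (K * K *_)
      (trans (sum-cong (λ j → sum-cong (λ j′ → trans (sum*sum (λ i → e i j * e i j′) (λ i → e i j * e i j′))
        (sum-cong (λ i → sum-cong (λ i′ → shuffle (e i j) (e i j′) (e i′ j) (e i′ j′)))))))
        (sym (sum₄-swap (λ i i′ j j′ → e i j * e i′ j * (e i j′ * e i′ j′)))))))
      where
      shuffle : ∀ a b c d → a * b * (c * d) ≡ a * c * (b * d)
      shuffle = solve-∀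

    edges²≤Vr : edges * edges ≤ K * Vr
    edges²≤Vr = subst₂ _≤_ (cong₂ _*_ (sym (∑-comm e)) (sym (∑-comm e))) (cong (K *_) expand) (sum²≤n*sum² (λ j → sum (λ i → e i j)))
      where
      expand : sum (λ j → sum (λ i → e i j) * sum (λ i → e i j)) ≡ Vr
      expand = trans (sum-cong (λ j → sum*sum (λ i → e i j) (λ i → e i j)))
        (trans (∑-comm (λ j i → sum (λ i′ → e i j * e i′ j))) (sum-cong (λ i → ∑-comm (λ j i′ → e i j * e i′ j))))

    edges²≤Vc : edges * edges ≤ K * Vc
    edges²≤Vc = subst (edges * edges ≤_) (cong (K *_) expand) (sum²≤n*sum² (λ i → sum (e i)))
      where
      expand : sum (λ i → sum (e i) * sum (e i)) ≡ Vc
      expand = trans (sum-cong (λ i → sum*sum (e i) (e i)))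
        (trans (∑-comm (λ i j → sum (λ j′ → e i j * e i j′))) (sum-cong (λ j → ∑-comm (λ i j′ → e i j * e i j′))))

    -- Cauchy-Schwarz gives V² ≤ 4 K² `hom`, while `hom` is at most (M + 1) V by the hypothesis on
    -- 4-cycles; one factor V cancels.
    V≤ : V ≤ 4 * (K * K * suc M)
    V≤ with V in eq
    ... | zero = z≤n
    ... | V′@(suc _) = *-cancelʳ-≤ V′ _ V′ (subst (λ v → v * v ≤ 4 * (K * K * suc M) * v) eq (begin
      V * V ≡⟨ square Vr Vc ⟩
      Vr * Vr + Vc * Vc + 2 * (Vr * Vc) ≤⟨ +-monoʳ-≤ (Vr * Vr + Vc * Vc) (2ab≤a²+b² Vr Vc) ⟩
      (Vr * Vr + Vc * Vc) + (Vr * Vr + Vc * Vc) ≤⟨ +-mono-≤ (+-mono-≤ Vr²≤ Vc²≤) (+-mono-≤ Vr²≤ Vc²≤) ⟩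
      (K * K * hom + K * K * hom) + (K * K * hom + K * K * hom) ≡⟨ four (K * K) hom ⟩
      4 * (K * K) * hom ≤⟨ *-monoʳ-≤ (4 * (K * K)) (≤-trans hom≤ (≤-trans (+-monoˡ-≤ V X≤) (≤-reflexive (+-comm (M * V) V)))) ⟩
      4 * (K * K) * (suc M * V) ≡⟨ assoc′ (K * K) (suc M) V ⟩
      4 * (K * K * suc M) * V ∎))
      where
      open ≤-Reasoning
      square : ∀ a b → (a + b) * (a + b) ≡ a * a + b * b + 2 * (a * b)
      square = solve-∀
      four : ∀ k h → (k * h + k * h) + (k * h + k * h) ≡ 4 * k * h
      four = solve-∀
      assoc′ : ∀ k m v → 4 * k * (m * v) ≡ 4 * (k * m) * v
      assoc′ = solve-∀

  denseGraph≤ : ∀ m → K * K ≤ m * edges → 0 < K → K ≤ 2 * (m * m * suc M)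
  denseGraph≤ m dense 0<K = *-cancelʳ-≤ K _ (2 * (K * K * K)) {{>-nonZero (*>0 {2} (s≤s z≤n) (*>0 (*>0 0<K 0<K) 0<K))}} (begin
    K * (2 * (K * K * K)) ≡⟨ eq₁ K ⟩
    2 * ((K * K) * (K * K)) ≤⟨ *-monoʳ-≤ 2 (*-mono-≤ dense dense) ⟩
    2 * ((m * edges) * (m * edges)) ≡⟨ eq₂ m edges ⟩
    m * m * (edges * edges + edges * edges) ≤⟨ *-monoʳ-≤ (m * m) (+-mono-≤ edges²≤Vr edges²≤Vc) ⟩
    m * m * (K * Vr + K * Vc) ≡⟨ cong (m * m *_) (sym (*-distribˡ-+ K Vr Vc)) ⟩
    m * m * (K * V) ≤⟨ *-monoʳ-≤ (m * m) (*-monoʳ-≤ K V≤) ⟩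
    m * m * (K * (4 * (K * K * suc M))) ≡⟨ eq₃ m K (suc M) ⟩
    2 * (m * m * suc M) * (2 * (K * K * K)) ∎)
    where
    open ≤-Reasoning
    eq₁ : ∀ k → k * (2 * (k * k * k)) ≡ 2 * ((k * k) * (k * k))
    eq₁ = solve-∀
    eq₂ : ∀ m e → 2 * ((m * e) * (m * e)) ≡ m * m * (e * e + e * e)
    eq₂ = solve-∀
    eq₃ : ∀ m k s → m * m * (k * (4 * (k * k * s))) ≡ 2 * (m * m * s) * (2 * (k * k * k))
    eq₃ = solve-∀

-- Colouring the pairs of summands

dyadic-dist : ∀ {x y} k → 2 ^ k ≤ x → x < 2 ^ suc k → 2 ^ k ≤ y → y < 2 ^ suc k → dist x y ≤ 2 ^ k
dyadic-dist {x} {y} k lx ux ly uy with ≤-total x y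
... | inj₁ le = ≤-trans (≤-reflexive (trans (dist-sym x y) (dist-≤ le))) (m≤n+o⇒m∸n≤o _ x (<⇒≤ (<-≤-trans uy (≤-trans (≤-reflexive (cong (2 ^ k +_) (+-identityʳ (2 ^ k)))) (+-monoˡ-≤ (2 ^ k) lx)))))
... | inj₂ ge = ≤-trans (≤-reflexive (dist-≤ ge)) (m≤n+o⇒m∸n≤o _ y (<⇒≤ (<-≤-trans ux (≤-trans (≤-reflexive (cong (2 ^ k +_) (+-identityʳ (2 ^ k)))) (+-monoˡ-≤ (2 ^ k) ly)))))

dist≤⊔ : ∀ x y → dist x y ≤ x ⊔ y
dist≤⊔ x y = subst (_≤ x ⊔ y) (sym (cong ℤ.∣_∣ (ℤP.m-n≡m⊖n x y))) (ℤP.∣m⊝n∣≤m⊔n x y)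

module _ {M K : ℕ} (α β : Fin K → ℕ) (α-inj : Injective _≡_ _≡_ α) (β-inj : Injective _≡_ _≡_ β)
  (α>0 : ∀ i → 0 < α i) (β>0 : ∀ j → 0 < β j)
  (power : ∀ i j → PurePower (α i + β j)) (below : ∀ i j → α i + β j < 2 ^ M) where

  private
    root : ∀ i j → ∃₂ λ z q → Prime q × q < M × 0 < z × z ^ q ≡ α i + β j
    root i j = primeRoot (power i j) (+-mono-≤ (α>0 i) (β>0 j)) (below i j)
    z q : Fin K → Fin K → ℕ
    z i j = proj₁ (root i j)
    q i j = proj₁ (proj₂ (root i j))
    q-prime : ∀ i j → Prime (q i j)
    q-prime i j = proj₁ (proj₂ (proj₂ (root i j)))
    q<M : ∀ i j → q i j < M
    q<M i j = proj₁ (proj₂ (proj₂ (proj₂ (root i j))))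
    z>0 : ∀ i j → 0 < z i j
    z>0 i j = proj₁ (proj₂ (proj₂ (proj₂ (proj₂ (root i j)))))
    z^q : ∀ i j → z i j ^ q i j ≡ α i + β j
    z^q i j = proj₂ (proj₂ (proj₂ (proj₂ (proj₂ (root i j)))))

    α<2^M : ∀ i j → α i < 2 ^ M
    α<2^M i j = ≤-<-trans (m≤m+n (α i) (β j)) (below i j)
    β<2^M : ∀ i j → β j < 2 ^ M
    β<2^M i j = ≤-<-trans (m≤n+m (β j) (α i)) (below i j)

    logα<M : ∀ i (j : Fin K) → ⌊log₂ α i ⌋ < M
    logα<M i j = ⌊log₂⌋< (α>0 i) (α<2^M i j)
    logβ<M : ∀ (i : Fin K) j → ⌊log₂ β j ⌋ < M
    logβ<M i j = ⌊log₂⌋< (β>0 j) (β<2^M i j)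

    -- The dyadic scales of α and β are recorded separately: together they fix the scale of the sum,
    -- and each bounds the differences of its own summands, as `scale` needs.
    colour : Fin K → Fin K → Fin (M * M * M)
    colour i j = combine (combine (fromℕ< (q<M i j)) (fromℕ< (logα<M i j))) (fromℕ< (logβ<M i j))

    decode : ∀ {i j i′ j′} → colour i j ≡ colour i′ j′ → q i j ≡ q i′ j′ × ⌊log₂ α i ⌋ ≡ ⌊log₂ α i′ ⌋ × ⌊log₂ β j ⌋ ≡ ⌊log₂ β j′ ⌋
    decode {i} {j} {i′} {j′} eq with combine-injective _ _ _ _ eq
    ... | eq₁ , eqβ with combine-injective _ _ _ _ eq₁
    ... | eqq , eqα = back (q<M i j) (q<M i′ j′) eqq , back (logα<M i j) (logα<M i′ j′) eqα , back (logβ<M i j) (logβ<M i′ j′) eqβ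
      where
      back : ∀ {a b} (la : a < M) (lb : b < M) → fromℕ< la ≡ fromℕ< lb → a ≡ b
      back la lb e = trans (sym (toℕ-fromℕ< la)) (trans (cong toℕ e) (toℕ-fromℕ< lb))

  powerSumset≤ : K ≤ 2 * ((M * M * M) * (M * M * M) * suc M)
  powerSumset≤ with K ≟ 0
  ... | yes refl = z≤n
  ... | no K≢0 = denseGraph≤ (e c) (λ i j → ind≤1 (colour i j ≟F c)) M
      (quads≤cherries (q-prime i₀ j₀) α β α-inj β-inj (e c) z (λ i j → ind≤1 (colour i j ≟F c)) z>0
        (λ i j h → trans (cong (z i j ^_) (sym (proj₁ (same i j h)))) (z^q i j)) scale M
        (λ i i′ → <⇒≤ (≤-<-trans (dist≤⊔ (α i) (α i′)) (⊔-lub (α<2^M i i₁) (α<2^M i′ i₁))))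
        (λ j j′ → <⇒≤ (≤-<-trans (dist≤⊔ (β j) (β j′)) (⊔-lub (β<2^M i₁ j) (β<2^M i₁ j′)))))
      m dense 0<K
    where
    m = M * M * M
    0<K = n≢0⇒n>0 K≢0
    i₁ : Fin K
    i₁ = fromℕ< 0<K
    e : Fin m → Fin K → Fin K → ℕ
    e c i j = ind (colour i j ≟F c)
    size : Fin m → ℕ
    size c = sum (λ i → sum (e c i))
    total : sum size ≡ K * K
    total = trans (∑-comm (λ c i → sum (e c i))) (trans (sum-cong (λ i → trans (∑-comm (λ c j → e c i j))
        (trans (sum-cong (λ j → trans (sum-single (colour i j) (λ c → e c i j) (λ c ne → ind-no (colour i j ≟F c) (λ eq → ne (sym eq))))
          (ind-yes (colour i j ≟F colour i j) refl))) (trans (sum-const K 1) (*-identityʳ K)))))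
      (sum-const K K))
    largest = sum≤max size (colour i₁ i₁)
    c : Fin m
    c = proj₁ largest
    dense : K * K ≤ m * size c
    dense = subst (_≤ m * size c) total (proj₂ largest)
    nonempty : 0 < size c
    nonempty = *>0⇒ʳ m (<-≤-trans (*>0 0<K 0<K) dense)
    i₀ j₀ : Fin K
    i₀ = proj₁ (∃pos (λ i → sum (e c i)) nonempty)
    j₀ = proj₁ (∃pos (e c i₀) (proj₂ (∃pos (λ i → sum (e c i)) nonempty)))
    edge : ∀ i j → 0 < e c i j → colour i j ≡ c
    edge i j lt with colour i j ≟F c
    ... | yes eq = eq
    ... | no _ = ⊥-elim (<⇒≢ lt refl)
    same : ∀ i j → 0 < e c i j → q i j ≡ q i₀ j₀ × ⌊log₂ α i ⌋ ≡ ⌊log₂ α i₀ ⌋ × ⌊log₂ β j ⌋ ≡ ⌊log₂ β j₀ ⌋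
    same i j h = decode (trans (edge i j h) (sym (edge i₀ j₀ (proj₂ (∃pos (e c i₀) (proj₂ (∃pos (λ i → sum (e c i)) nonempty)))))))
    a b : ℕ
    a = ⌊log₂ α i₀ ⌋
    b = ⌊log₂ β j₀ ⌋
    α-low : ∀ {i j} → 0 < e c i j → 2 ^ a ≤ α i
    α-low {i} {j} h = subst (λ t → 2 ^ t ≤ α i) (proj₁ (proj₂ (same i j h))) (2^⌊log₂⌋≤ (α i) (α>0 i))
    α-high : ∀ {i j} → 0 < e c i j → α i < 2 ^ suc a
    α-high {i} {j} h = subst (λ t → α i < 2 ^ suc t) (proj₁ (proj₂ (same i j h))) (<2^suc⌊log₂⌋ (α i))
    β-low : ∀ {i j} → 0 < e c i j → 2 ^ b ≤ β j
    β-low {i} {j} h = subst (λ t → 2 ^ t ≤ β j) (proj₂ (proj₂ (same i j h))) (2^⌊log₂⌋≤ (β j) (β>0 j))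
    β-high : ∀ {i j} → 0 < e c i j → β j < 2 ^ suc b
    β-high {i} {j} h = subst (λ t → β j < 2 ^ suc t) (proj₂ (proj₂ (same i j h))) (<2^suc⌊log₂⌋ (β j))
    4uw≤ : ∀ u w → 4 * (u * w) ≤ (u + w) * (u + w)
    4uw≤ u w = subst₂ _≤_ (eq₁ u w) (eq₂ u w) (+-monoˡ-≤ (2 * (u * w)) (2ab≤a²+b² u w))
      where
      eq₁ : ∀ u w → 2 * (u * w) + 2 * (u * w) ≡ 4 * (u * w)
      eq₁ = solve-∀
      eq₂ : ∀ u w → u * u + w * w + 2 * (u * w) ≡ (u + w) * (u + w)
      eq₂ = solve-∀
    -- The differences are at most 2^a and 2^b, every sum is at least 2^a + 2^b, and 4 · 2^a · 2^b ≤
    -- (2^a + 2^b)².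
    scale : ∀ i i′ j j′ → 0 < e c i j → 0 < e c i′ j → 0 < e c i j′ → 0 < e c i′ j′ →
      4 * (dist (α i) (α i′) * dist (β j) (β j′)) ≤ (α i + β j) * (α i′ + β j′) ×
      4 * (dist (α i) (α i′) * dist (β j) (β j′)) ≤ (α i′ + β j) * (α i + β j′)
    scale i i′ j j′ h₁ h₂ h₃ h₄ =
      ≤-trans le (*-mono-≤ (+-mono-≤ (α-low h₁) (β-low h₁)) (+-mono-≤ (α-low h₄) (β-low h₄))) ,
      ≤-trans le (*-mono-≤ (+-mono-≤ (α-low h₂) (β-low h₂)) (+-mono-≤ (α-low h₃) (β-low h₃)))
      where
      le : 4 * (dist (α i) (α i′) * dist (β j) (β j′)) ≤ (2 ^ a + 2 ^ b) * (2 ^ a + 2 ^ b)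
      le = ≤-trans (*-monoʳ-≤ 4 (*-mono-≤ (dyadic-dist a (α-low h₁) (α-high h₁) (α-low h₂) (α-high h₂))
          (dyadic-dist b (β-low h₁) (β-high h₁) (β-low h₃) (β-high h₃)))) (4uw≤ (2 ^ a) (2 ^ b))

-- Sub-sums modulo prime powers

data SubSum : List ℕ → ℕ → Set where
  none : SubSum [] 0
  skip : ∀ {x xs s} → SubSum xs s → SubSum (x ∷ xs) s
  keep : ∀ {x xs s} → SubSum xs s → SubSum (x ∷ xs) (x + s)

SubSum-0 : ∀ xs → SubSum xs 0
SubSum-0 [] = none
SubSum-0 (x ∷ xs) = skip (SubSum-0 xs)

SubSum-++ : ∀ {xs ys s t} → SubSum xs s → SubSum ys t → SubSum (xs ++ ys) (s + t)
SubSum-++ none q = q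
SubSum-++ (skip p) q = skip (SubSum-++ p q)
SubSum-++ {t = t} (keep {x} {xs} {s} p) q = subst (SubSum _) (sym (+-assoc x s t)) (keep (SubSum-++ p q))

SubSum-++ˡ : ∀ {xs s} ys → SubSum xs s → SubSum (xs ++ ys) s
SubSum-++ˡ ys p = subst (SubSum _) (+-identityʳ _) (SubSum-++ p (SubSum-0 ys))

SubSum-++ʳ : ∀ xs {ys s} → SubSum ys s → SubSum (xs ++ ys) s
SubSum-++ʳ xs p = SubSum-++ (SubSum-0 xs) p

SubSum-↭ : ∀ {xs ys s} → xs ↭ ys → SubSum xs s → SubSum ys s
SubSum-↭ Perm.refl p = p
SubSum-↭ (prep x eq) (skip p) = skip (SubSum-↭ eq p)
SubSum-↭ (prep x eq) (keep p) = keep (SubSum-↭ eq p)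
SubSum-↭ (swap x y eq) (skip (skip p)) = skip (skip (SubSum-↭ eq p))
SubSum-↭ (swap x y eq) (skip (keep p)) = keep (skip (SubSum-↭ eq p))
SubSum-↭ (swap x y eq) (keep (skip p)) = skip (keep (SubSum-↭ eq p))
SubSum-↭ (swap x y eq) (keep (keep {s = s} p)) = subst (SubSum _) (shuffle y x s) (keep (keep (SubSum-↭ eq p)))
  where
  shuffle : ∀ y x s → y + (x + s) ≡ x + (y + s)
  shuffle = solve-∀
SubSum-↭ (Perm.trans eq₁ eq₂) p = SubSum-↭ eq₂ (SubSum-↭ eq₁ p)

SubSum-∣ : ∀ {m xs s} → All (m ∣_) xs → SubSum xs s → m ∣ s
SubSum-∣ {m} ds none = m ∣0
SubSum-∣ (_ ∷ ds) (skip p) = SubSum-∣ ds p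
SubSum-∣ (d ∷ ds) (keep p) = ∣m∣n⇒∣m+n d (SubSum-∣ ds p)

mod? : ∀ a b m → Dec (a ≡ b mod m)
mod? a b m with m ∣? dist a b
... | yes d = yes (mod-intro (fromAbs (ℤ.+ a ℤ.- ℤ.+ b) d))
... | no nd = no (λ h → nd (toAbs (ℤ.+ a ℤ.- ℤ.+ b) (mod-elim h)))

mod-+-cancelˡ : ∀ {m} c {a b} → c + a ≡ c + b mod m → a ≡ b mod m
mod-+-cancelˡ {m} c {a} {b} (mod-intro h) = mod-intro (subst (m ∣ᶻ_)
  (trans (cong₂ ℤ._-_ (ℤP.pos-+ c a) (ℤP.pos-+ c b)) (eq (ℤ.+ c) (ℤ.+ a) (ℤ.+ b))) h)
  where
  eq : ∀ c a b → (c ℤ.+ a) ℤ.- (c ℤ.+ b) ≡ a ℤ.- b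
  eq = ℤR.solve-∀

mod-+-cancelʳ : ∀ {m} c {a b} → a + c ≡ b + c mod m → a ≡ b mod m
mod-+-cancelʳ c {a} {b} h = mod-+-cancelˡ c (mod-trans (mod-reflexive (+-comm c a)) (mod-trans h (mod-reflexive (+-comm b c))))

∣⇒mod0 : ∀ {m a} → m ∣ a → a ≡ 0 mod m
∣⇒mod0 {m} d = ∣⇒mod d (m ∣0)

mod0⇒∣ : ∀ {m a} → a ≡ 0 mod m → m ∣ a
mod0⇒∣ {m} h = mod-∣ h (m ∣0)

multiples-distinct : ∀ {r e x} → Prime r → ¬ r ^ e ∣ x → ∀ {s t} → s < t → t < r → ¬ s * x ≡ t * x mod r ^ e
multiples-distinct {r} {e} {x} pr nx {s} {t} s<t t<r h = nx (p^k∣d*s⇒p^k∣d pr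
    (λ d → <⇒≱ (≤-<-trans (m∸n≤m t s) t<r) (∣⇒≤′ (m<n⇒0<n∸m s<t) d)) e x
    (mod0⇒∣ (mod-sym (mod-+-cancelˡ (s * x) (mod-trans (mod-reflexive (+-identityʳ (s * x))) (mod-trans h (mod-reflexive split)))))))
  where
  split : t * x ≡ s * x + x * (t ∸ s)
  split = trans (cong (_* x) (sym (m+[n∸m]≡n (<⇒≤ s<t)))) (trans (*-distribʳ-+ x s (t ∸ s)) (cong (s * x +_) (*-comm (t ∸ s) x)))

-- If the classes found so far are not closed under adding x, some translate is a new class.
-- Otherwise they contain the orbit of one class under x, and its r members f 0 + t x with t < r are
-- distinct, too many for a list shorter than r.
growth : ∀ {r e} → Prime r → ∀ xs → All (λ x → ¬ r ^ e ∣ x) xs → length xs < r →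
  ∃ λ (f : Fin (suc (length xs)) → ℕ) → (∀ i → SubSum xs (f i)) × (∀ i j → f i ≡ f j mod r ^ e → i ≡ j)
growth pr [] ns lt = (λ _ → 0) , (λ _ → none) , λ { fzero fzero _ → refl }
growth {r} {e} pr (x ∷ xs) (nx ∷ ns) lt with growth {e = e} pr xs ns (<-trans (n<1+n _) lt)
... | f , sub , inj with any? (λ i → all? (λ j → ¬? (mod? (f i + x) (f j) (r ^ e))))
... | yes (i , new) = f′ , sub′ , inj′
  where
  f′ : Fin (suc (suc (length xs))) → ℕ
  f′ fzero = x + f i
  f′ (fsuc j) = f j
  sub′ : ∀ j → SubSum (x ∷ xs) (f′ j)
  sub′ fzero = keep (sub i)
  sub′ (fsuc j) = skip (sub j)
  inj′ : ∀ j k → f′ j ≡ f′ k mod r ^ e → j ≡ k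
  inj′ fzero fzero _ = refl
  inj′ fzero (fsuc k) h = ⊥-elim (new k (mod-trans (mod-reflexive (+-comm (f i) x)) h))
  inj′ (fsuc j) fzero h = ⊥-elim (new j (mod-trans (mod-reflexive (+-comm (f i) x)) (mod-sym h)))
  inj′ (fsuc j) (fsuc k) h = cong fsuc (inj j k h)
... | no closed = ⊥-elim (collide (pigeonhole lt (λ t → orbit (toℕ t))))
  where
  next : ∀ i → ∃ λ j → f i + x ≡ f j mod r ^ e
  next i with any? (λ j → mod? (f i + x) (f j) (r ^ e))
  ... | yes h = h
  ... | no nh = ⊥-elim (closed (i , λ j h → nh (j , h)))
  orbit : ℕ → Fin (suc (length xs))
  orbit zero = fzero
  orbit (suc t) = proj₁ (next (orbit t))
  orbit≡ : ∀ t → f (orbit t) ≡ f fzero + t * x mod r ^ e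
  orbit≡ zero = mod-reflexive (sym (+-identityʳ _))
  orbit≡ (suc t) = mod-trans (mod-sym (proj₂ (next (orbit t)))) (mod-trans (mod-+ (orbit≡ t) mod-refl) (mod-reflexive (shuffle (f fzero) (t * x) x)))
    where
    shuffle : ∀ a b c → a + b + c ≡ a + (c + b)
    shuffle = solve-∀
  collide : (∃₂ λ (s t : Fin r) → toℕ s < toℕ t × orbit (toℕ s) ≡ orbit (toℕ t)) → ⊥
  collide (s , t , s<t , eq) = multiples-distinct {e = e} pr nx s<t (toℕ<n t) (mod-+-cancelˡ (f fzero)
    (mod-trans (mod-sym (orbit≡ (toℕ s))) (mod-trans (mod-reflexive (cong f eq)) (orbit≡ (toℕ t)))))

ExactlyDiv : ℕ → ℕ → ℕ → Set
ExactlyDiv p u x = p ^ u ∣ x × ¬ p ^ suc u ∣ x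

-- `growth` yields p sub-sums in distinct classes, all multiples of p^u; there are only p such
-- classes modulo p^(u+1), so c cannot lie in a further one.
coverage : ∀ {p u} → Prime p → ∀ xs → All (ExactlyDiv p u) xs → suc (length xs) ≡ p → ∀ c → p ^ u ∣ c →
  ∃ λ s → SubSum xs s × s ≡ c mod p ^ suc u
coverage {p} {u} pr xs exact refl c P∣c with growth {e = suc u} pr xs (All.map proj₂ exact) ≤-refl
... | f , sub , inj with any? (λ i → mod? (f i) c (p ^ suc u))
... | yes (i , h) = f i , sub i , h
... | no none′ = ⊥-elim (collide (pigeonhole ≤-refl (λ i → fromℕ< (m%n<n (y i) p))))
  where
  g : Fin (suc p) → ℕ
  g fzero = c
  g (fsuc i) = f i
  divs : ∀ i → p ^ u ∣ g i
  divs fzero = P∣c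
  divs (fsuc i) = SubSum-∣ (All.map proj₁ exact) (sub i)
  y : Fin (suc p) → ℕ
  y i = quotient (divs i)
  lift : ∀ i j → y i ≡ y j mod p → g i ≡ g j mod p ^ suc u
  lift i j (mod-intro h) = mod-intro (fromAbs (ℤ.+ g i ℤ.- ℤ.+ g j) (subst₂ _∣_ (*-comm (p ^ u) p)
    (trans (sym (dist-* (p ^ u) (y i) (y j))) (cong₂ dist (sym (m∣n⇒n≡m*quotient (divs i))) (sym (m∣n⇒n≡m*quotient (divs j)))))
    (*-monoʳ-∣ (p ^ u) (toAbs (ℤ.+ y i ℤ.- ℤ.+ y j) h))))
  sameClass : ∀ {i j} → fromℕ< (m%n<n (y i) p) ≡ fromℕ< (m%n<n (y j) p) → g i ≡ g j mod p ^ suc u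
  sameClass {i} {j} eq = lift i j (%≡⇒mod (trans (sym (toℕ-fromℕ< (m%n<n (y i) p))) (trans (cong toℕ eq) (toℕ-fromℕ< (m%n<n (y j) p)))))
  collide : (∃₂ λ i j → toℕ i < toℕ j × fromℕ< (m%n<n (y i) p) ≡ fromℕ< (m%n<n (y j) p)) → ⊥
  collide (fzero , fsuc j , _ , eq) = none′ (j , mod-sym (sameClass {fzero} {fsuc j} eq))
  collide (fsuc i , fsuc j , i<j , eq) = <⇒≢ (s≤s⁻¹ i<j) (cong toℕ (inj i j (sameClass {fsuc i} {fsuc j} eq)))

module _ {p u ρ b : ℕ} (pr : Prime p) {xs ys zs : List ℕ}
  (ex : All (ExactlyDiv p u) xs) (ey : All (ExactlyDiv p u) ys) (ez : All (ExactlyDiv p u) zs)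
  (lx : suc (length xs) ≡ p) (ly : suc (length ys) ≡ p) (lz : suc (length zs) ≡ p) (P∣b : p ^ u ∣ b) (ρ∤pb : ¬ ρ ∣ p * b) where

  private
    P Q γ y : ℕ
    P = p ^ u
    Q = p ^ suc u
    -- The class of -b modulo Q, as a natural number.
    γ = b * (Q ∸ 1)
    γ+b : γ + b ≡ b * Q
    γ+b = trans (cong (γ +_) (sym (*-identityʳ b))) (trans (sym (*-distribˡ-+ b (Q ∸ 1) 1)) (cong (b *_) (m∸n+n≡m (^>0 (suc u) (prime⇒0< pr)))))
    P∣γ : P ∣ γ
    P∣γ = ∣m⇒∣m*n (Q ∸ 1) P∣b
    yCover : ∃ λ s → SubSum ys s × s ≡ γ mod Q
    yCover = coverage {u = u} pr ys ey ly γ P∣γ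
    y = proj₁ yCover
    xCover : ∀ j → ∃ λ s → SubSum xs s × s ≡ j * γ mod Q
    -- In the zero class the empty sub-sum is taken on purpose: X 0 and X p must be 0 itself, since
    -- they are later compared modulo ρ and not modulo Q.
    xCover j with Q ∣? j * γ
    ... | yes d = 0 , SubSum-0 xs , mod-sym (∣⇒mod0 d)
    ... | no _ = coverage {u = u} pr xs ex lx (j * γ) (∣n⇒∣m*n j P∣γ)
    zCover : ∀ j → ∃ λ s → SubSum zs s × s ≡ j * b mod Q
    zCover j = coverage {u = u} pr zs ez lz (j * b) (∣n⇒∣m*n j P∣b)
    X Z : ℕ → ℕ
    X j = proj₁ (xCover j)
    Z j = proj₁ (zCover j)
    X≡0 : ∀ j → Q ∣ j * γ → X j ≡ 0
    X≡0 j d with Q ∣? j * γ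
    ... | yes _ = refl
    ... | no nd = ⊥-elim (nd d)
    zero-class : ∀ j → Q ∣ j * γ + j * b
    zero-class j = subst (Q ∣_) (trans (cong (j *_) (sym γ+b)) (*-distribˡ-+ j γ b)) (∣n⇒∣m*n j (n∣m*n b))

  -- If every sub-sum divisible by p^(u+1) were divisible by ρ, the class of a sub-sum modulo p^(u+1) would determine it
  -- modulo ρ, additively; the resulting homomorphism from the p-element group of classes forces ρ ∣ p * b.
  block : ∃ λ τ → SubSum (b ∷ (xs ++ (ys ++ zs))) τ × p ^ suc u ∣ τ × ¬ ρ ∣ τ
  block with ρ ∣? b + y | any? (λ (j : Fin p) → ¬? (ρ ∣? X (toℕ j) + (y + Z (suc (toℕ j))))) | any? (λ (j : Fin p) → ¬? (ρ ∣? X (suc (toℕ j)) + Z (suc (toℕ j))))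
  ... | no nd | _ | _ = b + y , keep (SubSum-++ʳ xs (SubSum-++ˡ zs (proj₁ (proj₂ yCover)))) ,
      mod0⇒∣ (mod-trans (mod-+ mod-refl (proj₂ (proj₂ yCover))) (∣⇒mod0 (subst (Q ∣_) (trans (sym γ+b) (+-comm γ b)) (n∣m*n b)))) , nd
  ... | _ | yes (j , nd) | _ = _ , skip (SubSum-++ (proj₁ (proj₂ (xCover (toℕ j)))) (SubSum-++ (proj₁ (proj₂ yCover)) (proj₁ (proj₂ (zCover (suc (toℕ j))))))) ,
      mod0⇒∣ (mod-trans (mod-+ (proj₂ (proj₂ (xCover (toℕ j)))) (mod-+ (proj₂ (proj₂ yCover)) (proj₂ (proj₂ (zCover (suc (toℕ j)))))))
        (∣⇒mod0 (subst (Q ∣_) (shuffle (toℕ j * γ) γ (suc (toℕ j) * b)) (zero-class (suc (toℕ j)))))) , nd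
    where
    shuffle : ∀ a g c → (g + a) + c ≡ a + (g + c)
    shuffle = solve-∀
  ... | _ | _ | yes (j , nd) = _ , skip (SubSum-++ (proj₁ (proj₂ (xCover (suc (toℕ j))))) (SubSum-++ʳ ys (proj₁ (proj₂ (zCover (suc (toℕ j))))))) ,
      mod0⇒∣ (mod-trans (mod-+ (proj₂ (proj₂ (xCover (suc (toℕ j))))) (proj₂ (proj₂ (zCover (suc (toℕ j))))))
        (∣⇒mod0 (zero-class (suc (toℕ j))))) , nd
  ... | yes ρ∣b+y | no none₁ | no none₂ = ⊥-elim (ρ∤pb (mod0⇒∣ (mod-+-cancelʳ (p * y)
      (mod-trans (mod-reflexive (sym (*-distribˡ-+ p b y))) (mod-trans (∣⇒mod0 (∣n⇒∣m*n p ρ∣b+y)) (mod-trans (mod-sym pY≡0) (mod-reflexive refl)))))))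
    where
    all₁ : ∀ (j : Fin p) → ρ ∣ X (toℕ j) + (y + Z (suc (toℕ j)))
    all₁ j = decidable-stable (ρ ∣? _) λ nd → none₁ (j , nd)
    all₂ : ∀ (j : Fin p) → ρ ∣ X (suc (toℕ j)) + Z (suc (toℕ j))
    all₂ j = decidable-stable (ρ ∣? _) λ nd → none₂ (j , nd)
    step : ∀ j → j < p → X (suc j) ≡ y + X j mod ρ
    step j j<p = subst (λ k → X (suc k) ≡ y + X k mod ρ) (toℕ-fromℕ< j<p) (mod-+-cancelʳ (Z (suc (toℕ i)))
        (mod-trans (∣⇒mod (all₂ i) (all₁ i)) (mod-reflexive (shuffle (X (toℕ i)) y (Z (suc (toℕ i)))))))
      where
      i = fromℕ< j<p
      shuffle : ∀ a b c → a + (b + c) ≡ b + a + c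
      shuffle = solve-∀
    X≡ : ∀ j → j ≤ p → X j ≡ j * y mod ρ
    X≡ zero _ = mod-reflexive (X≡0 0 (Q ∣0))
    X≡ (suc j) j<p = mod-trans (step j j<p) (mod-+ (mod-refl {a = y}) (X≡ j (<⇒≤ j<p)))
    pY≡0 : p * y ≡ 0 mod ρ
    pY≡0 = mod-trans (mod-sym (X≡ p ≤-refl)) (mod-reflexive (X≡0 p (*-monoʳ-∣ p P∣γ)))

-- Choosing one option for each modulus

module _ {n : ℕ} where
  cons : ∀ {k} → Fin n → (Fin k → Fin n) → Fin (suc k) → Fin n
  cons i t fzero = i
  cons i t (fsuc c) = t c

  sumTuples : ∀ k → ((Fin k → Fin n) → ℕ) → ℕ
  sumTuples zero F = F (λ ())
  sumTuples (suc k) F = sum {n} (λ i → sumTuples k (λ t → F (cons i t)))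

  sumTuples-mono : ∀ k {F G : (Fin k → Fin n) → ℕ} → (∀ t → F t ≤ G t) → sumTuples k F ≤ sumTuples k G
  sumTuples-mono zero h = h (λ ())
  sumTuples-mono (suc k) h = sum-mono {n} (λ i → sumTuples-mono k (λ t → h (cons i t)))

  sumTuples-1 : ∀ k → sumTuples k (λ _ → 1) ≡ n ^ k
  sumTuples-1 zero = refl
  sumTuples-1 (suc k) = trans (sum-cong {n} (λ _ → sumTuples-1 k)) (sum-const n (n ^ k))

  sumTuples-sum : ∀ k {m} (F : Fin m → (Fin k → Fin n) → ℕ) → sum (λ i → sumTuples k (F i)) ≡ sumTuples k (λ t → sum (λ i → F i t))
  sumTuples-sum zero F = refl
  sumTuples-sum (suc k) F = trans (∑-comm (λ i j → sumTuples k (λ t → F i (cons j t)))) (sum-cong {n} (λ j → sumTuples-sum k (λ i t → F i (cons j t))))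

  small⇒zero : ∀ k F → sumTuples k F < n ^ k → ∃ λ t → F t ≡ 0
  small⇒zero zero F lt = (λ ()) , n≤0⇒n≡0 (s≤s⁻¹ lt)
  small⇒zero (suc k) F lt with any? (λ i → sumTuples k (λ t → F (cons i t)) <? n ^ k)
  ... | yes (i , lt′) with small⇒zero k (λ t → F (cons i t)) lt′
  ... | t , z = cons i t , z
  small⇒zero (suc k) F lt | no nh = ⊥-elim (<⇒≱ lt (≤-trans (≤-reflexive (sym (sum-const n (n ^ k)))) (sum-mono {n} (λ i → ≮⇒≥ (λ lt′ → nh (i , lt′))))))

  atMostOne : ∀ {m} {P : Fin m → Set} (P? : ∀ i → Dec (P i)) → (∀ i j → P i → P j → i ≡ j) → sum (λ i → ind (P? i)) ≤ 1
  atMostOne P? uniq with any? P?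
  ... | yes (i , pi) = ≤-trans (≤-reflexive (sum-single i (λ j → ind (P? j)) (λ j ne → ind-no (P? j) (λ pj → ne (uniq j i pj pi))))) (ind≤1 (P? i))
  ... | no nh = ≤-trans (≤-reflexive (sum-0 (λ j → ind (P? j)) (λ j → ind-no (P? j) (λ pj → nh (j , pj))))) z≤n

  -- With all coordinates but c fixed, the n options at c give sums distinct modulo ρ, so at most
  -- one of them is a multiple. The offset s collects the coordinates already fixed by the
  -- recursion.
  countBad : ∀ {k} (o : Fin k → Fin n → ℕ) (c : Fin k) ρ s → (∀ i j → o c i ≡ o c j mod ρ → i ≡ j) →
    n * sumTuples k (λ t → ind (ρ ∣? s + sum (λ c′ → o c′ (t c′)))) ≤ n ^ k
  countBad {suc k} o fzero ρ s inj = *-monoʳ-≤ n (begin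
    sumTuples (suc k) (λ t → ind (ρ ∣? s + sum (λ c′ → o c′ (t c′)))) ≡⟨ sumTuples-sum k (λ i t → ind (ρ ∣? s + (o fzero i + sum (λ c′ → o (fsuc c′) (t c′))))) ⟩
    sumTuples k (λ t → sum {n} (λ i → ind (ρ ∣? s + (o fzero i + sum (λ c′ → o (fsuc c′) (t c′))))))
      ≤⟨ sumTuples-mono k (λ t → atMostOne (λ i → ρ ∣? s + (o fzero i + sum (λ c′ → o (fsuc c′) (t c′)))) (λ i j di dj →
           inj i j (mod-+-cancelʳ (sum (λ c′ → o (fsuc c′) (t c′))) (mod-+-cancelˡ s (∣⇒mod di dj))))) ⟩
    sumTuples k (λ _ → 1) ≡⟨ sumTuples-1 k ⟩
    n ^ k ∎)
    where open ≤-Reasoning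
  countBad {suc k} o (fsuc c) ρ s inj = begin
    n * sum {n} (λ i → sumTuples k (λ t → ind (ρ ∣? s + (o fzero i + sum (λ c′ → o (fsuc c′) (t c′))))))
      ≡⟨ *-distribˡ-sum {n} n (λ i → sumTuples k (λ t → ind (ρ ∣? s + (o fzero i + sum (λ c′ → o (fsuc c′) (t c′)))))) ⟩
    sum {n} (λ i → n * sumTuples k (λ t → ind (ρ ∣? s + (o fzero i + sum (λ c′ → o (fsuc c′) (t c′))))))
      ≤⟨ sum-mono {n} (λ i → subst (_≤ n ^ k) (cong (n *_) (rebase i)) (countBad (λ c′ → o (fsuc c′)) c ρ (s + o fzero i) inj)) ⟩
    sum {n} (λ i → n ^ k) ≡⟨ sum-const n (n ^ k) ⟩
    n ^ suc k ∎
    where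
    open ≤-Reasoning
    rebase : ∀ i → sumTuples k (λ t → ind (ρ ∣? s + o fzero i + sum (λ c′ → o (fsuc c′) (t c′)))) ≡
      sumTuples k (λ t → ind (ρ ∣? s + (o fzero i + sum (λ c′ → o (fsuc c′) (t c′)))))
    rebase i = ≤-antisym (sumTuples-mono k (λ t → ≤-reflexive (eq t))) (sumTuples-mono k (λ t → ≤-reflexive (sym (eq t))))
      where
      eq : ∀ t → ind (ρ ∣? s + o fzero i + sum (λ c′ → o (fsuc c′) (t c′))) ≡ ind (ρ ∣? s + (o fzero i + sum (λ c′ → o (fsuc c′) (t c′))))
      eq t = cong (λ x → ind (ρ ∣? x)) (+-assoc s (o fzero i) (sum (λ c′ → o (fsuc c′) (t c′))))

  -- Each modulus rules out at most a fraction 1/n of all choices.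
  avoidAll : ∀ {k} (o : Fin k → Fin n → ℕ) (ρ : Fin k → ℕ) → k < n → (∀ c i j → o c i ≡ o c j mod ρ c → i ≡ j) →
    ∃ λ (t : Fin k → Fin n) → ∀ c → ¬ ρ c ∣ sum (λ c′ → o c′ (t c′))
  avoidAll {k} o ρ k<n inj with small⇒zero k (λ t → sum (λ c → ind (ρ c ∣? sum (λ c′ → o c′ (t c′)))))
    (*-cancelˡ-< n _ _ (begin-strict
      n * sumTuples k (λ t → sum (λ c → ind (ρ c ∣? sum (λ c′ → o c′ (t c′)))))
        ≡⟨ cong (n *_) (sym (sumTuples-sum k (λ c t → ind (ρ c ∣? sum (λ c′ → o c′ (t c′)))))) ⟩
      n * sum (λ c → sumTuples k (λ t → ind (ρ c ∣? sum (λ c′ → o c′ (t c′)))))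
        ≡⟨ *-distribˡ-sum n (λ c → sumTuples k (λ t → ind (ρ c ∣? sum (λ c′ → o c′ (t c′))))) ⟩
      sum (λ c → n * sumTuples k (λ t → ind (ρ c ∣? sum (λ c′ → o c′ (t c′))))) ≤⟨ sum-mono (λ c → countBad o c (ρ c) 0 (inj c)) ⟩
      sum (λ (c : Fin k) → n ^ k) ≡⟨ sum-const k (n ^ k) ⟩
      k * n ^ k <⟨ *-monoˡ-< (n ^ k) {{>-nonZero (^>0 k (≤-<-trans z≤n k<n))}} k<n ⟩
      n * n ^ k ∎))
    where open ≤-Reasoning
  ... | t , z = t , λ c d → <⇒≢ (≤-trans (≤-reflexive (sym (ind-yes (ρ c ∣? _) d))) (term≤sum (λ c → ind (ρ c ∣? sum (λ c′ → o c′ (t c′)))) c)) (sym z)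

-- Supplies of elements of least valuation and blocks built from them

module _ {P : ℕ → Set} (P? : ∀ x → Dec (P x)) where
  count : List ℕ → ℕ
  count [] = 0
  count (x ∷ xs) = ind (P? x) + count xs

  count-++ : ∀ xs ys → count (xs ++ ys) ≡ count xs + count ys
  count-++ [] ys = refl
  count-++ (x ∷ xs) ys = trans (cong (ind (P? x) +_) (count-++ xs ys)) (sym (+-assoc (ind (P? x)) _ _))

  count-↭ : ∀ {xs ys} → xs ↭ ys → count xs ≡ count ys
  count-↭ Perm.refl = refl
  count-↭ (prep x eq) = cong (ind (P? x) +_) (count-↭ eq)
  count-↭ (swap x y eq) = trans (cong (λ t → ind (P? x) + (ind (P? y) + t)) (count-↭ eq)) (shuffle (ind (P? x)) (ind (P? y)) _)
    where
    shuffle : ∀ a b c → a + (b + c) ≡ b + (a + c)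
    shuffle = solve-∀
  count-↭ (Perm.trans eq₁ eq₂) = trans (count-↭ eq₁) (count-↭ eq₂)

  count≤length : ∀ xs → count xs ≤ length xs
  count≤length [] = z≤n
  count≤length (x ∷ xs) = +-mono-≤ (ind≤1 (P? x)) (count≤length xs)

  extract : ∀ k xs → k ≤ count xs → ∃₂ λ us rest → xs ↭ us ++ rest × length us ≡ k × All P us
  extract zero xs _ = [] , xs , ↭-refl , refl , []
  extract (suc k) (x ∷ xs) le with P? x
  ... | yes px with extract k xs (s≤s⁻¹ le)
  ... | us , rest , eq , len , ps = x ∷ us , rest , prep x eq , cong suc len , px ∷ ps
  extract (suc k) (x ∷ xs) le | no _ with extract (suc k) xs le
  ... | us , rest , eq , len , ps = us , x ∷ rest , ↭-trans (prep x eq) (↭-sym (shift x us rest)) , len , ps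

module _ {N : ℕ} (π : Fin N → ℕ) (π-prime : ∀ i → Prime (π i)) (u : Fin N → ℕ) where

  unit? : ∀ i x → Dec (¬ π i ^ suc (u i) ∣ x)
  unit? i x = ¬? (π i ^ suc (u i) ∣? x)

  record Supply (S : List ℕ) (k : ℕ) : Set where
    constructor supply
    field
      divisible : ∀ i → All (π i ^ u i ∣_) S
      enough : ∀ i → k ≤ count (unit? i) S
  open Supply

  Supply-≤ : ∀ {S k l} → k ≤ l → Supply S l → Supply S k
  Supply-≤ le (supply d e) = supply d (λ i → ≤-trans le (e i))

  -- The elements of least valuation for different primes may overlap; a elements taken for one
  -- prime cost any other prime at most a of its own.
  takeUnits : ∀ {S} i a k → Supply S (a + k) →
    ∃₂ λ us rest → S ↭ us ++ rest × length us ≡ a × All (ExactlyDiv (π i) (u i)) us × Supply rest k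
  takeUnits {S} i a k (supply d e) with extract (unit? i) a S (≤-trans (m≤m+n a k) (e i))
  ... | us , rest , eq , len , units = us , rest , eq , len ,
      All.zipWith (λ x → x) (AllP.++⁻ˡ us (All-resp-↭ eq (d i)) , units) ,
      supply (λ j → AllP.++⁻ʳ us (All-resp-↭ eq (d j)))
        (λ j → +-cancelˡ-≤ a k _ (≤-trans (e j) (≤-trans (≤-reflexive (trans (count-↭ (unit? j) eq) (count-++ (unit? j) us rest)))
          (+-monoˡ-≤ (count (unit? j) rest) (≤-trans (count≤length (unit? j) us) (≤-reflexive len))))))

  module _ (i₀ : Fin N) where
    private
      p : ℕ
      p = π i₀

    -- One `block` uses three groups of p - 1 elements and the element b, at most 3 p in all. Its
    -- sum τ acts as a new element with an additional factor p, still not a multiple of ρ.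
    superElement : ∀ {S ρ} j k → (∀ {b} → ¬ π j ^ suc (u j) ∣ b → ¬ ρ ∣ p * b) → Supply S (3 * p + k) →
      ∃ λ τ → ∃₂ λ us rest → S ↭ us ++ rest × SubSum us τ × p ^ suc (u i₀) ∣ τ × (¬ ρ ∣ τ) × Supply rest k
    superElement {S} {ρ} j k ρ∤ sup = case takeUnits i₀ (pred p) (pred p + (pred p + (1 + k))) (Supply-≤ (size p (prime⇒0< (π-prime i₀))) sup) of
      λ { (xs , S₁ , eq₁ , lx , ex , sup₁) → case takeUnits i₀ (pred p) (pred p + (1 + k)) sup₁ of
      λ { (ys , S₂ , eq₂ , ly , ey , sup₂) → case takeUnits i₀ (pred p) (1 + k) sup₂ of
      λ { (zs , S₃ , eq₃ , lz , ez , sup₃) → case takeUnits j 1 k sup₃ of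
      λ { (b ∷ [] , S₄ , eq₄ , _ , (_ , nb) ∷ [] , sup₄) →
        case block {u = u i₀} (π-prime i₀) ex ey ez (len lx) (len ly) (len lz) (All.head (All-resp-↭ eq₄ (divisible sup₃ i₀))) (ρ∤ nb) of
      λ { (τ , sub , d , nd) → τ , b ∷ (xs ++ (ys ++ zs)) , S₄ , perm b xs ys zs eq₁ eq₂ eq₃ eq₄ , sub , d , nd , sup₄ } } } } }
      where
      size : ∀ p → 0 < p → pred p + (pred p + (pred p + (1 + k))) ≤ 3 * p + k
      size (suc p) _ = ≤-trans (m≤n+m _ 2) (≤-reflexive (eq p k))
        where
        eq : ∀ p k → 2 + (p + (p + (p + (1 + k)))) ≡ 3 * (1 + p) + k
        eq = solve-∀
      len : ∀ {n} → n ≡ pred p → suc n ≡ p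
      len eq = trans (cong suc eq) (suc-pred p {{prime⇒nonZero (π-prime i₀)}})
      perm : ∀ b xs ys zs {S₁ S₂ S₃ S₄} → S ↭ xs ++ S₁ → S₁ ↭ ys ++ S₂ → S₂ ↭ zs ++ S₃ → S₃ ↭ b ∷ S₄ →
        S ↭ b ∷ (xs ++ (ys ++ zs)) ++ S₄
      perm b xs ys zs {S₄ = S₄} eq₁ eq₂ eq₃ eq₄ = ↭-trans eq₁ (↭-trans (++⁺ˡ xs (↭-trans eq₂ (++⁺ˡ ys (↭-trans eq₃ (++⁺ˡ zs eq₄)))))
        (↭-trans (↭-reflexive (trans (cong (xs ++_) (sym (Lₚ.++-assoc ys zs (b ∷ S₄)))) (sym (Lₚ.++-assoc xs (ys ++ zs) (b ∷ S₄)))))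
          (shift b (xs ++ (ys ++ zs)) S₄)))

    superElements : ∀ {S ρ} j n k → (∀ {b} → ¬ π j ^ suc (u j) ∣ b → ¬ ρ ∣ p * b) → Supply S (n * (3 * p) + k) →
      ∃ λ τs → ∃₂ λ us rest → S ↭ us ++ rest × length τs ≡ n × (∀ {s} → SubSum τs s → SubSum us s) ×
        All (p ^ suc (u i₀) ∣_) τs × All (λ τ → ¬ ρ ∣ τ) τs × Supply rest k
    superElements {S} j zero k ρ∤ sup = [] , [] , S , ↭-refl , refl , (λ s → s) , [] , [] , sup
    superElements {S} {ρ} j (suc n) k ρ∤ sup =
      case superElement {S} {ρ} j (n * (3 * p) + k) ρ∤ (Supply-≤ (≤-reflexive (sym (+-assoc (3 * p) (n * (3 * p)) k))) sup) of
      λ { (τ , us , S₁ , eq , sub , d , nd , sup₁) → case superElements {S₁} {ρ} j n k ρ∤ sup₁ of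
      λ { (τs , vs , rest , eq′ , len , sub′ , ds , nds , sup₂) → τ ∷ τs , us ++ vs , rest ,
        ↭-trans eq (↭-trans (++⁺ˡ us eq′) (↭-reflexive (sym (Lₚ.++-assoc us vs rest)))) , cong suc len ,
        (λ { (skip s) → SubSum-++ʳ us (sub′ s) ; (keep s) → SubSum-++ sub (sub′ s) }) , d ∷ ds , nd ∷ nds , sup₂ } }

    -- The n super-elements reserved for the modulus ρ c have n + 1 sub-sums distinct modulo ρ c by
    -- `growth`. Reserved elements are disjoint for different c, so the options can be combined
    -- freely.
    options : ∀ n {k S} (J : Fin k → Fin N) (ρ : Fin k → ℕ) → (∀ c {b} → ¬ π (J c) ^ suc (u (J c)) ∣ b → ¬ ρ c ∣ p * b) →
      (∀ c → ∃₂ λ r e → Prime r × ρ c ≡ r ^ e × n < r) → Supply S (k * (n * (3 * p))) →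
      ∃ λ (o : Fin k → Fin (suc n) → ℕ) → (∀ c i j → o c i ≡ o c j mod ρ c → i ≡ j) ×
        (∀ (t : Fin k → Fin (suc n)) → SubSum S (sum (λ c → o c (t c))) × p ^ suc (u i₀) ∣ sum (λ c → o c (t c)))
    options n {zero} J ρ ρ∤ pp sup = (λ ()) , (λ ()) , λ t → SubSum-0 _ , _ ∣0
    options n {suc k} {S} J ρ ρ∤ pp sup = case superElements {S} {ρ fzero} (J fzero) n (k * (n * (3 * p))) (ρ∤ fzero) sup of
      λ { (τs , us , rest , eq , refl , sub , ds , nds , sup₁) →
        addOption J ρ τs us rest eq sub ds nds (pp fzero)
          (options (length τs) {k} {rest} (J ∘ fsuc) (ρ ∘ fsuc) (λ c → ρ∤ (fsuc c)) (λ c → pp (fsuc c)) sup₁) }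
      where
      addOption : ∀ (J : Fin (suc k) → Fin N) (ρ : Fin (suc k) → ℕ) τs us rest → S ↭ us ++ rest → (∀ {s} → SubSum τs s → SubSum us s) →
        All (p ^ suc (u i₀) ∣_) τs → All (λ τ → ¬ ρ fzero ∣ τ) τs → (∃₂ λ r e → Prime r × ρ fzero ≡ r ^ e × length τs < r) →
        (∃ λ (o : Fin k → Fin (suc (length τs)) → ℕ) → (∀ c i j → o c i ≡ o c j mod ρ (fsuc c) → i ≡ j) ×
          (∀ (t : Fin k → Fin (suc (length τs))) → SubSum rest (sum (λ c → o c (t c))) × p ^ suc (u i₀) ∣ sum (λ c → o c (t c)))) →
        ∃ λ (o : Fin (suc k) → Fin (suc (length τs)) → ℕ) → (∀ c i j → o c i ≡ o c j mod ρ c → i ≡ j) ×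
          (∀ (t : Fin (suc k) → Fin (suc (length τs))) → SubSum S (sum (λ c → o c (t c))) × p ^ suc (u i₀) ∣ sum (λ c → o c (t c)))
      addOption J ρ τs us rest eq sub ds nds (r , e , prr , ρ≡ , n<r) (o , inj , good) =
        o′ , inj′ , λ t → SubSum-↭ (↭-sym eq) (SubSum-++ (sub (proj₁ (proj₂ fam) (t fzero))) (proj₁ (good (λ c → t (fsuc c))))) ,
          ∣m∣n⇒∣m+n (SubSum-∣ ds (proj₁ (proj₂ fam) (t fzero))) (proj₂ (good (λ c → t (fsuc c))))
        where
        fam = growth {e = e} prr τs (subst (λ m → All (λ τ → ¬ m ∣ τ) τs) ρ≡ nds) n<r
        o′ : Fin (suc k) → Fin (suc (length τs)) → ℕ
        o′ fzero = proj₁ fam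
        o′ (fsuc c) = o c
        inj′ : ∀ c i j → o′ c i ≡ o′ c j mod ρ c → i ≡ j
        inj′ fzero i j h = proj₂ (proj₂ fam) i j (subst (λ m → o′ fzero i ≡ o′ fzero j mod m) ρ≡ h)
        inj′ (fsuc c) = inj c

exactlyDiv⇒val : ∀ {p u x} → 2 ≤ p → 0 < x → ExactlyDiv p u x → val p x ≡ u
exactlyDiv⇒val {p} {u} {x} 2≤p 0<x (d , nd) = ≤-antisym (≮⇒≥ λ lt → nd (≤val⇒∣ p x lt)) (∣⇒≤val 2≤p 0<x d)

exponent∣val : ∀ {b g s p u} → Prime p → s ≡ b ^ g → 0 < g → 0 < s → ExactlyDiv p u s → g ∣ u
exponent∣val {b} {g} {s} {p} {u} pr refl 0<g 0<s ex = divides (val p b) (trans (sym (exactlyDiv⇒val (prime⇒2≤ pr) 0<s ex))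
  (trans (val-^ pr (base>0 b g 0<g 0<s) g) (*-comm g (val p b))))
  where
  base>0 : ∀ b g → 0 < g → 0 < b ^ g → 0 < b
  base>0 zero (suc g) _ ()
  base>0 (suc b) g _ _ = s≤s z≤n

-- Some sub-sum has valuation suc (u i₀) at π i₀ and u (J c) at each π (J c); an exponent of a power divides all of them.
noCommonExponent : ∀ {N} (π : Fin N → ℕ) (π-prime : ∀ i → Prime (π i)) → Injective _≡_ _≡_ π → (u : Fin N → ℕ) →
  ∀ {S k} n i₀ (J : Fin k → Fin N) → (∀ c → J c ≢ i₀) → suc k ≤ n → (∀ i → n < π i) →
  Supply π π-prime u S (suc k * (n * (3 * π i₀))) → (∀ s → SubSum S s → 0 < s → PurePower s) →
  ¬ (∀ g → 2 ≤ g → g ∣ suc (u i₀) → ¬ (∀ c → g ∣ u (J c)))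
noCommonExponent {N} π π-prime π-inj u {S} {k} n i₀ J J≢ k<n n<π sup power none′ =
  case options π π-prime u i₀ n J′ ρ ρ∤ (λ c → π (J′ c) , e c , π-prime (J′ c) , refl , n<π (J′ c)) sup of
    λ { (o , inj , good) → case avoidAll o ρ (s≤s k<n) inj of
    λ { (t , avoid) → contradictory _ (proj₁ (good t)) (proj₂ (good t)) avoid } }
  where
  p = π i₀
  J′ : Fin (suc k) → Fin N
  J′ fzero = i₀
  J′ (fsuc c) = J c
  e : Fin (suc k) → ℕ
  -- One higher than for the other primes: all options are multiples of p^(u i₀ + 1), and avoiding
  -- the next power makes the valuation exactly `suc (u i₀)`.
  e fzero = suc (suc (u i₀))
  e (fsuc c) = suc (u (J c))
  ρ : Fin (suc k) → ℕ
  ρ c = π (J′ c) ^ e c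
  ρ∤ : ∀ c {b} → ¬ π (J′ c) ^ suc (u (J′ c)) ∣ b → ¬ ρ c ∣ p * b
  ρ∤ fzero nd d = nd (*-cancelˡ-∣ p {{prime⇒nonZero (π-prime i₀)}} d)
  ρ∤ (fsuc c) {b} nd d = nd (p^k∣d*s⇒p^k∣d (π-prime (J c)) (λ r∣p → J≢ c (π-inj (distinctPrimes (π-prime (J c)) (π-prime i₀) r∣p)))
    (suc (u (J c))) b (subst (π (J c) ^ suc (u (J c)) ∣_) (*-comm p b) d))
  contradictory : ∀ s → SubSum S s → p ^ suc (u i₀) ∣ s → (∀ c → ¬ ρ c ∣ s) → ⊥
  contradictory s sub d avoid = case power s sub 0<s of
      λ { (b , g , 2≤g , s≡) → none′ g 2≤g
        (exponent∣val (π-prime i₀) s≡ (<-trans (s≤s z≤n) 2≤g) 0<s (d , avoid fzero))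
        (λ c → exponent∣val (π-prime (J c)) s≡ (<-trans (s≤s z≤n) 2≤g) 0<s (SubSum-∣ (Supply.divisible sup (J c)) sub , avoid (fsuc c))) }
    where
    0<s : 0 < s
    0<s = n≢0⇒n>0 λ z → avoid fzero (subst (_ ∣_) (sym z) (_ ∣0))

-- Avoiding a common exponent

coprime-*-∣ : ∀ {a b n} → Coprime a b → a ∣ n → b ∣ n → a * b ∣ n
coprime-*-∣ {a} {b} c (divides q refl) b∣n =
  subst (a * b ∣_) (*-comm a q) (*-monoʳ-∣ a (coprime-divisor (Cop.sym c) (subst (b ∣_) (*-comm q a) b∣n)))

coprime-product : ∀ {a} xs → All (Coprime a) xs → Coprime a (product xs)
coprime-product [] [] (_ , d) = ∣1⇒≡1 d
coprime-product {a} (x ∷ xs) (c ∷ cs) {d} (d∣a , d∣x*P) =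
  coprime-product xs cs (d∣a , coprime-divisor {d} {x} (λ (e∣d , e∣x) → c (∣-trans e∣d d∣a , e∣x)) d∣x*P)

product-∣ : ∀ {n} xs → AllPairs Coprime xs → All (_∣ n) xs → product xs ∣ n
product-∣ [] _ _ = 1∣ _
product-∣ (x ∷ xs) (c ∷ cs) (d ∷ ds) = coprime-*-∣ (coprime-product xs c) d (product-∣ xs cs ds)

allPairs-lookup : ∀ {a ℓ} {A : Set a} {R : A → A → Set ℓ} {xs : List A} → AllPairs R xs →
  ∀ (i j : Fin (length xs)) → toℕ i < toℕ j → R (lookup xs i) (lookup xs j)
allPairs-lookup (r ∷ rs) fzero (fsuc j) _ = All.lookup r (∈-lookup j)
allPairs-lookup (r ∷ rs) (fsuc i) (fsuc j) lt = allPairs-lookup rs i j (s≤s⁻¹ lt)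

unique-bounded : ∀ {B} (xs : List ℕ) → AllPairs _≢_ xs → All (_< B) xs → length xs ≤ B
unique-bounded {B} xs un bd = ≮⇒≥ λ lt → collide (pigeonhole lt (λ i → fromℕ< (at i)))
  where
  at : ∀ i → lookup xs i < B
  at i = All.lookup bd (∈-lookup i)
  collide : (∃₂ λ i j → toℕ i < toℕ j × fromℕ< (at i) ≡ fromℕ< (at j)) → ⊥
  collide (i , j , i<j , eq) = allPairs-lookup un i j i<j (trans (sym (toℕ-fromℕ< (at i))) (trans (cong toℕ eq) (toℕ-fromℕ< (at j))))

-- Factors of size at least B pay for themselves; each of the others is given a factor B. Among
-- distinct numbers the latter are at most B many.
product-large : ∀ {B} → 0 < B → (small? : Decidable (_< B)) → ∀ xs → All (0 <_) xs →
  B ^ length xs ≤ B ^ length (filter small? xs) * product xs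
product-large 0<B small? [] [] = ≤-refl
product-large {B} 0<B small? (x ∷ xs) (0<x ∷ pos) with small? x
... | yes _ = begin
  B * B ^ length xs ≤⟨ *-monoʳ-≤ B (product-large 0<B small? xs pos) ⟩
  B * (B ^ f * product xs) ≡⟨ sym (*-assoc B (B ^ f) _) ⟩
  B ^ suc f * product xs ≤⟨ *-monoʳ-≤ (B ^ suc f) (≤-trans (≤-reflexive (sym (*-identityˡ _))) (*-monoˡ-≤ (product xs) 0<x)) ⟩
  B ^ suc f * (x * product xs) ∎
  where
  open ≤-Reasoning
  f = length (filter small? xs)
... | no x≮B = begin
  B * B ^ length xs ≤⟨ *-mono-≤ (≮⇒≥ x≮B) (product-large 0<B small? xs pos) ⟩
  x * (B ^ f * product xs) ≡⟨ shuffle x (B ^ f) (product xs) ⟩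
  B ^ f * (x * product xs) ∎
  where
  open ≤-Reasoning
  f = length (filter small? xs)
  shuffle : ∀ a b c → a * (b * c) ≡ b * (a * c)
  shuffle = solve-∀

product-distinct : ∀ {B} → 0 < B → ∀ xs → AllPairs _≢_ xs → All (0 <_) xs → B ^ length xs ≤ B ^ B * product xs
product-distinct {B} 0<B xs un pos = ≤-trans (product-large 0<B (_<? B) xs pos) (*-monoˡ-≤ (product xs)
  (^-monoʳ-≤ B {{>-nonZero 0<B}} (unique-bounded (filter (_<? B) xs) (AllPairsP.filter⁺ (_<? B) un) (AllP.all-filter (_<? B) xs))))

module _ {N : ℕ} where
  without : List (Fin N) → List (Fin N)
  without [] = tabulate id
  without (a ∷ A) = filter (λ i → ¬? (i ≟F a)) (without A)

  without-unique : ∀ A → AllPairs _≢_ (without A)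
  without-unique [] = AllPairsP.tabulate⁺ (λ ne → ne)
  without-unique (a ∷ A) = AllPairsP.filter⁺ _ (without-unique A)

  without-∉ : ∀ A → All (λ i → All (i ≢_) A) (without A)
  without-∉ [] = All.universal (λ _ → []) _
  without-∉ (a ∷ A) = All.zipWith (λ (ne , al) → ne ∷ al)
    (AllP.all-filter (λ i → ¬? (i ≟F a)) (without A) , AllP.filter⁺ (λ i → ¬? (i ≟F a)) (without-∉ A))

  removeOne : ∀ (a : Fin N) xs → AllPairs _≢_ xs → length xs ≤ suc (length (filter (λ i → ¬? (i ≟F a)) xs))
  removeOne a [] _ = z≤n
  removeOne a (x ∷ xs) (ne ∷ un) with x ≟F a
  ... | yes refl = s≤s (≤-reflexive (cong length (sym (Lₚ.filter-all (λ i → ¬? (i ≟F x)) (All.map (λ ne eq → ne (sym eq)) ne)))))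
  ... | no _ = s≤s (removeOne a xs un)

  without-length : ∀ A → N ≤ length (without A) + length A
  without-length [] = ≤-reflexive (sym (trans (+-identityʳ _) (length-tabulate id)))
  without-length (a ∷ A) = ≤-trans (without-length A) (≤-trans (+-monoˡ-≤ (length A) (removeOne a (without A) (without-unique A)))
    (≤-reflexive (sym (+-suc _ (length A)))))

-- Few of the numbers u suffice to make suc (u i₀) coprime to their gcd: first lower the gcd by factors 2^x for as long
-- as possible; then for each i only a factor below 2^x is shared with suc (u i), and it is removed by halving.
module Selection {N : ℕ} (u : Fin N → ℕ) (u>0 : ∀ i → 0 < u i) (x t : ℕ) (u< : ∀ i → u i < 2 ^ (x * t))
  {B : ℕ} (0<B : 0 < B) (many : B ^ B * 2 ^ (x * t) ≤ B ^ (N ∸ suc t)) (r₀ : Fin N) where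

  private
    G : List (Fin N) → ℕ
    G [] = 0
    G (i ∷ A) = gcd (u i) (G A)

    G∣ : ∀ {A i} → i ∈ A → G A ∣ u i
    G∣ {j ∷ A} (here refl) = gcd[m,n]∣m (u j) (G A)
    G∣ {j ∷ A} (there i∈A) = ∣-trans (gcd[m,n]∣n (u j) (G A)) (G∣ i∈A)

    ∣G : ∀ {g} A → (∀ c → g ∣ u (lookup A c)) → g ∣ G A
    ∣G {g} [] h = g ∣0
    ∣G (i ∷ A) h = gcd-greatest (h fzero) (∣G A (h ∘ fsuc))

    ∣⇒>0 : ∀ {m n} → m ∣ n → 0 < n → 0 < m
    ∣⇒>0 {zero} d 0<n = ⊥-elim (<⇒≢ 0<n (sym (0∣⇒≡0 d)))
    ∣⇒>0 {suc m} d 0<n = s≤s z≤n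

    greedy : ∀ s A → r₀ ∈ A → G A < 2 ^ (x * s) →
      ∃ λ A′ → length A′ ≤ length A + s × r₀ ∈ A′ × (∀ i → G A′ < 2 ^ x * gcd (u i) (G A′))
    greedy s A r₀∈A lt with any? (λ i → 2 ^ x * gcd (u i) (G A) ≤? G A)
    ... | no nh = A , m≤m+n _ s , r₀∈A , λ i → ≰⇒> (λ le → nh (i , le))
    greedy zero A r₀∈A lt | yes (i , le) = ⊥-elim (<⇒≱ (subst (G A <_) (cong (2 ^_) (*-zeroʳ x)) lt) (∣⇒>0 (G∣ r₀∈A) (u>0 r₀)))
    greedy (suc s) A r₀∈A lt | yes (i , le) with greedy s (i ∷ A) (there r₀∈A)
      (*-cancelˡ-< (2 ^ x) _ _ (≤-<-trans le (<-≤-trans lt (≤-reflexive (trans (cong (2 ^_) (*-suc x s)) (^-distribˡ-+-* 2 x (x * s)))))))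
    ... | A′ , len , r , stop = A′ , ≤-trans len (≤-reflexive (sym (+-suc (length A) s))) , r , stop

    -- Such a g makes i hopeless: it survives in the gcd however many indices other than i are
    -- added.
    Bad : Fin N → ℕ → Set
    Bad i g = 2 ≤ g × g ∣ suc (u i) × (∀ r → r ≢ i → g ∣ u r)

    bad? : ∀ i → Dec (∃ λ (g : Fin (2 + u i)) → Bad i (toℕ g))
    bad? i = any? λ g → (2 ≤? toℕ g) ×-dec ((toℕ g ∣? suc (u i)) ×-dec all? (λ r → imp (r ≟F i) (toℕ g ∣? u r)))
      where
      imp : ∀ {P Q : Set} → Dec P → Dec Q → Dec (¬ P → Q)
      imp (yes p) _ = yes (λ np → ⊥-elim (np p))
      imp (no np) (yes q) = yes (λ _ → q)
      imp (no np) (no nq) = no (λ f → nq (f np))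

    good : ∀ i → ¬ (∃ λ (g : Fin (2 + u i)) → Bad i (toℕ g)) → ∀ {g} → ¬ Bad i g
    good i nb {g} b@(_ , g∣ , _) = nb (fromℕ< g< , subst (Bad i) (sym (toℕ-fromℕ< g<)) b)
      where
      g< : g < 2 + u i
      g< = s≤s (∣⇒≤ g∣)

    halve : ∀ {i} → (∀ {g} → ¬ Bad i g) → ∀ s A → All (_≢ i) A → gcd (suc (u i)) (G A) < 2 ^ s →
      ∃ λ A′ → length A′ ≤ length A + s × All (_≢ i) A′ × gcd (suc (u i)) (G A′) ≡ 1
    halve {i} nb s A A≢ lt with gcd (suc (u i)) (G A) in geq
    ... | zero = ⊥-elim (<⇒≢ (∣⇒>0 (subst (_∣ suc (u i)) geq (gcd[m,n]∣m (suc (u i)) (G A))) (s≤s z≤n)) refl)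
    ... | suc zero = A , m≤m+n _ s , A≢ , geq
    halve {i} nb zero A A≢ (s≤s ()) | suc (suc g′)
    halve {i} nb (suc s) A A≢ lt | g@(suc (suc g′))
      with any? (λ r → ¬? (r ≟F i) ×-dec ¬? (g ∣? u r))
    ... | no nh = ⊥-elim (nb {g} (s≤s (s≤s z≤n) , subst (_∣ suc (u i)) geq (gcd[m,n]∣m (suc (u i)) (G A)) ,
        λ r r≢i → decidable-stable (g ∣? u r) (λ nd → nh (r , r≢i , nd))))
    ... | yes (r , r≢i , nd) with halve nb s (r ∷ A) (r≢i ∷ A≢) (*-cancelˡ-< 2 _ _ (≤-<-trans (properDivisor h∣g h≢g) lt))
      where
      h = gcd (suc (u i)) (gcd (u r) (G A))
      h∣g : h ∣ g
      h∣g = subst (h ∣_) geq (gcd-greatest (gcd[m,n]∣m (suc (u i)) (gcd (u r) (G A))) (∣-trans (gcd[m,n]∣n (suc (u i)) (gcd (u r) (G A))) (gcd[m,n]∣n (u r) (G A))))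
      h≢g : h ≢ g
      h≢g eq = nd (subst (_∣ u r) eq (∣-trans (gcd[m,n]∣n (suc (u i)) (gcd (u r) (G A))) (gcd[m,n]∣m (u r) (G A))))
      properDivisor : ∀ {h g} → h ∣ suc g → h ≢ suc g → 2 * h ≤ suc g
      properDivisor {h} (divides (suc zero) eq) ne = ⊥-elim (ne (sym (trans eq (+-identityʳ h))))
      properDivisor {h} (divides (suc (suc q)) eq) ne = ≤-trans (*-monoˡ-≤ h {2} {suc (suc q)} (s≤s (s≤s z≤n))) (≤-reflexive (sym eq))
    ... | A′ , len , A′≢ , done = A′ , ≤-trans len (≤-reflexive (sym (+-suc (length A) s))) , A′≢ , done

    consecutive : ∀ n → Coprime (suc n) n
    consecutive n {d} (d₁ , d₂) = ∣1⇒≡1 (∣m+n∣m⇒∣n (subst (d ∣_) (+-comm 1 n) d₁) d₂)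

    -- The witnesses g i are pairwise coprime divisors of u r₀, too many of them to fit.
    notAllBad : ∀ A → length A ≤ suc t → r₀ ∈ A → (∀ i → All (i ≢_) A → ∃ (Bad i)) → ⊥
    notAllBad A len r₀∈A allBad = <⇒≱ small (≤-trans many (≤-trans (^-monoʳ-≤ B {{>-nonZero 0<B}} count≤) (product-distinct 0<B gs distinct positive)))
      where
      W = without A
      g : Fin N → ℕ
      g i with All.all? (λ a → ¬? (i ≟F a)) A
      ... | yes i∉A = proj₁ (allBad i i∉A)
      ... | no _ = 2
      g-bad : ∀ i → All (i ≢_) A → Bad i (g i)
      g-bad i i∉A with All.all? (λ a → ¬? (i ≟F a)) A
      ... | yes h = proj₂ (allBad i h)
      ... | no nh = ⊥-elim (nh i∉A)
      gs = map g W
      bads : All (λ i → Bad i (g i)) W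
      bads = All.map (λ {i} → g-bad i) (without-∉ A)
      coprime₂ : ∀ {i j} → Bad i (g i) → Bad j (g j) → i ≢ j → Coprime (g i) (g j)
      coprime₂ {i} {j} (_ , d , _) (_ , _ , o) ne (e₁ , e₂) = consecutive (u i) (∣-trans e₁ d , ∣-trans e₂ (o i ne))
      pairs : ∀ {W} → All (λ i → Bad i (g i)) W → AllPairs _≢_ W → AllPairs Coprime (map g W)
      pairs [] [] = []
      pairs (b ∷ bs) (n ∷ ns) = AllP.map⁺ (All.zipWith (λ (b′ , ne) {d} → coprime₂ b b′ ne {d}) (bs , n)) ∷ pairs bs ns
      coprimes : AllPairs Coprime gs
      coprimes = pairs bads (without-unique A)
      big : All (2 ≤_) gs
      big = AllP.map⁺ (All.map proj₁ bads)
      positive : All (0 <_) gs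
      positive = All.map (<-trans (s≤s z≤n)) big
      ne-of : ∀ {xs} → All (2 ≤_) xs → AllPairs Coprime xs → AllPairs _≢_ xs
      ne-of [] [] = []
      ne-of (b ∷ bs) (c ∷ cs) = All.map (λ { cop refl → <⇒≢ b (sym (cop (∣-refl , ∣-refl))) }) c ∷ ne-of bs cs
      distinct : AllPairs _≢_ gs
      distinct = ne-of big coprimes
      dividesAll : All (_∣ u r₀) gs
      dividesAll = AllP.map⁺ (All.zipWith (λ { {i} ((_ , _ , o) , i∉A) → o r₀ (λ eq → All.lookup i∉A r₀∈A (sym eq)) }) (bads , without-∉ A))
      small : B ^ B * product gs < B ^ B * 2 ^ (x * t)
      small = *-monoʳ-< (B ^ B) {{>-nonZero (^>0 B 0<B)}} (≤-<-trans (∣⇒≤′ (u>0 r₀) (product-∣ gs coprimes dividesAll)) (u< r₀))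
      count≤ : N ∸ suc t ≤ length gs
      count≤ = ≤-trans (m≤n+o⇒m∸n≤o N (suc t) (≤-trans (without-length A) (≤-trans (+-monoʳ-≤ (length W) len) (≤-reflexive (+-comm (length W) (suc t))))))
        (≤-reflexive (sym (length-map g W)))

  select : ∃₂ λ i A → All (_≢ i) A × length A ≤ suc t + x × (∀ g → 2 ≤ g → g ∣ suc (u i) → ¬ (∀ c → g ∣ u (lookup A c)))
  select with greedy t (r₀ ∷ []) (here refl) (subst (_< 2 ^ (x * t)) (sym (∣-antisym (gcd[m,n]∣m (u r₀) 0) (gcd-greatest ∣-refl (u r₀ ∣0)))) (u< r₀))
  ... | A , len , r₀∈A , stop with any? (λ i → All.all? (λ a → ¬? (i ≟F a)) A ×-dec ¬? (bad? i))
  ... | no nh = ⊥-elim (notAllBad A len r₀∈A λ i i∉A → let (g , b) = decidable-stable (bad? i) (λ nb → nh (i , i∉A , nb)) in toℕ g , b)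
  ... | yes (i , i∉A , nb) with halve {i} (λ {g} → good i nb {g}) x A (All.map (λ ne eq → ne (sym eq)) i∉A) g<
    where
    g = gcd (suc (u i)) (G A)
    c = gcd (u i) (G A)
    g< : g < 2 ^ x
    -- As u i and `suc (u i)` are coprime, the product of their gcds with G A divides G A, which is
    -- below 2^x times the first of them because the greedy choice has stopped.
    g< = *-cancelʳ-< c g (2 ^ x) (≤-<-trans (∣⇒≤′ (∣⇒>0′ (G∣ r₀∈A)) (coprime-*-∣ (λ (d₁ , d₂) → consecutive (u i)
        (∣-trans d₁ (gcd[m,n]∣m (suc (u i)) (G A)) , ∣-trans d₂ (gcd[m,n]∣m (u i) (G A)))) (gcd[m,n]∣n (suc (u i)) (G A)) (gcd[m,n]∣n (u i) (G A)))) (stop i))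
      where
      ∣⇒>0′ : G A ∣ u r₀ → 0 < G A
      ∣⇒>0′ d = ∣⇒>0 d (u>0 r₀)
  ... | A′ , len′ , A′≢ , one = i , A′ , A′≢ , ≤-trans len′ (+-monoˡ-≤ x len) ,
      λ g 2≤g g∣ h → <⇒≢ 2≤g (sym (∣1⇒≡1 (subst (g ∣_) one (gcd-greatest g∣ (∣G A′ h)))))

-- Few distinct sub-sums

Distinct : List ℕ → ℕ → Set
Distinct S K = ∃ λ (f : Fin K → ℕ) → Injective _≡_ _≡_ f × (∀ i → SubSum S (f i) × 0 < f i)

Distinct-≤ : ∀ {S K L} → K ≤ L → Distinct S L → Distinct S K
Distinct-≤ le (f , inj , sub) = (λ i → f (inject≤ i le)) , (λ eq → inject≤-injective le le _ _ (inj eq)) , λ i → sub (inject≤ i le)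

Distinct-↭ : ∀ {S T K} → S ↭ T → Distinct S K → Distinct T K
Distinct-↭ eq (f , inj , sub) = f , inj , λ i → SubSum-↭ eq (proj₁ (sub i)) , proj₂ (sub i)

Distinct-1 : ∀ {x S} → 0 < x → Distinct (x ∷ S) 1
Distinct-1 {x} {S} 0<x = (λ _ → x + 0) , (λ { {fzero} {fzero} _ → refl }) , λ _ → keep (SubSum-0 S) , ≤-trans 0<x (m≤m+n x 0)

-- As with digits: the residue modulo ρ of a combined sum determines the part from xs, and
-- cancellation then the part from ys.
Distinct-* : ∀ {ρ xs ys K L} (g : Fin K → ℕ) → (∀ i → SubSum xs (g i)) → (∀ i j → g i ≡ g j mod ρ → i ≡ j) →
  All (ρ ∣_) ys → Distinct ys L → Distinct (xs ++ ys) (K * L)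
Distinct-* {ρ} {xs} {ys} {K} {L} g g-sub g-inj ds (h , h-inj , h-sub) = f , f-inj , f-sub
  where
  f : Fin (K * L) → ℕ
  f i = g (proj₁ (remQuot {K} L i)) + h (proj₂ (remQuot {K} L i))
  f-sub : ∀ i → SubSum (xs ++ ys) (f i) × 0 < f i
  f-sub i = SubSum-++ (g-sub (proj₁ (remQuot {K} L i))) (proj₁ (h-sub (proj₂ (remQuot {K} L i)))) ,
    ≤-trans (proj₂ (h-sub (proj₂ (remQuot {K} L i)))) (m≤n+m (h (proj₂ (remQuot {K} L i))) (g (proj₁ (remQuot {K} L i))))
  h∣ : ∀ j → ρ ∣ h j
  h∣ j = SubSum-∣ ds (proj₁ (h-sub j))
  core : ∀ a b a′ b′ → g a + h b ≡ g a′ + h b′ → combine a b ≡ combine a′ b′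
  core a b a′ b′ eq with g-inj a a′ (mod-trans (mod-trans (mod-reflexive (sym (+-identityʳ (g a))))
      (mod-trans (mod-+ (mod-refl {a = g a}) (mod-sym (∣⇒mod0 (h∣ b)))) (mod-trans (mod-reflexive eq) (mod-+ (mod-refl {a = g a′}) (∣⇒mod0 (h∣ b′))))))
      (mod-reflexive (+-identityʳ (g a′))))
  ... | refl = cong (combine a) (h-inj (+-cancelˡ-≡ (g a) (h b) (h b′) eq))
  f-inj : Injective _≡_ _≡_ f
  f-inj {i} {j} eq = trans (sym (combine-remQuot {K} L i)) (trans (core (proj₁ (remQuot {K} L i)) (proj₂ (remQuot {K} L i)) (proj₁ (remQuot {K} L j)) (proj₂ (remQuot {K} L j)) eq) (combine-remQuot {K} L j))

minVal : ∀ {p} → 2 ≤ p → ∀ x S → All (0 <_) (x ∷ S) → ∃ λ u → All (p ^ u ∣_) (x ∷ S) × 1 ≤ count (λ y → ¬? (p ^ suc u ∣? y)) (x ∷ S)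
minVal {p} 2≤p x [] (0<x ∷ []) = val p x , ≤val⇒∣ p x ≤-refl ∷ [] ,
  ≤-trans (≤-reflexive (sym (ind-yes (¬? (p ^ suc (val p x) ∣? x)) λ d → <-irrefl refl (∣⇒≤val 2≤p 0<x d)))) (m≤m+n _ 0)
minVal {p} 2≤p x (y ∷ S) (0<x ∷ pos) with minVal 2≤p y S pos
... | u , ds , c with p ^ u ∣? x
... | yes d = u , d ∷ ds , ≤-trans c (m≤n+m _ (ind (¬? (p ^ suc u ∣? x))))
... | no nd = val p x , ≤val⇒∣ p x ≤-refl ∷ All.map (∣-trans (m≤n⇒p^m∣p^n p v≤u)) ds ,
      ≤-trans (≤-reflexive (sym (ind-yes (¬? (p ^ suc (val p x) ∣? x)) λ d → <-irrefl refl (∣⇒≤val 2≤p 0<x d)))) (m≤m+n _ _)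
  where
  v≤u : val p x ≤ u
  v≤u = <⇒≤ (≰⇒> λ u≤v → nd (≤val⇒∣ p x u≤v))

count-0 : ∀ {P : ℕ → Set} (P? : ∀ x → Dec (P x)) xs → count P? xs ≡ 0 → All (λ x → ¬ P x) xs
count-0 P? [] _ = []
count-0 P? (x ∷ xs) eq with P? x
... | no np = np ∷ count-0 P? xs eq

count-all : ∀ {P : ℕ → Set} (P? : ∀ x → Dec (P x)) {xs} → All P xs → count P? xs ≡ length xs
count-all P? [] = refl
count-all P? {x ∷ _} (p ∷ ps) = cong₂ _+_ (ind-yes (P? x) p) (count-all P? ps)

splitUnits : ∀ ρ S → ∃₂ λ us rest → S ↭ us ++ rest × length us ≡ count (λ y → ¬? (ρ ∣? y)) S ×
  All (λ y → ¬ ρ ∣ y) us × All (ρ ∣_) rest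
splitUnits ρ S with extract (λ y → ¬? (ρ ∣? y)) (count (λ y → ¬? (ρ ∣? y)) S) S ≤-refl
... | us , rest , eq , len , units = us , rest , eq , len , units ,
    All.map (λ {y} nn → decidable-stable (ρ ∣? y) nn) (count-0 U? rest (+-cancelˡ-≡ (length us) _ _
      (trans (cong (_+ count U? rest) (sym (count-all U? units))) (trans (sym (count-++ U? us rest)) (trans (sym (count-↭ U? eq)) (trans (sym len) (sym (+-identityʳ _))))))))
  where
  U? : ∀ y → Dec (¬ ρ ∣ y)
  U? y = ¬? (ρ ∣? y)

module Elimination {N : ℕ} (π : Fin N → ℕ) (π-prime : ∀ i → Prime (π i)) (l m μ : ℕ) (0<l : 0 < l)
  (m≤μl : m ≤ μ * l) (2^l≤μ : 2 ^ l ≤ μ) (2^l≤π : ∀ i → 2 ^ l ≤ π i) where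

  Rich : List ℕ → Set
  Rich S = ∃ λ (u : Fin N → ℕ) → Supply π π-prime u S m

  Outcome : List ℕ → ℕ → Set
  Outcome S t = (∃₂ λ S′ T → S ↭ S′ ++ T × Rich S′) ⊎ Distinct S (2 ^ t)

  private
    lastElement : ∀ {S} → 0 < length S → All (0 <_) S → Distinct S 1
    lastElement {x ∷ S} _ (0<x ∷ _) = Distinct-1 0<x

    prefixGrowth : ∀ i e k us → All (λ y → ¬ π i ^ e ∣ y) us → k ≤ length us → suc k ≤ π i →
      ∃ λ (g : Fin (suc k) → ℕ) → (∀ j → SubSum us (g j)) × (∀ j j′ → g j ≡ g j′ mod π i ^ e → j ≡ j′)
    prefixGrowth i e k us units k≤ k<π = subst Growth len (proj₁ g , sub , proj₂ (proj₂ g))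
      where
      Growth : ℕ → Set
      Growth k = ∃ λ (g : Fin (suc k) → ℕ) → (∀ j → SubSum us (g j)) × (∀ j j′ → g j ≡ g j′ mod π i ^ e → j ≡ j′)
      len : length (take k us) ≡ k
      len = trans (length-take k us) (m≤n⇒m⊓n≡m k≤)
      g = growth {e = e} (π-prime i) (take k us) (AllP.take⁺ k units) (≤-trans (≤-reflexive (cong suc len)) k<π)
      sub : ∀ j → SubSum us (proj₁ g j)
      sub j = subst (λ z → SubSum z (proj₁ g j)) (take++drop≡id k us) (SubSum-++ˡ (drop k us) (proj₁ (proj₂ g) j))

    -- us are the elements of least valuation at π i.
    remove : ∀ i e us rest t → All (λ y → ¬ π i ^ e ∣ y) us → All (π i ^ e ∣_) rest → All (0 <_) rest →
      1 ≤ length us → length us < m → suc t * μ + m < length us + length rest →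
      (∀ {t′} → t′ < suc t → t′ * μ + m < length rest → Outcome rest t′) →
      (∃₂ λ S′ T → rest ↭ S′ ++ T × Rich S′) ⊎ Distinct (us ++ rest) (2 ^ suc t)
    remove i e us rest t units ds pos 1≤c c<m long rec = byCase (2 ^ l ≤? suc (length us)) (suc t ≤? l)
      where
      join : ∀ {k L} → suc k ≤ π i → k ≤ length us → Distinct rest L → Distinct (us ++ rest) (suc k * L)
      join k<π k≤ dist = case prefixGrowth i e _ us units k≤ k<π of λ { (g , sub , inj) → Distinct-* g sub inj ds dist }
      rest>0 : 0 < length rest
      rest>0 = +-cancelˡ-< (length us) 0 (length rest) (≤-<-trans (≤-trans (≤-reflexive (+-identityʳ (length us))) (≤-trans (<⇒≤ c<m) (m≤n+m m (suc t * μ)))) long)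
      suc-k : suc (2 ^ l ∸ 1) ≡ 2 ^ l
      suc-k = m+[n∸m]≡n (^>0 l (s≤s z≤n))
      joinBig : ∀ {L} → 2 ^ l ≤ suc (length us) → Distinct rest L → Distinct (us ++ rest) (2 ^ l * L)
      joinBig {L} big dist = subst (λ n → Distinct (us ++ rest) (n * L)) suc-k
        (join (≤-trans (≤-reflexive suc-k) (2^l≤π i)) (s≤s⁻¹ (≤-trans (≤-reflexive suc-k) big)) dist)
      shorter : ∀ t′ → length us + (t′ * μ + m) ≤ suc t * μ + m → t′ * μ + m < length rest
      shorter t′ le = +-cancelˡ-< (length us) (t′ * μ + m) (length rest) (≤-<-trans le long)
      byCase : Dec (2 ^ l ≤ suc (length us)) → Dec (suc t ≤ l) → (∃₂ λ S′ T → rest ↭ S′ ++ T × Rich S′) ⊎ Distinct (us ++ rest) (2 ^ suc t)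
      -- At most l doublings are still wanted, so this batch together with a single remaining
      -- element provides them all.
      byCase (yes big) (yes t<l) = inj₂ (Distinct-≤ (≤-trans (^-monoʳ-≤ 2 t<l) (≤-reflexive (sym (*-identityʳ (2 ^ l))))) (joinBig big (lastElement rest>0 pos)))
      byCase (yes big) (no t≮l) = case rec {suc t ∸ l} (∸-monoʳ-< 0<l l≤t) (shorter (suc t ∸ l) fits) of
        λ { (inj₁ r) → inj₁ r ; (inj₂ dist) → inj₂ (Distinct-≤ (≤-reflexive (trans (cong (2 ^_) (sym (m+[n∸m]≡n l≤t))) (^-distribˡ-+-* 2 l (suc t ∸ l)))) (joinBig big dist)) }
        where
        l≤t : l ≤ suc t
        l≤t = <⇒≤ (≰⇒> t≮l)
        fits : length us + ((suc t ∸ l) * μ + m) ≤ suc t * μ + m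
        fits = begin
          length us + ((suc t ∸ l) * μ + m) ≤⟨ +-monoˡ-≤ _ (≤-trans (<⇒≤ c<m) (≤-trans m≤μl (≤-reflexive (*-comm μ l)))) ⟩
          l * μ + ((suc t ∸ l) * μ + m) ≡⟨ trans (sym (+-assoc (l * μ) _ m)) (cong (_+ m) (trans (sym (*-distribʳ-+ μ l (suc t ∸ l))) (cong (_* μ) (m+[n∸m]≡n l≤t)))) ⟩
          suc t * μ + m ∎
          where open ≤-Reasoning
      -- Fewer than 2^l ≤ μ elements are removed here, so charging them to a single doubling is
      -- affordable.
      byCase (no small) _ = case rec {t} ≤-refl (shorter t fits) of
        λ { (inj₁ r) → inj₁ r ; (inj₂ dist) → inj₂ (join (prime⇒2≤ (π-prime i)) 1≤c dist) }
        where
        fits : length us + (t * μ + m) ≤ suc t * μ + m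
        fits = ≤-trans (+-monoˡ-≤ (t * μ + m) (≤-trans (n≤1+n _) (≤-trans (<⇒≤ (≰⇒> small)) 2^l≤μ))) (≤-reflexive (sym (+-assoc μ (t * μ) m)))

  -- The budget is μ elements per doubling: a large batch has fewer than m ≤ μ l elements and gives
  -- l doublings, a small one fewer than μ and gives one. The reserve m keeps the remainder
  -- non-empty. If no prime has a batch below m, the set is `Rich`.
  eliminate : ∀ t S → All (0 <_) S → t * μ + m < length S → Outcome S t
  eliminate = <-rec _ go
    where
    go : ∀ t → (∀ {t′} → t′ < t → ∀ S → All (0 <_) S → t′ * μ + m < length S → Outcome S t′) →
      ∀ S → All (0 <_) S → t * μ + m < length S → Outcome S t
    go zero rec S pos long = inj₂ (lastElement (≤-<-trans z≤n long) pos)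
    go (suc t) rec (x ∷ S) pos long = decide (any? (λ i → count (U? i) (x ∷ S) <? m))
      where
      mv : ∀ i → ∃ λ u → All (π i ^ u ∣_) (x ∷ S) × 1 ≤ count (λ y → ¬? (π i ^ suc u ∣? y)) (x ∷ S)
      mv i = minVal (prime⇒2≤ (π-prime i)) x S pos
      u : Fin N → ℕ
      u i = proj₁ (mv i)
      U? : ∀ i y → Dec (¬ π i ^ suc (u i) ∣ y)
      U? i y = ¬? (π i ^ suc (u i) ∣? y)
      decide : Dec (∃ λ i → count (U? i) (x ∷ S) < m) → Outcome (x ∷ S) (suc t)
      decide (no none′) = inj₁ (x ∷ S , [] , ↭-reflexive (sym (Lₚ.++-identityʳ (x ∷ S))) , u ,
        supply (λ i → proj₁ (proj₂ (mv i))) (λ i → ≮⇒≥ (λ lt → none′ (i , lt))))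
      decide (yes (i , few)) = case splitUnits (π i ^ suc (u i)) (x ∷ S) of λ { (us , rest , eq , len , units , ds) →
        case remove i (suc (u i)) us rest t units ds (AllP.++⁻ʳ us (All-resp-↭ eq pos))
          (≤-trans (proj₂ (proj₂ (mv i))) (≤-reflexive (sym len))) (≤-<-trans (≤-reflexive len) few)
          (<-≤-trans long (≤-reflexive (trans (↭-length eq) (length-++ us))))
          (λ lt → rec lt rest (AllP.++⁻ʳ us (All-resp-↭ eq pos))) of
        λ { (inj₁ (S′ , T , eq′ , rich)) → inj₁ (S′ , T ++ us , ↭-trans eq (↭-trans (++⁺ˡ us eq′) (↭-trans (++-comm us (S′ ++ T)) (↭-reflexive (Lₚ.++-assoc S′ T us)))) , rich)
          ; (inj₂ dist) → inj₂ (Distinct-↭ (↭-sym eq) dist) } }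

-- Chebyshev's lower bound for the number of primes

pascal : ∀ n k → suc n choose suc k ≡ n choose k + n choose suc k
pascal n k = sym (nCk+nC[k+1]≡[n+1]C[k+1] n k)

nC0≡1 : ∀ n → n choose 0 ≡ 1
nC0≡1 zero = refl
nC0≡1 (suc n) = refl

absorption : ∀ n k → suc k * (suc n choose suc k) ≡ suc n * (n choose k)
absorption zero zero = refl
absorption zero (suc k) = trans (cong (suc (suc k) *_) (k>n⇒nCk≡0 {1} {suc (suc k)} (s≤s (s≤s z≤n))))
  (trans (*-zeroʳ (suc (suc k))) (sym (cong (1 *_) (k>n⇒nCk≡0 {0} {suc k} (s≤s z≤n)))))
absorption (suc n) zero = trans (cong (1 *_) (nC1≡n (suc (suc n)))) (*-comm 1 (suc (suc n)))
absorption (suc n) (suc k) = begin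
  suc (suc k) * (suc (suc n) choose suc (suc k)) ≡⟨ cong (suc (suc k) *_) (pascal (suc n) (suc k)) ⟩
  suc (suc k) * (suc n choose suc k + suc n choose suc (suc k)) ≡⟨ expand (suc k) (suc n choose suc k) (suc n choose suc (suc k)) ⟩
  suc n choose suc k + (suc k * (suc n choose suc k) + suc (suc k) * (suc n choose suc (suc k)))
    ≡⟨ cong (suc n choose suc k +_) (cong₂ _+_ (absorption n k) (absorption n (suc k))) ⟩
  suc n choose suc k + (suc n * (n choose k) + suc n * (n choose suc k))
    ≡⟨ cong (suc n choose suc k +_) (trans (sym (*-distribˡ-+ (suc n) (n choose k) (n choose suc k))) (cong (suc n *_) (sym (pascal n k)))) ⟩
  suc (suc n) * (suc n choose suc k) ∎
  where
  open ≡-Reasoning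
  expand : ∀ k a b → (1 + k) * (a + b) ≡ a + (k * a + (1 + k) * b)
  expand = solve-∀

CommonMultiple : ℕ → ℕ → Set
CommonMultiple n L = ∀ j → 0 < j → j ≤ n → j ∣ L

-- Leibniz's harmonic triangle: with A, B, D the entries m C(n,m), m C(n+1,m), (m+1) C(n+1,m+1), 1/D = 1/A − 1/B.
leibniz : ∀ m n L → CommonMultiple (suc n) L → m ≤ n → suc m * (suc n choose suc m) ∣ L
leibniz zero n L cm _ = subst (_∣ L) (sym (trans (cong (1 *_) (nC1≡n (suc n))) (*-identityˡ (suc n)))) (cm (suc n) (s≤s z≤n) ≤-refl)
leibniz (suc m) (suc n) L cm (s≤s m≤n)
  with leibniz m n L (λ j 0<j j≤ → cm j 0<j (≤-trans j≤ (n≤1+n (suc n)))) m≤n | leibniz m (suc n) L cm (≤-trans m≤n (n≤1+n n))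
... | divides a L≡aA | divides b L≡bB = ∣m+n∣m⇒∣n (subst (D ∣_) D*a≡ (m∣m*n a)) (m∣m*n b)
  where
  A B D : ℕ
  A = suc m * (suc n choose suc m)
  B = suc m * (suc (suc n) choose suc m)
  D = suc (suc m) * (suc (suc n) choose suc (suc m))
  k = suc m
  N = suc (suc n)
  c = suc n choose m
  D≡ : D ≡ N * (suc n choose k)
  D≡ = absorption (suc n) k
  B≡ : B ≡ N * c
  B≡ = absorption (suc n) m
  B≡A+ : B ≡ A + k * c
  B≡A+ = trans (cong (k *_) (pascal (suc n) m)) (trans (*-distribˡ-+ k c (suc n choose k)) (+-comm (k * c) A))
  D*a≡ : D * a ≡ D * b + L
  D*a≡ = *-cancelˡ-≡ (D * a) (D * b + L) k (begin
    k * (D * a) ≡⟨ trans (cong (λ t → k * (t * a)) D≡) (eq₁ k N (suc n choose k) a) ⟩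
    N * (a * A) ≡⟨ cong (N *_) (sym L≡aA) ⟩
    N * L ≡⟨ cong (N *_) (trans L≡bB (cong (b *_) B≡A+)) ⟩
    N * (b * (A + k * c)) ≡⟨ eq₂ N b k (suc n choose k) c ⟩
    k * (N * (suc n choose k) * b + b * (N * c)) ≡⟨ cong (k *_) (cong₂ _+_ (cong (_* b) (sym D≡)) (trans (cong (b *_) (sym B≡)) (sym L≡bB))) ⟩
    k * (D * b + L) ∎)
    where
    open ≡-Reasoning
    eq₁ : ∀ k N x a → k * (N * x * a) ≡ N * (a * (k * x))
    eq₁ = solve-∀
    eq₂ : ∀ N b k x c → N * (b * (k * x + k * c)) ≡ k * (N * x * b + b * (N * c))
    eq₂ = solve-∀

C-mono : ∀ n k → n choose k ≤ suc n choose k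
C-mono n zero = ≤-reflexive (trans (nC0≡1 n) (sym (nC0≡1 (suc n))))
C-mono n (suc k) = ≤-trans (m≤n+m (n choose suc k) (n choose k)) (≤-reflexive (sym (pascal n k)))

2^k≤central : ∀ k → 2 ^ k ≤ (k + k) choose k
2^k≤central zero = ≤-refl
2^k≤central (suc k) = begin
  2 ^ suc k ≡⟨ cong (2 ^ k +_) (+-identityʳ (2 ^ k)) ⟩
  2 ^ k + 2 ^ k ≤⟨ +-mono-≤ (≤-trans (2^k≤central k) (C-mono (k + k) k))
       (≤-trans (2^k≤central k) (≤-trans (m≤m+n ((k + k) choose k) ((k + k) choose suc k)) (≤-reflexive (sym (pascal (k + k) k))))) ⟩
  suc (k + k) choose k + suc (k + k) choose suc k ≡⟨ sym (pascal (suc (k + k)) k) ⟩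
  suc (suc (k + k)) choose suc k ≡⟨ cong (_choose suc k) (cong suc (sym (+-suc k k))) ⟩
  (suc k + suc k) choose suc k ∎
  where open ≤-Reasoning

powerBelow : ∀ p n → 2 ≤ p → 0 < n → ∃ λ e → p ^ e ≤ n × n < p ^ suc e
powerBelow p n 2≤p 0<n = search n (n<p^n n 2≤p)
  where
  search : ∀ k → n < p ^ k → ∃ λ e → p ^ e ≤ n × n < p ^ suc e
  search zero lt = ⊥-elim (<⇒≱ lt 0<n)
  search (suc k) lt with p ^ k ≤? n
  ... | yes le = k , le , lt
  ... | no nle = search k (≰⇒> nle)

module _ (n : ℕ) (0<n : 0 < n) where
  private
    exponent : ℕ → ℕ
    exponent p with 2 ≤? p
    ... | yes 2≤p = proj₁ (powerBelow p n 2≤p 0<n)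
    ... | no _ = 0

    exponent≤ : ∀ p → p ^ exponent p ≤ n
    exponent≤ p with 2 ≤? p
    ... | yes 2≤p = proj₁ (proj₂ (powerBelow p n 2≤p 0<n))
    ... | no _ = 0<n

    exponent> : ∀ {p} → 2 ≤ p → n < p ^ suc (exponent p)
    exponent> {p} 2≤p with 2 ≤? p
    ... | yes 2≤p′ = proj₂ (proj₂ (powerBelow p n 2≤p′ 0<n))
    ... | no ¬2≤p = ⊥-elim (¬2≤p 2≤p)

    -- Over all primes up to n this is the least common multiple of 1, ..., n.
    primePowers : List ℕ → ℕ
    primePowers ps = product (map (λ p → p ^ exponent p) ps)

    primePowers≤ : ∀ ps → primePowers ps ≤ n ^ length ps
    primePowers≤ [] = ≤-refl
    primePowers≤ (p ∷ ps) = *-mono-≤ (exponent≤ p) (primePowers≤ ps)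

    primePowers>0 : ∀ {ps} → All Prime ps → 0 < primePowers ps
    primePowers>0 [] = s≤s z≤n
    primePowers>0 {p ∷ _} (pr ∷ prs) = *>0 (^>0 (exponent p) (prime⇒0< pr)) (primePowers>0 prs)

    ∈⇒∣ : ∀ {p ps} → p ∈ ps → p ^ exponent p ∣ primePowers ps
    ∈⇒∣ {p} {_ ∷ ps} (here refl) = m∣m*n (primePowers ps)
    ∈⇒∣ {p} {q ∷ _} (there i) = ∣n⇒∣m*n (q ^ exponent q) (∈⇒∣ i)

  primesUpTo : List ℕ
  primesUpTo = filter prime? (upTo (suc n))

  primesUpTo-prime : All Prime primesUpTo
  primesUpTo-prime = AllP.all-filter prime? (upTo (suc n))

  private
    commonMultiple : CommonMultiple n (primePowers primesUpTo)
    commonMultiple j 0<j j≤n = val-≤⇒∣ j _ 0<j (primePowers>0 primesUpTo-prime) val≤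
      where
      val≤ : ∀ p → Prime p → val p j ≤ val p (primePowers primesUpTo)
      val≤ p pr with val p j in eq
      ... | zero = z≤n
      ... | suc v = ∣⇒≤val (prime⇒2≤ pr) (primePowers>0 primesUpTo-prime) (∣-trans (m≤n⇒p^m∣p^n p v≤e) (∈⇒∣ p∈))
        where
        p^v≤n : p ^ suc v ≤ n
        p^v≤n = ≤-trans (∣⇒≤′ 0<j (≤val⇒∣ p j (≤-reflexive (sym eq)))) j≤n
        p≤n : p ≤ n
        p≤n = ≤-trans (∣⇒≤′ (^>0 (suc v) (prime⇒0< pr)) (m∣m*n (p ^ v))) p^v≤n
        p∈ : p ∈ primesUpTo
        p∈ = ∈-filter⁺ prime? (∈-upTo⁺ (s≤s p≤n)) pr
        v≤e : suc v ≤ exponent p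
        v≤e = ≮⇒≥ λ e<v → <⇒≱ (exponent> (prime⇒2≤ pr)) (≤-trans (^-monoʳ-≤ p {{prime⇒nonZero pr}} e<v) p^v≤n)

  -- A multiple of the central binomial coefficient divides the least common multiple of 1, ..., n
  -- by `leibniz`, and the latter has one factor at most n for each prime up to n.
  2^k≤n^π : ∀ k → n ≡ suc k + suc k → 2 ^ suc k ≤ n ^ length primesUpTo
  2^k≤n^π k eq = begin
    2 ^ suc k ≤⟨ 2^k≤central (suc k) ⟩
    (suc k + suc k) choose suc k ≤⟨ m≤m+n _ (k * ((suc k + suc k) choose suc k)) ⟩
    suc k * ((suc k + suc k) choose suc k) ≤⟨ ∣⇒≤′ (primePowers>0 primesUpTo-prime)
        (leibniz k (k + suc k) (primePowers primesUpTo) (λ j 0<j j≤ → commonMultiple j 0<j (≤-trans j≤ (≤-reflexive (sym eq)))) (m≤m+n k (suc k))) ⟩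
    primePowers primesUpTo ≤⟨ primePowers≤ primesUpTo ⟩
    n ^ length primesUpTo ∎
    where open ≤-Reasoning

lookup-injective : ∀ {xs : List ℕ} → AllPairs _≢_ xs → Injective _≡_ _≡_ (lookup xs)
lookup-injective un {i} {j} eq with <-cmp (toℕ i) (toℕ j)
... | tri< lt _ _ = ⊥-elim (allPairs-lookup un i j lt eq)
... | tri≈ _ e _ = toℕ-injective e
... | tri> _ _ gt = ⊥-elim (allPairs-lookup un j i gt (sym eq))

partition-length : ∀ {P : ℕ → Set} (P? : Decidable P) xs → length xs ≡ length (filter P? xs) + length (filter (λ x → ¬? (P? x)) xs)
partition-length P? [] = refl
partition-length P? (x ∷ xs) with P? x
... | yes _ = cong suc (partition-length P? xs)
... | no _ = trans (cong suc (partition-length P? xs)) (sym (+-suc _ _))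

-- For n = 2^(y+1) the previous estimate reads 2^(2^y) ≤ 2^((y+1) π(n)), with π(n) the number of
-- primes up to n; compare exponents and give up the at most b + 1 primes not above b.
manyPrimes : ∀ y b → ∃₂ λ N (π : Fin N → ℕ) → Injective _≡_ _≡_ π × (∀ i → Prime (π i)) × (∀ i → b < π i) ×
  (∀ i → π i ≤ 2 ^ suc y) × 2 ^ y ≤ suc y * (N + suc b)
manyPrimes y b = length ps , lookup ps , lookup-injective ps-unique ,
    (λ i → All.lookup (AllP.filter⁺ (b <?_) (primesUpTo-prime n n>0)) (∈-lookup i)) ,
    (λ i → All.lookup (AllP.all-filter (b <?_) all) (∈-lookup i)) ,
    (λ i → All.lookup (AllP.filter⁺ (b <?_) (AllP.filter⁺ prime? {xs = upTo (suc n)} (All.tabulate (λ {x} x∈ → s≤s⁻¹ (∈-upTo⁻ x∈))))) (∈-lookup i)) ,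
    ≤-trans density (*-monoʳ-≤ (suc y) (≤-trans (≤-reflexive (partition-length (b <?_) all)) (+-monoʳ-≤ (length ps) few)))
  where
  n = 2 ^ suc y
  n>0 : 0 < n
  n>0 = ^>0 (suc y) (s≤s z≤n)
  all ps : List ℕ
  all = primesUpTo n n>0
  ps = filter (b <?_) all
  all-unique : AllPairs _≢_ all
  all-unique = AllPairsP.filter⁺ prime? (Uniq.upTo⁺ (suc n))
  ps-unique : AllPairs _≢_ ps
  ps-unique = AllPairsP.filter⁺ (b <?_) all-unique
  few : length (filter (λ x → ¬? (b <? x)) all) ≤ suc b
  few = unique-bounded _ (AllPairsP.filter⁺ (λ x → ¬? (b <? x)) all-unique)
    (All.map (λ nlt → s≤s (≮⇒≥ nlt)) (AllP.all-filter (λ x → ¬? (b <? x)) all))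
  half : suc (2 ^ y ∸ 1) ≡ 2 ^ y
  half = m+[n∸m]≡n (^>0 y (s≤s z≤n))
  density : 2 ^ y ≤ suc y * length all
  density = ≮⇒≥ λ lt → <⇒≱ (^-monoʳ-< 2 ≤-refl lt) (≤-trans (subst (λ k → 2 ^ k ≤ n ^ length all) half
      (2^k≤n^π n n>0 (2 ^ y ∸ 1) (trans (cong (2 ^ y +_) (+-identityʳ (2 ^ y))) (sym (cong₂ _+_ half half)))))
    (≤-reflexive (^-*-assoc 2 (suc y) (length all))))

-- Applying everything to the given numbers: sub-sums and parameters

tabulate-subset : ∀ {d s} (a : Fin d → ℕ) → SubSum (tabulate a) s → ∃ λ (p : Subset d) → subsetSum a p ≡ s
tabulate-subset {zero} a none = [] , refl
tabulate-subset {suc d} a (skip sub) with tabulate-subset (a ∘ fsuc) sub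
... | p , eq = false ∷ p , eq
tabulate-subset {suc d} a (keep sub) with tabulate-subset (a ∘ fsuc) sub
... | p , eq = true ∷ p , cong (a fzero +_) eq

subsetSum>0⇒nonempty : ∀ {d} (a : Fin d → ℕ) (p : Subset d) → 0 < subsetSum a p → Nonempty p
subsetSum>0⇒nonempty {suc d} a (true ∷ p) _ = fzero , here
subsetSum>0⇒nonempty {suc d} a (false ∷ p) lt with subsetSum>0⇒nonempty (a ∘ fsuc) p lt
... | i , i∈p = fsuc i , there i∈p

PowersBelow : List ℕ → ℕ → Set
PowersBelow S M = ∀ s → SubSum S s → 0 < s → PurePower s × s < 2 ^ M

distinctSums⊥ : ∀ {S T M K} → PowersBelow (S ++ T) M → Distinct S K → Distinct T K → 2 * ((M * M * M) * (M * M * M) * suc M) < K → ⊥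
distinctSums⊥ {M = M} powers (f , f-inj , f-sub) (g , g-inj , g-sub) lt = <⇒≱ lt
  (powerSumset≤ {M} f g f-inj g-inj (λ i → proj₂ (f-sub i)) (λ j → proj₂ (g-sub j))
    (λ i j → proj₁ (power i j)) (λ i j → proj₂ (power i j)))
  where
  power : ∀ i j → PurePower (f i + g j) × f i + g j < 2 ^ M
  power i j = powers (f i + g j) (SubSum-++ (proj₁ (f-sub i)) (proj₁ (g-sub j))) (≤-trans (proj₂ (f-sub i)) (m≤m+n (f i) (g j)))

exponent<M : ∀ {p u S M} → Prime p → 0 < length S → All (0 <_) S → All (p ^ u ∣_) S → PowersBelow S M → u < M
exponent<M {p} {u} {x ∷ S} {M} pr _ (0<x ∷ _) (d ∷ _) powers = ≰⇒> λ M≤u → <⇒≱ (proj₂ (powers (x + 0) (keep (SubSum-0 S)) (≤-trans 0<x (m≤m+n x 0))))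
  (≤-trans (^-monoʳ-≤ 2 M≤u) (≤-trans (^-monoˡ-≤ u (prime⇒2≤ pr)) (≤-trans (∣⇒≤′ 0<x d) (m≤m+n x 0))))

-- The coefficient in m = c₀ X⁴, where X² ≤ n.
c₀ : ℕ
c₀ = 2 ^ 3 * 2 ^ 3 * (3 * 2 ^ 8)

-- With n = L2 N all elements lie below 2^M; X ≈ √n, and the primes used lie between 8 X and 2^8 X².
module Parameters (n l : ℕ) (8≤l : 8 ≤ l) (lower : 4 ^ l ≤ n) (upper : n < 4 ^ suc l) where
  M X m μ t : ℕ
  -- This exceeds the floor of log₂ N, hence N < 2^M.
  M = 2 ^ suc n
  X = 2 ^ l
  -- At most 2^(l+3) moduli, 2^(l+3) blocks for each, and 3 p elements per block with p ≤ 2^(2l+8).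
  m = 2 ^ (l + 3) * (2 ^ (l + 3) * (3 * 2 ^ (2 * l + 8)))
  -- The price of one doubling; the summand `suc X` covers the remainder of the division and ensures
  -- 2^l ≤ μ.
  μ = m / l + suc X
    where
    instance
      l≢0 : NonZero l
      l≢0 = >-nonZero (≤-trans (s≤s z≤n) 8≤l)
  -- 2 M⁶ (M + 1) ≤ 4 M⁷ = 2^(7n+9), so 2^t distinct sub-sums are too many.
  t = 7 * n + 10

  private
    instance
      nzl : NonZero l
      nzl = >-nonZero (≤-trans (s≤s z≤n) 8≤l)

  0<l : 0 < l
  0<l = ≤-trans (s≤s z≤n) 8≤l

  0<X : 0 < X
  0<X = ^>0 l (s≤s z≤n)

  4^l≡X*X : 4 ^ l ≡ X * X
  4^l≡X*X = trans (^-*-assoc 2 2 l) (trans (cong (2 ^_) (cong (l +_) (+-identityʳ l))) (^-distribˡ-+-* 2 l l))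

  X*t₁≡ : X * 2 ^ (l + 2) ≡ 4 ^ suc l
  X*t₁≡ = trans (cong (X *_) (^-distribˡ-+-* 2 l 2)) (trans (shuffle X) (cong (4 *_) (sym 4^l≡X*X)))
    where
    shuffle : ∀ x → x * (x * 4) ≡ 4 * (x * x)
    shuffle = solve-∀

  M≤2^ : M ≤ 2 ^ (X * 2 ^ (l + 2))
  M≤2^ = ^-monoʳ-≤ 2 (≤-trans upper (≤-reflexive (sym X*t₁≡)))

  m≤μl : m ≤ μ * l
  m≤μl = begin
    m ≡⟨ m≡m%n+[m/n]*n m l ⟩
    m % l + m / l * l ≤⟨ +-monoˡ-≤ (m / l * l) (<⇒≤ (m%n<n m l)) ⟩
    l + m / l * l ≤⟨ +-monoˡ-≤ (m / l * l) (m≤m+n l (X * l)) ⟩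
    suc X * l + m / l * l ≡⟨ trans (+-comm (suc X * l) (m / l * l)) (sym (*-distribʳ-+ l (m / l) (suc X))) ⟩
    μ * l ∎
    where open ≤-Reasoning

  μl≤ : μ * l ≤ m + (l + X * X)
  μl≤ = begin
    μ * l ≡⟨ *-distribʳ-+ l (m / l) (suc X) ⟩
    m / l * l + suc X * l ≤⟨ +-mono-≤ (m/n*n≤m m l) (+-monoʳ-≤ l (*-monoʳ-≤ X (<⇒≤ (n<2^n l)))) ⟩
    m + (l + X * X) ∎
    where open ≤-Reasoning

  X≤μ : X ≤ μ
  X≤μ = ≤-trans (n≤1+n X) (m≤n+m (suc X) (m / l))

  enoughSums : 2 * ((M * M * M) * (M * M * M) * suc M) < 2 ^ t
  enoughSums = begin-strict
    2 * ((M * M * M) * (M * M * M) * suc M) ≤⟨ *-monoʳ-≤ 2 (*-monoʳ-≤ ((M * M * M) * (M * M * M)) (≤-trans (+-monoˡ-≤ M (^>0 (suc n) (s≤s z≤n))) (≤-reflexive (sym (cong (M +_) (+-identityʳ M)))))) ⟩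
    2 * ((M * M * M) * (M * M * M) * (2 * M)) ≡⟨ shuffle M ⟩
    4 * M ^ 7 ≡⟨ cong (4 *_) (^-*-assoc 2 (suc n) 7) ⟩
    2 ^ 2 * 2 ^ (suc n * 7) ≡⟨ sym (^-distribˡ-+-* 2 2 (suc n * 7)) ⟩
    2 ^ (2 + suc n * 7) <⟨ ^-monoʳ-< 2 ≤-refl (≤-reflexive (exponents n)) ⟩
    2 ^ t ∎
    where
    open ≤-Reasoning
    shuffle : ∀ M → 2 * ((M * M * M) * (M * M * M) * (2 * M)) ≡ 4 * (M * (M * (M * (M * (M * (M * (M * 1)))))))
    shuffle = solve-∀
    exponents : ∀ n → 1 + (2 + (1 + n) * 7) ≡ 7 * n + 10
    exponents = solve-∀

  -- On taking logarithms the requirement of `Selection` becomes l X + 4 X² ≤ l (N - 4 X - 1). So N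
  -- of order n / log n is needed, which the primes up to a multiple of X² provide.
  manyEnough : ∀ N → 2 ^ (2 * l + 7) ≤ suc (2 * l + 7) * (N + suc (2 ^ (l + 3))) →
    X ^ X * 2 ^ (X * 2 ^ (l + 2)) ≤ X ^ (N ∸ suc (2 ^ (l + 2)))
  manyEnough N dense = begin
    X ^ X * 2 ^ (X * 2 ^ (l + 2)) ≡⟨ cong₂ _*_ (^-*-assoc 2 l X) (cong (2 ^_) (trans X*t₁≡ (cong (4 *_) 4^l≡X*X))) ⟩
    2 ^ (l * X) * 2 ^ (4 * (X * X)) ≡⟨ sym (^-distribˡ-+-* 2 (l * X) (4 * (X * X))) ⟩
    2 ^ (l * X + 4 * (X * X)) ≤⟨ ^-monoʳ-≤ 2 exponents ⟩
    2 ^ (l * (N ∸ suc (2 ^ (l + 2)))) ≡⟨ sym (^-*-assoc 2 l (N ∸ suc (2 ^ (l + 2)))) ⟩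
    X ^ (N ∸ suc (2 ^ (l + 2))) ∎
    where
    open ≤-Reasoning
    N′ = N ∸ suc (2 ^ (l + 2))
    l≤X : l ≤ X
    l≤X = <⇒≤ (n<2^n l)
    N≤ : N ≤ N′ + suc (X * 4)
    N≤ = ≤-trans (m≤n+m∸n N (suc (2 ^ (l + 2)))) (≤-reflexive (trans (+-comm (suc (2 ^ (l + 2))) N′) (cong (λ z → N′ + suc z) (^-distribˡ-+-* 2 l 2))))
    2l+8≤3l : suc (2 * l + 7) ≤ 3 * l
    2l+8≤3l = ≤-trans (≤-reflexive (eq l)) (≤-trans (+-monoʳ-≤ (2 * l) 8≤l) (≤-reflexive (eq′ l)))
      where
      eq : ∀ l → 1 + (2 * l + 7) ≡ 2 * l + 8
      eq = solve-∀
      eq′ : ∀ l → 2 * l + l ≡ 3 * l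
      eq′ = solve-∀
    exponents : l * X + 4 * (X * X) ≤ l * N′
    -- The density gives 128 X² on the left. If the claim failed, the right side would be at most 57
    -- X², by l ≤ X and by 2 l + 8 ≤ 3 l, for which l ≥ 8 is used.
    exponents = ≮⇒≥ λ lt → <⇒≱ (*-monoˡ-< (X * X) {{>-nonZero (*>0 0<X 0<X)}} (m<n+m 57 {71} (s≤s z≤n))) (begin
      128 * (X * X) ≡⟨ trans (*-comm 128 (X * X)) (sym (trans (^-distribˡ-+-* 2 (2 * l) 7) (cong (_* 128) (trans (sym (^-*-assoc 2 2 l)) 4^l≡X*X)))) ⟩
      2 ^ (2 * l + 7) ≤⟨ dense ⟩
      suc (2 * l + 7) * (N + suc (2 ^ (l + 3))) ≤⟨ *-mono-≤ 2l+8≤3l (+-mono-≤ N≤ (≤-reflexive (cong suc (^-distribˡ-+-* 2 l 3)))) ⟩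
      3 * l * (N′ + suc (X * 4) + suc (X * 8)) ≡⟨ expand l N′ X ⟩
      3 * (l * N′) + l * (36 * X + 6) ≤⟨ +-monoˡ-≤ (l * (36 * X + 6)) (*-monoʳ-≤ 3 (<⇒≤ lt)) ⟩
      3 * (l * X + 4 * (X * X)) + l * (36 * X + 6) ≡⟨ collect l X ⟩
      12 * (X * X) + (l * X * 39 + l * 6) ≤⟨ +-monoʳ-≤ (12 * (X * X)) (+-mono-≤ (*-monoˡ-≤ 39 (*-monoˡ-≤ X l≤X)) (*-monoˡ-≤ 6 (≤-trans l≤X (≤-trans (≤-reflexive (sym (*-identityʳ X))) (*-monoʳ-≤ X 0<X))))) ⟩
      12 * (X * X) + (X * X * 39 + X * X * 6) ≡⟨ total (X * X) ⟩
      57 * (X * X) ∎)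
      where
      expand : ∀ l N X → 3 * l * (N + (1 + X * 4) + (1 + X * 8)) ≡ 3 * (l * N) + l * (36 * X + 6)
      expand = solve-∀
      collect : ∀ l X → 3 * (l * X + 4 * (X * X)) + l * (36 * X + 6) ≡ 12 * (X * X) + (l * X * 39 + l * 6)
      collect = solve-∀
      total : ∀ Q → 12 * Q + (Q * 39 + Q * 6) ≡ 57 * Q
      total = solve-∀

  module WithPrimes {N : ℕ} (π : Fin N → ℕ) (π-inj : Injective _≡_ _≡_ π) (π-prime : ∀ i → Prime (π i))
    (π> : ∀ i → 2 ^ (l + 3) < π i) (π≤ : ∀ i → π i ≤ 2 ^ (2 * l + 8))
    (many : X ^ X * 2 ^ (X * 2 ^ (l + 2)) ≤ X ^ (N ∸ suc (2 ^ (l + 2)))) where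

    2^l≤π : ∀ i → X ≤ π i
    2^l≤π i = ≤-trans (^-monoʳ-≤ 2 (m≤m+n l 3)) (<⇒≤ (π> i))

    open Elimination π π-prime l m μ 0<l m≤μl X≤μ 2^l≤π public

    selectionSize : suc (suc (2 ^ (l + 2)) + X) ≤ 2 ^ (l + 3)
    selectionSize = begin
      suc (suc (2 ^ (l + 2)) + X) ≡⟨ cong (λ z → suc (suc z) + X) (^-distribˡ-+-* 2 l 2) ⟩
      2 + (X * 4 + X) ≤⟨ +-monoˡ-≤ (X * 4 + X) (≤-trans (≤-reflexive (sym (*-identityˡ 2))) (*-monoˡ-≤ 2 0<X)) ⟩
      X * 2 + (X * 4 + X) ≤⟨ m≤m+n _ X ⟩
      X * 2 + (X * 4 + X) + X ≡⟨ eq X ⟩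
      X * 8 ≡⟨ sym (^-distribˡ-+-* 2 l 3) ⟩
      2 ^ (l + 3) ∎
      where
      open ≤-Reasoning
      eq : ∀ x → x * 2 + (x * 4 + x) + x ≡ x * 8
      eq = solve-∀

    notRich : ∀ {S} → 0 < N → All (0 <_) S → PowersBelow S M → ¬ Rich S
    notRich {S} 0<N pos powers (u , sup) = case any? (λ i → u i ≟ 0) of
        -- If some u i is 0, then `suc (u i)` = 1 has no divisor g ≥ 2, and no further prime has to
        -- be controlled; otherwise all u i are positive, as `Selection` demands.
        λ { (yes (i , ui≡0)) → finish i [] [] (≤-trans (s≤s z≤n) selectionSize)
              (λ g 2≤g g∣ _ → <⇒≢ 2≤g (sym (∣1⇒≡1 (subst (λ z → g ∣ suc z) ui≡0 g∣))))
          ; (no none′) → case Selection.select u (λ i → n≢0⇒n>0 (λ z → none′ (i , z))) X (2 ^ (l + 2)) (λ i → u< i) 0<X many (fromℕ< 0<N) of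
            λ { (i , A , A≢ , len , none″) → finish i A A≢ (≤-trans (s≤s len) selectionSize) none″ } }
      where
      0<m : 0 < m
      0<m = *>0 (^>0 (l + 3) (s≤s z≤n)) (*>0 (^>0 (l + 3) (s≤s z≤n)) (*>0 {3} (s≤s z≤n) (^>0 (2 * l + 8) (s≤s z≤n))))
      nonempty : 0 < length S
      nonempty = ≤-trans 0<m (≤-trans (Supply.enough sup (fromℕ< 0<N)) (count≤length (unit? π π-prime u (fromℕ< 0<N)) S))
      u< : ∀ i → u i < 2 ^ (X * 2 ^ (l + 2))
      u< i = <-≤-trans (exponent<M (π-prime i) nonempty pos (Supply.divisible sup i) powers) M≤2^
      finish : ∀ i A → All (_≢ i) A → suc (length A) ≤ 2 ^ (l + 3) → (∀ g → 2 ≤ g → g ∣ suc (u i) → ¬ (∀ c → g ∣ u (lookup A c))) → ⊥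
      finish i A A≢ size none′ = noCommonExponent π π-prime π-inj u (2 ^ (l + 3)) i (lookup A) (λ c → All.lookup A≢ (∈-lookup c)) size π>
        (Supply-≤ π π-prime u (*-mono-≤ size (*-monoʳ-≤ (2 ^ (l + 3)) (*-monoʳ-≤ 3 (π≤ i)))) sup)
        (λ s sub 0<s → proj₁ (powers s sub 0<s)) none′

    manySums : ∀ {S} → 0 < N → All (0 <_) S → PowersBelow S M → t * μ + m < length S → Distinct S (2 ^ t)
    manySums {S} 0<N pos powers long = case eliminate t S pos long of
      λ { (inj₂ dist) → dist
        ; (inj₁ (S′ , T , eq , rich)) → ⊥-elim (notRich 0<N (AllP.++⁻ˡ S′ (All-resp-↭ eq pos))
            (λ s sub → powers s (SubSum-↭ (↭-sym eq) (SubSum-++ˡ T sub))) rich) }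

    short : ∀ S → 0 < N → All (0 <_) S → PowersBelow S M → length S < 2 * suc (t * μ + m)
    short S 0<N pos powers = ≰⇒> λ long → distinctSums⊥ {M = M} (λ s sub → powers s (subst (λ z → SubSum z s) (take++drop≡id h S) sub))
        (manySums 0<N (AllP.take⁺ h pos) (λ s sub → powers s (subst (λ z → SubSum z s) (take++drop≡id h S) (SubSum-++ˡ (drop h S) sub)))
          (≤-reflexive (sym (trans (length-take h S) (m≤n⇒m⊓n≡m (≤-trans (m≤m+n h (h + 0)) long))))))
        (manySums 0<N (AllP.drop⁺ h pos) (λ s sub → powers s (subst (λ z → SubSum z s) (take++drop≡id h S) (SubSum-++ʳ (take h S) sub)))
          (≤-trans (m+n≤o⇒m≤o∸n h (≤-trans (≤-reflexive (cong (h +_) (sym (+-identityʳ h)))) long)) (≤-reflexive (sym (Lₚ.length-drop h S)))))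
        enoughSums
      where
      h = suc (t * μ + m)

  lengthBound : ∀ S → All (0 <_) S → PowersBelow S M → length S < 2 * suc (t * μ + m)
  lengthBound S pos powers = case manyPrimes (2 * l + 7) (2 ^ (l + 3)) of
    λ { (N , π , π-inj , π-prime , π> , π≤ , dense) →
      WithPrimes.short π π-inj π-prime π> (λ i → ≤-trans (π≤ i) (≤-reflexive (cong (2 ^_) (sym (+-suc (2 * l) 7))))) (manyEnough N dense) S
        (n≢0⇒n>0 (λ { refl → <⇒≱ (impossible) (manyEnough 0 dense) })) pos powers }
    where
    -- For N = 0 the truncated exponent is 0, so `manyEnough` would bound a number above 1 by 1.
    impossible : X ^ (0 ∸ suc (2 ^ (l + 2))) < X ^ X * 2 ^ (X * 2 ^ (l + 2))
    impossible = ≤-trans (≤-reflexive (cong (λ k → suc (X ^ k)) (0∸n≡0 (suc (2 ^ (l + 2))))))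
      (≤-trans (^-monoʳ-≤ 2 {1} (*>0 0<X (^>0 (l + 2) (s≤s z≤n)))) (≤-trans (≤-reflexive (sym (*-identityˡ _))) (*-monoˡ-≤ (2 ^ (X * 2 ^ (l + 2))) (^>0 X 0<X))))

  m≤c₀n² : m ≤ c₀ * (n * n)
  m≤c₀n² = begin
    m ≡⟨ cong₂ (λ a b → a * (a * (3 * b))) (^-distribˡ-+-* 2 l 3) (trans (^-distribˡ-+-* 2 (2 * l) 8) (cong (_* 2 ^ 8) (trans (sym (^-*-assoc 2 2 l)) 4^l≡X*X))) ⟩
    X * 2 ^ 3 * (X * 2 ^ 3 * (3 * (X * X * 2 ^ 8))) ≡⟨ shuffle (2 ^ 3) (2 ^ 8) X ⟩
    c₀ * ((X * X) * (X * X)) ≤⟨ *-monoʳ-≤ c₀ (*-mono-≤ X²≤n X²≤n) ⟩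
    c₀ * (n * n) ∎
    where
    open ≤-Reasoning
    X²≤n : X * X ≤ n
    X²≤n = ≤-trans (≤-reflexive (sym 4^l≡X*X)) lower
    shuffle : ∀ a b X → X * a * (X * a * (3 * (X * X * b))) ≡ a * a * (3 * b) * ((X * X) * (X * X))
    shuffle = solve-∀

-- The length is at most 2 (t μ + m + 1). Multiplication by L3 N ≤ 3 l turns μ into μ l, which is at
-- most (c + 2) n², the 2 coming from l and X²; with t ≤ 17 n the leading term is cubic in n.
powerCube-bound : ∀ c → (∀ n l 8≤l lo up → Parameters.m n l 8≤l lo up ≤ c * (n * n)) →
  ∀ N → 17 ≤ L3 N → ∀ d (a : Fin d → ℕ) → (∀ i → 0 < a i) → HinVN a N → d * L3 N ≤ 6 * (1 + 17 * (c + 2) + c) * L2 N ^ 3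
powerCube-bound c m≤cn² N 17≤L3 d a a>0 hyp = begin
  d * L3 N ≤⟨ *-mono-≤ (<⇒≤ d<) L3≤3l ⟩
  2 * suc (t * μ + m) * (3 * l) ≡⟨ expand t μ m l ⟩
  6 * (l + t * (μ * l) + m * l) ≤⟨ *-monoʳ-≤ 6 (+-mono-≤ (+-mono-≤ l≤nQ (*-mono-≤ t≤17n μl≤Q)) (*-mono-≤ m≤ l≤n)) ⟩
  6 * (n * Q + 17 * n * ((c + 2) * Q) + c * Q * n) ≡⟨ collect c n ⟩
  6 * (1 + 17 * (c + 2) + c) * n ^ 3 ∎
  where
  open ≤-Reasoning
  n l : ℕ
  n = L2 N
  -- Half of log₂ n, so that 2^l is about √n; 17 ≤ L3 N gives l ≥ 8.
  l = ⌊ L3 N /2⌋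
  0<log : ∀ {x} → 0 < ⌊log₂ x ⌋ → 0 < x
  0<log {suc x} _ = s≤s z≤n
  0<n : 0 < n
  0<n = 0<log (≤-trans (s≤s z≤n) 17≤L3)
  L3≤2l+1 : L3 N ≤ suc (l + l)
  L3≤2l+1 = ≤-trans (≤-reflexive (sym (⌊n/2⌋+⌈n/2⌉≡n (L3 N)))) (≤-trans (+-monoʳ-≤ l (⌈n/2⌉≤suc⌊n/2⌋ (L3 N))) (≤-reflexive (+-suc l l)))
    where
    ⌈n/2⌉≤suc⌊n/2⌋ : ∀ k → ⌈ k /2⌉ ≤ suc ⌊ k /2⌋
    ⌈n/2⌉≤suc⌊n/2⌋ zero = z≤n
    ⌈n/2⌉≤suc⌊n/2⌋ (suc zero) = ≤-refl
    ⌈n/2⌉≤suc⌊n/2⌋ (suc (suc k)) = s≤s (⌈n/2⌉≤suc⌊n/2⌋ k)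
  8≤l : 8 ≤ l
  8≤l = ⌊n/2⌋-mono {17} 17≤L3
  double : ∀ k → 4 ^ k ≡ 2 ^ (k + k)
  double k = trans (^-*-assoc 2 2 k) (cong (2 ^_) (cong (k +_) (+-identityʳ k)))
  4^l≤n : 4 ^ l ≤ n
  4^l≤n = begin
    4 ^ l ≡⟨ double l ⟩
    2 ^ (l + l) ≤⟨ ^-monoʳ-≤ 2 (≤-trans (+-monoʳ-≤ l (⌊n/2⌋≤⌈n/2⌉ (L3 N))) (≤-reflexive (⌊n/2⌋+⌈n/2⌉≡n (L3 N)))) ⟩
    2 ^ L3 N ≤⟨ 2^⌊log₂⌋≤ n 0<n ⟩
    n ∎
  n<4^[1+l] : n < 4 ^ suc l
  n<4^[1+l] = <-≤-trans (<2^suc⌊log₂⌋ n) (≤-trans (^-monoʳ-≤ 2 (s≤s L3≤2l+1)) (≤-reflexive (sym (trans (double (suc l)) (cong (λ k → 2 ^ suc k) (+-suc l l))))))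
  open Parameters n l 8≤l 4^l≤n n<4^[1+l]
  S : List ℕ
  S = tabulate a
  powers : PowersBelow S M
  powers s sub 0<s = case tabulate-subset a sub of λ { (p , refl) →
    case hyp p (subsetSum>0⇒nonempty a p 0<s) of λ { (pow , _ , s≤N) → pow , ≤-<-trans s≤N N<2^M } }
    where
    N<2^M : N < 2 ^ M
    N<2^M = <-≤-trans (<2^suc⌊log₂⌋ N) (^-monoʳ-≤ 2 (<2^suc⌊log₂⌋ ⌊log₂ N ⌋))
  d< : d < 2 * suc (t * μ + m)
  d< = subst (_< 2 * suc (t * μ + m)) (length-tabulate a) (lengthBound S (AllP.tabulate⁺ a>0) powers)
  L3≤3l : L3 N ≤ 3 * l
  L3≤3l = ≤-trans L3≤2l+1 (≤-trans (+-monoˡ-≤ (l + l) (≤-trans (s≤s z≤n) 8≤l)) (≤-reflexive (eq l)))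
    where
    eq : ∀ l → l + (l + l) ≡ 3 * l
    eq = solve-∀
  Q : ℕ
  Q = n * n
  m≤ : m ≤ c * Q
  m≤ = m≤cn² n l 8≤l 4^l≤n n<4^[1+l]
  n≤Q : n ≤ Q
  n≤Q = ≤-trans (≤-reflexive (sym (*-identityʳ n))) (*-monoʳ-≤ n 0<n)
  l≤n : l ≤ n
  l≤n = ≤-trans (<⇒≤ (n<p^n {4} l (s≤s (s≤s z≤n)))) 4^l≤n
  l≤nQ : l ≤ n * Q
  l≤nQ = ≤-trans l≤n (≤-trans (≤-reflexive (sym (*-identityʳ n))) (*-monoʳ-≤ n (*>0 0<n 0<n)))
  t≤17n : t ≤ 17 * n
  t≤17n = ≤-trans (+-monoʳ-≤ (7 * n) (*-monoʳ-≤ 10 0<n)) (≤-reflexive (sym (*-distribʳ-+ n 7 10)))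
  μl≤Q : μ * l ≤ (c + 2) * Q
  μl≤Q = begin
    μ * l ≤⟨ μl≤ ⟩
    m + (l + X * X) ≤⟨ +-mono-≤ m≤ (+-mono-≤ (≤-trans l≤n n≤Q) (≤-trans (≤-reflexive (sym 4^l≡X*X)) (≤-trans 4^l≤n n≤Q))) ⟩
    c * Q + (Q + Q) ≡⟨ eq c Q ⟩
    (c + 2) * Q ∎
    where
    eq : ∀ c q → c * q + (q + q) ≡ (c + 2) * q
    eq = solve-∀
  expand : ∀ t μ m l → 2 * suc (t * μ + m) * (3 * l) ≡ 6 * (l + t * (μ * l) + m * l)
  expand t μ m l = eq t μ m l
    where
    eq : ∀ t μ m l → 2 * (1 + (t * μ + m)) * (3 * l) ≡ 6 * (l + t * (μ * l) + m * l)
    eq = solve-∀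
  collect : ∀ c n → 6 * (n * (n * n) + 17 * n * ((c + 2) * (n * n)) + c * (n * n) * n) ≡ 6 * (1 + 17 * (c + 2) + c) * (n * (n * (n * 1)))
  collect = solve-∀

-- The two final bounds

k≤L3 : ∀ k N → 2 ^ (2 ^ (2 ^ k)) ≤ N → k ≤ L3 N
k≤L3 k N le = 2^k≤⇒k≤⌊log₂⌋ (2^k≤⇒k≤⌊log₂⌋ (2^k≤⇒k≤⌊log₂⌋ le))

L3≤L2 : ∀ N → L3 N ≤ L2 N
L3≤L2 N with L2 N
... | zero = z≤n
... | n@(suc _) = <⇒≤ (<-≤-trans (n<2^n ⌊log₂ n ⌋) (2^⌊log₂⌋≤ n (s≤s z≤n)))

-- The quartic estimate arises from the cubic one on multiplication by L3 N ≤ L2 N, with the same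
-- constants.
cube⇒bounds : ∀ C N₀ →
  (∀ N → N₀ ≤ N → ∀ d (a : Fin d → ℕ) → (∀ i → 0 < a i) → HinVN a N → d * L3 N ≤ C * L2 N ^ 3) →
  (∃₂ λ C N₀ → ∀ N → N₀ ≤ N → ∀ d (a : Fin d → ℕ) →
    (∀ i → 0 < a i) → Injective _≡_ _≡_ a → HinVN a N →
    d * L3 N ≤ C * L2 N ^ 3)
    ×
    (∃₂ λ C N₀ → ∀ N → N₀ ≤ N → ∀ d (a : Fin d → ℕ) →
    (∀ i → 0 < a i) → HinVN a N →
    d * L3 N ^ 2 ≤ C * L2 N ^ 4)
cube⇒bounds C N₀ cube = (C , N₀ , λ N N₀≤N d a a>0 _ hyp → cube N N₀≤N d a a>0 hyp) ,
  (C , N₀ , λ N N₀≤N d a a>0 hyp → general N d (cube N N₀≤N d a a>0 hyp))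
  where
  general : ∀ N d → d * L3 N ≤ C * L2 N ^ 3 → d * L3 N ^ 2 ≤ C * L2 N ^ 4
  general N d h = begin
    d * L3 N ^ 2 ≡⟨ eq₁ d (L3 N) ⟩
    d * L3 N * L3 N ≤⟨ *-mono-≤ h (L3≤L2 N) ⟩
    C * L2 N ^ 3 * L2 N ≡⟨ eq₂ C (L2 N) ⟩
    C * L2 N ^ 4 ∎
    where
    open ≤-Reasoning
    eq₁ : ∀ d x → d * (x * (x * 1)) ≡ d * x * x
    eq₁ = solve-∀
    eq₂ : ∀ c x → c * (x * (x * (x * 1))) * x ≡ c * (x * (x * (x * (x * 1))))
    eq₂ = solve-∀

theorem4 : (∃₂ λ C N₀ → ∀ N → N₀ ≤ N → ∀ d (a : Fin d → ℕ) →
    (∀ i → 0 < a i) → Injective _≡_ _≡_ a → HinVN a N →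
    d * L3 N ≤ C * L2 N ^ 3)
    ×
    (∃₂ λ C N₀ → ∀ N → N₀ ≤ N → ∀ d (a : Fin d → ℕ) →
    (∀ i → 0 < a i) → HinVN a N →
    d * L3 N ^ 2 ≤ C * L2 N ^ 4)
theorem4 = cube⇒bounds (6 * (1 + 17 * (c₀ + 2) + c₀)) (2 ^ (2 ^ (2 ^ 17)))
  (λ N N₀≤N → powerCube-bound c₀ Parameters.m≤c₀n² N (k≤L3 17 N N₀≤N))
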